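{- Let $n,k$ be positive integers with $k\le n$. (a) If $n\le2$, then $\mathfrak{r}_{\triangle_{n,k}}$ is $p$-positive. (b) If $n\ge3$ is odd, then $\mathfrak{r}_{\triangle_{n,k}}$ is $p$-positive if and only if $k\in\{1,3,n-2,n\}$. (c) If $n\ge4$ is even, then $\mathfrak{r}_{\triangle_{n,k}}$ is $p$-positive if and only if $k\in\{1,3,n/2,n/2+1,n-2,n\}$.
   Context: Boxes are indexed $(i,j)$, row $i$ from the top, column $j$ from the left. For a composition $\alpha=(\alpha_1,\dots,\alpha_\ell)$, the ribbon $\alpha$ is the set of boxes in which row $i$ has $\alpha_i$ consecutive boxes and, for $i<\ell$, the leftmost box of row $i$ lies directly above the rightmost box of row $i+1$. A marked shifted tableau of it is a filling by letters of $\{1'<1<2'<2<\cdots\}$ with weakly increasing rows and columns, at most one unmarked $k$ per column and at most one $k'$ per row for each $k$; the content $(c_1,c_2,\dots)$ counts entries with unmarked value $i$. $\mathfrak{r}_\alpha=\sum_Tx_1^{c_1}x_2^{c_2}\cdots$ over all such tableaux. For $1\le k\le n$, $\triangle_{n,k}$ is the ribbon with composition $(1^{k-1},n-k+1)$. A symmetric function is $p$-positive if all its coefficients in the basis of power sums $p_\lambda=\prod_ip_{\lambda_i}$, $p_r=\sum_jx_j^r$, are nonnegative. -}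

module Defs where

open import Data.Nat using (ℕ; zero; suc; _+_; _*_; _∸_; _≤ᵇ_; _<ᵇ_; _≡ᵇ_)
open import Data.Nat.DivMod using (_/_; _%_)
open import Data.Bool using (Bool; true; false; _∧_; _∨_; not; if_then_else_)
open import Data.List using (List; []; _∷_; _++_; map; concatMap; filter; length; zip; replicate; upTo; foldr; all; filterᵇ)
open import Data.Nat.ListAction using (sum)
open import Data.Product using (_×_; _,_; proj₁; proj₂; Σ)
open import Data.Vec using (Vec; tabulate)
open import Data.Fin using (Fin; toℕ)
open import Relation.Binary.PropositionalEquality using (_≡_)
open import Relation.Nullary.Decidable using (⌊_⌋)
open import Data.Vec.Properties using (≡-dec)
import Data.Nat.Properties as ℕP
open import Data.Integer using (+_)
open import Data.Rational using (ℚ; 0ℚ; _≤_) renaming (_+_ to _+ℚ_; _*_ to _*ℚ_)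
import Data.Rational as ℚ

allLists : ℕ → ℕ → List (List ℕ)
allLists zero    b = [] ∷ []
allLists (suc l) b = concatMap (λ x → map (x ∷_) (allLists l b)) (upTo b)

-- Ribbons.  A box is (row , column).  For a composition α = (α₁,…,α_ℓ),
-- row i (i = 1,…,ℓ, from the top) has αᵢ consecutive boxes, and the
-- leftmost box of row i lies directly above the rightmost box of row i+1.
-- We put the first box of the last row in column 1.

rowBoxes : ℕ → ℕ → ℕ → List (ℕ × ℕ)
rowBoxes i s a = map (λ t → (i , s + t)) (upTo a)

-- ribbonAux i α = (boxes of the ribbon α with first row indexed i ,
--                  column of the leftmost box of its first row)
ribbonAux : ℕ → List ℕ → List (ℕ × ℕ) × ℕ
ribbonAux i []            = [] , 1
ribbonAux i (a ∷ [])      = rowBoxes i 1 a , 1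
ribbonAux i (a ∷ b ∷ rest) =
  let r = ribbonAux (suc i) (b ∷ rest)
      s = proj₂ r + b ∸ 1           -- column of the rightmost box of row i+1
  in rowBoxes i s a ++ proj₁ r , s

ribbon : List ℕ → List (ℕ × ℕ)
ribbon α = proj₁ (ribbonAux 1 α)

triangle : ℕ → ℕ → List ℕ
triangle n k = replicate (k ∸ 1) 1 ++ ((n ∸ k + 1) ∷ [])

-- Marked letters 1' < 1 < 2' < 2 < ⋯ are encoded by natural codes
--   (v')  ↦ 2(v-1) ,   v ↦ 2(v-1)+1,
-- so the order on letters is the order on codes.
-- With m variables the letters are the codes 0,…,2m-1.

unmarkedValue : ℕ → ℕ          -- 0-indexed: code of v' or v ↦ v-1
unmarkedValue e = e / 2

isMarked : ℕ → Bool
isMarked e = e % 2 ≡ᵇ 0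

pairOK : ((ℕ × ℕ) × ℕ) → ((ℕ × ℕ) × ℕ) → Bool
pairOK ((i , j) , e) ((i' , j') , e') =
  let sameRow = i ≡ᵇ i'
      sameCol = j ≡ᵇ j'
      sameVal = unmarkedValue e ≡ᵇ unmarkedValue e'
      rowBefore = sameRow ∧ (j <ᵇ j')
      colBefore = sameCol ∧ (i <ᵇ i')
  in  (not rowBefore ∨ (e ≤ᵇ e'))
    ∧ (not colBefore ∨ (e ≤ᵇ e'))
    ∧ not (rowBefore ∧ isMarked e ∧ isMarked e' ∧ sameVal)
    ∧ not (colBefore ∧ not (isMarked e) ∧ not (isMarked e') ∧ sameVal)

isMarkedTableau : List (ℕ × ℕ) → List ℕ → Bool
isMarkedTableau boxes T =
  let z = zip boxes T in all (λ x → all (λ y → pairOK x y) z) z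

content : (m : ℕ) → List ℕ → Vec ℕ m
content m T = tabulate (λ j → length (filter (λ e → unmarkedValue e ℕP.≟ toℕ j) T))

vecEq : {m : ℕ} → Vec ℕ m → Vec ℕ m → Bool
vecEq u v = ⌊ ≡-dec ℕP._≟_ u v ⌋

-- coefficient of x₁^{c₁}⋯x_m^{c_m} in 𝔯_α(x₁,…,x_m):
-- the number of marked shifted tableaux of the ribbon α with entries in
-- {1',1,…,m',m} and content c.
ribbonCoeff : List ℕ → (m : ℕ) → Vec ℕ m → ℕ
ribbonCoeff α m c =
  let boxes = ribbon α in
  length (filterᵇ (λ T → isMarkedTableau boxes T ∧ vecEq (content m T) c)
                 (allLists (length boxes) (2 * m)))

-- Power sums.  p_λ(x₁,…,x_m) = ∏ᵢ (∑_j x_j^{λᵢ}); the coefficient of x^c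
-- is the number of maps f : {parts of λ} → {1,…,m} with
-- ∑_{i : f(i) = j} λᵢ = c_j for all j.

weight : (m : ℕ) → List ℕ → List ℕ → Vec ℕ m
weight m lam f = tabulate (λ j → sum (map proj₁ (filter (λ p → proj₂ p ℕP.≟ toℕ j) (zip lam f))))

powerSumCoeff : List ℕ → (m : ℕ) → Vec ℕ m → ℕ
powerSumCoeff lam m c =
  length (filterᵇ (λ f → vecEq (weight m lam f) c) (allLists (length lam) m))

isPartition : ℕ → List ℕ → Bool
isPartition n lam = (sum lam ≡ᵇ n) ∧ positive lam ∧ decreasing lam
  where
  positive : List ℕ → Bool
  positive = all (λ x → 1 ≤ᵇ x)
  decreasing : List ℕ → Bool
  decreasing []            = true
  decreasing (x ∷ [])      = true
  decreasing (x ∷ y ∷ xs)  = (y ≤ᵇ x) ∧ decreasing (y ∷ xs)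

-- each partition of n has at most n parts, each at most n
partitions : ℕ → List (List ℕ)
partitions n = filterᵇ (isPartition n)
                      (concatMap (λ l → allLists l (suc n)) (upTo (suc n)))

ℕtoℚ : ℕ → ℚ
ℕtoℚ k = + k ℚ./ 1

sumℚ : List ℚ → ℚ
sumℚ = foldr _+ℚ_ 0ℚ

-- p-positivity of 𝔯_α (homogeneous of degree |α|): 𝔯_α = ∑_{λ ⊢ |α|} a_λ p_λ
-- with all a_λ ≥ 0, equality of symmetric functions being equality of all
-- coefficients of all finite-variable specialisations.

pPositiveRibbon : List ℕ → Set
pPositiveRibbon α =
  Σ (List ℕ → ℚ) λ a →
    ((lam : List ℕ) → 0ℚ ≤ a lam) ×
    ((m : ℕ) (c : Vec ℕ m) →
       ℕtoℚ (ribbonCoeff α m c)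
         ≡ sumℚ (map (λ lam → a lam *ℚ ℕtoℚ (powerSumCoeff lam m c)) (partitions (sum α))))

{-# OPTIONS --safe #-}
module Submission where

-- Write i = k − 1 and j = n − k, and let q_l be the generating function of a single row, which is
-- also that of a single column.  Gluing a column to a row in the two possible ways gives
--   hook(i + 1, j) + hook(i, j + 1) = q_{i+1} q_{j+1},
-- so the hook is symmetric in i and j, and it is an alternating sum of products q_a q_b.
-- Since Q(t) = ∑ q_l t^l = ∏ (1 + x t)/(1 − x t) = exp(2 ∑_{r odd} p_r t^r / r), the coefficient of p_ρ
-- in the hook is a positive multiple of the coefficient of t^i in ∏_{r ∈ ρ} (1 + t^r) / (1 + t) if all
-- parts of ρ are odd, and zero otherwise.  This is nonnegative for i = 0 and i = 2, and
-- 2 hook(i, i + 1) = q_{i+1}².  In the remaining cases it is negative for a suitable ρ: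
--   (n)                        if i and j are odd,
--   (i − 1, j − 1, 3)          if i, j ≥ 4 are even,
--   (i + 2, j − 1)             if i is odd, j is even and j ≥ i + 3,
--   (i − 1, 3, j − 4, 3)       if i ≥ 4 is even, j is odd and j ≥ i + 3.
-- The q_l enter through the recursion l q_l = 2 ∑_{r odd} p_r q_{l−r}, and the symmetric functions
-- through linear functionals: a weight f on contents stands for the coefficients being read off.

open import Algebra.Bundles using (CommutativeRing)
import Algebra.Properties.Ring
open import Algebra.Structures using (IsCommutativeRing)
open import Data.Bool using (Bool; true; false; _∧_; not; _xor_; T; if_then_else_)
open import Data.Bool.ListAction using (all)
open import Data.Bool.Properties using (∧-zeroʳ; ∧-identityʳ; ∧-assoc; not-injective; xor-same; T?)
open import Data.Empty using (⊥-elim)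
open import Data.Fin using (Fin; toℕ)
import Data.Fin as Fin
import Data.Integer as ℤ
import Data.Integer.Properties as ℤ
open import Data.List using (List; []; _∷_; _++_; map; concatMap; length; upTo; applyUpTo; filter; filterᵇ; replicate; zip)
open import Data.List.Membership.Propositional using (_∈_; lose)
open import Data.List.Membership.Propositional.Properties using (∈-map⁺; ∈-map⁻; ∈-concatMap⁺; ∈-concatMap⁻; ∈-upTo⁺; ∈-filter⁺)
open import Data.List.Properties using (length-++; length-map; length-upTo)
import Data.List.Relation.Binary.Permutation.Propositional as ↭
open import Data.List.Relation.Binary.Permutation.Propositional using (_↭_; ↭-sym; ↭⇒↭ₛ)
open import Data.List.Relation.Binary.Permutation.Propositional.Properties using (All-resp-↭; ↭-length)
open import Data.List.Relation.Binary.Pointwise using (Pointwise-≡⇒≡)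
import Data.List.Relation.Unary.All as All
open import Data.List.Relation.Unary.All using (All; []; _∷_)
open import Data.List.Relation.Unary.Any using (here; there; satisfied)
open import Data.List.Relation.Unary.Linked using (Linked; []; [-]; _∷_)
open import Data.List.Relation.Unary.Sorted.TotalOrder.Properties using (↗↭↗⇒≋)
import Data.List.Sort as Sort
open import Data.Nat using (ℕ; zero; suc; _+_; _*_; _∸_; _≤ᵇ_; _<ᵇ_; _≡ᵇ_; _<_; _≤_; _≥_; z≤n; s≤s; z<s; s<s; s≤s⁻¹; compare; less; equal; greater)
open import Data.Nat.Divisibility using (∣-refl)
open import Data.Nat.DivMod using (_/_; _%_; +-distrib-/-∣ˡ; m*n/n≡m; m≡m%n+[m/n]*n)
open import Data.Nat.ListAction using (sum)
open import Data.Nat.ListAction.Properties using (sum-↭)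
import Data.Nat.Properties as ℕ
open import Data.Nat.Tactic.RingSolver using (solve-∀)
open import Data.Product using (_×_; _,_; proj₁; proj₂; ∃-syntax)
open import Data.Rational using (ℚ; 0ℚ; 1ℚ)
import Data.Rational as ℚ
import Data.Rational.Properties as ℚ
import Data.Rational.Unnormalised as ℚᵘ
import Data.Rational.Unnormalised.Properties as ℚᵘ
open import Data.Sum using (_⊎_; inj₁; inj₂; [_,_]′)
open import Data.Vec using (Vec; []; _∷_; tabulate; zipWith; fromList)
open import Data.Vec.Properties using (tabulate-cong; zipWith-comm; zipWith-assoc; ≡-dec)
open import Defs
open import Function using (_∘_; mk⇔; _⇔_)
open import Relation.Binary.Bundles using (DecTotalOrder)
import Relation.Binary.Construct.Flip.EqAndOrd as Flip
open import Relation.Binary.PropositionalEquality using (_≡_; refl; sym; trans; cong; cong₂; subst; module ≡-Reasoning)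
open import Relation.Nullary using (yes; no; ¬_; contradiction)

open ≡-Reasoning

-- Dividing the recursion by the total degree n strips one odd part r off a product q_i q_j with the
-- factor 2/n, whichever row r came from. Iterating it yields ordered compositions weighted by
-- products of 2/(tail sum), not partitions with z_λ; the rearrangements of a partition are added up
-- only at the end. Signs survive this, because the weights are positive and the coefficient of tⁱ
-- ignores the order of the parts. A p-expansion is here an arbitrary family of rationals, so
-- refuting positivity needs the linear independence of the p_λ, while proving it does not. The
-- negative ρ are dictated by the denominator 1 + t. A part 1 would cancel it and leave nonnegative
-- coefficients, so every part must be at least 3. If all parts exceed i, the coefficient is the
-- (-1)ⁱ of 1/(1 + t), which settles odd i. For even i, a part 3 cuts the series down to (1 + t³)/(1
-- + t) = 1 - t + t², and a part i - 1 carries its -t to degree i.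

private variable
  m : ℕ
  A A′ : Set

-- Opaque copies of the operations of ℚ: the originals unfold eagerly, which defeats unification.
infixl 6 _+ℚ_
infixl 7 _*ℚ_
infix  8 -ℚ_

opaque
  _+ℚ_ _*ℚ_ : ℚ → ℚ → ℚ
  _+ℚ_ = ℚ._+_
  _*ℚ_ = ℚ._*_

  -ℚ_ : ℚ → ℚ
  -ℚ_ = ℚ.-_

  +ℚ-def : ∀ x y → x +ℚ y ≡ x ℚ.+ y
  +ℚ-def x y = refl

  *ℚ-def : ∀ x y → x *ℚ y ≡ x ℚ.* y
  *ℚ-def x y = refl

  ℚ-isCommutativeRing : IsCommutativeRing _≡_ _+ℚ_ _*ℚ_ -ℚ_ 0ℚ 1ℚ
  ℚ-isCommutativeRing = ℚ.+-*-isCommutativeRing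

ℚ-commutativeRing : CommutativeRing _ _
ℚ-commutativeRing = record { isCommutativeRing = ℚ-isCommutativeRing }

module K = CommutativeRing ℚ-commutativeRing

open Algebra.Properties.Ring K.ring using (-‿involutive)
open import Algebra.Solver.Ring.NaturalCoefficients.Default K.commutativeSemiring
  using (solve; _:=_; _:+_; _:*_; con)

2ℚ : ℚ
2ℚ = 1ℚ +ℚ 1ℚ

-- Finite sums

∑ : List A → (A → ℚ) → ℚ
∑ []       f = 0ℚ
∑ (x ∷ xs) f = f x +ℚ ∑ xs f

sumℚ-map : (f : A → ℚ) (xs : List A) → sumℚ (map f xs) ≡ ∑ xs f
sumℚ-map f []       = refl
sumℚ-map f (x ∷ xs) = trans (cong (f x ℚ.+_) (sumℚ-map f xs)) (sym (+ℚ-def (f x) _))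

∑-cong-∈ : {f g : A → ℚ} (xs : List A) → (∀ {x} → x ∈ xs → f x ≡ g x) → ∑ xs f ≡ ∑ xs g
∑-cong-∈ []       eq = refl
∑-cong-∈ (x ∷ xs) eq = cong₂ _+ℚ_ (eq (here refl)) (∑-cong-∈ xs (eq ∘ there))

∑-cong : {f g : A → ℚ} (xs : List A) → (∀ x → f x ≡ g x) → ∑ xs f ≡ ∑ xs g
∑-cong xs eq = ∑-cong-∈ xs λ {x} _ → eq x

∑-zero : (xs : List A) → ∑ xs (λ _ → 0ℚ) ≡ 0ℚ
∑-zero []       = refl
∑-zero (x ∷ xs) = trans (K.+-identityˡ _) (∑-zero xs)

+ℚ-interchange : ∀ a b c d → (a +ℚ b) +ℚ (c +ℚ d) ≡ (a +ℚ c) +ℚ (b +ℚ d)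
+ℚ-interchange = solve 4 (λ a b c d → (a :+ b) :+ (c :+ d) := (a :+ c) :+ (b :+ d)) refl

∑-+ : (xs : List A) (f g : A → ℚ) → ∑ xs (λ x → f x +ℚ g x) ≡ ∑ xs f +ℚ ∑ xs g
∑-+ []       f g = sym (K.+-identityˡ 0ℚ)
∑-+ (x ∷ xs) f g = trans (cong ((f x +ℚ g x) +ℚ_) (∑-+ xs f g)) (+ℚ-interchange (f x) (g x) _ _)

∑-*ˡ : (c : ℚ) (xs : List A) (f : A → ℚ) → ∑ xs (λ x → c *ℚ f x) ≡ c *ℚ ∑ xs f
∑-*ˡ c []       f = sym (K.zeroʳ c)
∑-*ˡ c (x ∷ xs) f = trans (cong (c *ℚ f x +ℚ_) (∑-*ˡ c xs f)) (sym (K.distribˡ c _ _))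

∑-*ʳ : (c : ℚ) (xs : List A) (f : A → ℚ) → ∑ xs (λ x → f x *ℚ c) ≡ ∑ xs f *ℚ c
∑-*ʳ c xs f = trans (∑-cong xs λ x → K.*-comm (f x) c) (trans (∑-*ˡ c xs f) (K.*-comm c _))

∑-swap : (xs : List A) (ys : List A′) (f : A → A′ → ℚ) →
         ∑ xs (λ x → ∑ ys (f x)) ≡ ∑ ys (λ y → ∑ xs (λ x → f x y))
∑-swap []       ys f = sym (∑-zero ys)
∑-swap (x ∷ xs) ys f = trans (cong (∑ ys (f x) +ℚ_) (∑-swap xs ys f)) (sym (∑-+ ys (f x) _))

∑-++ : (xs ys : List A) (f : A → ℚ) → ∑ (xs ++ ys) f ≡ ∑ xs f +ℚ ∑ ys f
∑-++ []       ys f = sym (K.+-identityˡ _)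
∑-++ (x ∷ xs) ys f = trans (cong (f x +ℚ_) (∑-++ xs ys f)) (sym (K.+-assoc (f x) _ _))

∑-map : (g : A → A′) (xs : List A) (f : A′ → ℚ) → ∑ (map g xs) f ≡ ∑ xs (f ∘ g)
∑-map g []       f = refl
∑-map g (x ∷ xs) f = cong (f (g x) +ℚ_) (∑-map g xs f)

∑-concatMap : (g : A → List A′) (xs : List A) (f : A′ → ℚ) →
              ∑ (concatMap g xs) f ≡ ∑ xs (λ x → ∑ (g x) f)
∑-concatMap g []       f = refl
∑-concatMap g (x ∷ xs) f =
  trans (∑-++ (g x) (concatMap g xs) f) (cong (∑ (g x) f +ℚ_) (∑-concatMap g xs f))

∑-applyUpTo : (g : ℕ → A) (n : ℕ) (f : A → ℚ) → ∑ (applyUpTo g n) f ≡ ∑ (upTo n) (f ∘ g)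
∑-applyUpTo g zero    f = refl
∑-applyUpTo g (suc n) f = cong (f (g 0) +ℚ_)
  (trans (∑-applyUpTo (g ∘ suc) n f) (sym (∑-applyUpTo suc n (f ∘ g))))

∑-upTo-suc : (n : ℕ) (f : ℕ → ℚ) → ∑ (upTo (suc n)) f ≡ f 0 +ℚ ∑ (upTo n) (f ∘ suc)
∑-upTo-suc n f = cong (f 0 +ℚ_) (∑-applyUpTo suc n f)

-- Indicators, and counting as summation

⟦_⟧ : Bool → ℚ
⟦ true ⟧  = 1ℚ
⟦ false ⟧ = 0ℚ

⟦∧⟧ : ∀ a b → ⟦ a ∧ b ⟧ ≡ ⟦ a ⟧ *ℚ ⟦ b ⟧
⟦∧⟧ true  b = sym (K.*-identityˡ _)
⟦∧⟧ false b = sym (K.zeroˡ ⟦ b ⟧)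

ℕtoℚ-+ : ∀ m n → ℕtoℚ (m + n) ≡ ℕtoℚ m +ℚ ℕtoℚ n
ℕtoℚ-+ m n = trans (ℚ.toℚᵘ-injective (begin′
  ℚ.toℚᵘ (ℕtoℚ (m + n))                         ≈⟨ ℚ.toℚᵘ-fromℚᵘ (ℚᵘ.mkℚᵘ (ℤ.+ (m + n)) 0) ⟩
  ℚᵘ.mkℚᵘ (ℤ.+ (m + n)) 0                       ≈⟨ ℚᵘ.*≡* (cong (ℤ._* ℤ.+ 1) (sym (cong₂ ℤ._+_ (ℤ.*-identityʳ (ℤ.+ m)) (ℤ.*-identityʳ (ℤ.+ n))))) ⟩
  ℚᵘ.mkℚᵘ (ℤ.+ m) 0 ℚᵘ.+ ℚᵘ.mkℚᵘ (ℤ.+ n) 0      ≈⟨ ℚᵘ.+-cong (ℚ.toℚᵘ-fromℚᵘ (ℚᵘ.mkℚᵘ (ℤ.+ m) 0)) (ℚ.toℚᵘ-fromℚᵘ (ℚᵘ.mkℚᵘ (ℤ.+ n) 0)) ⟨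
  ℚ.toℚᵘ (ℕtoℚ m) ℚᵘ.+ ℚ.toℚᵘ (ℕtoℚ n)          ≈⟨ ℚ.toℚᵘ-homo-+ (ℕtoℚ m) (ℕtoℚ n) ⟨
  ℚ.toℚᵘ (ℕtoℚ m ℚ.+ ℕtoℚ n)                    ∎′)) (sym (+ℚ-def (ℕtoℚ m) (ℕtoℚ n)))
  where open import Relation.Binary.Reasoning.Setoid ℚᵘ.≃-setoid renaming (begin_ to begin′_; _∎ to _∎′)

ℕtoℚ-length-filterᵇ : (p : A → Bool) (xs : List A) →
                      ℕtoℚ (length (filterᵇ p xs)) ≡ ∑ xs (λ x → ⟦ p x ⟧)
ℕtoℚ-length-filterᵇ p []       = refl
ℕtoℚ-length-filterᵇ p (x ∷ xs) with p x
... | true  = trans (ℕtoℚ-+ 1 (length (filterᵇ p xs))) (cong (1ℚ +ℚ_) (ℕtoℚ-length-filterᵇ p xs))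
... | false = trans (ℕtoℚ-length-filterᵇ p xs) (sym (K.+-identityˡ _))

∑-filterᵇ : (p : A → Bool) (xs : List A) (f : A → ℚ) →
            ∑ (filterᵇ p xs) f ≡ ∑ xs (λ x → ⟦ p x ⟧ *ℚ f x)
∑-filterᵇ p []       f = refl
∑-filterᵇ p (x ∷ xs) f with p x
... | true  = cong₂ _+ℚ_ (sym (K.*-identityˡ (f x))) (∑-filterᵇ p xs f)
... | false = trans (∑-filterᵇ p xs f)
  (sym (trans (cong (_+ℚ ∑ xs (λ y → ⟦ p y ⟧ *ℚ f y)) (K.zeroˡ (f x))) (K.+-identityˡ _)))

-- Sums over words

∑-allLists-suc : ∀ l b (F : List ℕ → ℚ) →
  ∑ (allLists (suc l) b) F ≡ ∑ (upTo b) λ x → ∑ (allLists l b) λ t → F (x ∷ t)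
∑-allLists-suc l b F = trans (∑-concatMap (λ x → map (x ∷_) (allLists l b)) (upTo b) F)
  (∑-cong (upTo b) λ x → ∑-map (x ∷_) (allLists l b) F)

∑-allLists-++ : ∀ i j b (F : List ℕ → ℚ) →
  ∑ (allLists (i + j) b) F ≡ ∑ (allLists i b) λ u → ∑ (allLists j b) λ v → F (u ++ v)
∑-allLists-++ zero    j b F = sym (K.+-identityʳ _)
∑-allLists-++ (suc i) j b F = begin
  ∑ (allLists (suc i + j) b) F
    ≡⟨ ∑-allLists-suc (i + j) b F ⟩
  ∑ (upTo b) (λ x → ∑ (allLists (i + j) b) λ t → F (x ∷ t))
    ≡⟨ ∑-cong (upTo b) (λ x → ∑-allLists-++ i j b (F ∘ (x ∷_))) ⟩
  ∑ (upTo b) (λ x → ∑ (allLists i b) λ u → ∑ (allLists j b) λ v → F (x ∷ u ++ v))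
    ≡⟨ ∑-allLists-suc i b (λ u → ∑ (allLists j b) λ v → F (u ++ v)) ⟨
  ∑ (allLists (suc i) b) (λ u → ∑ (allLists j b) λ v → F (u ++ v)) ∎

-- `allLists` grows words at the front, but a column and a row are glued at their last letters, so
-- these must be split off instead.
∑-allLists-∷ʳ : ∀ l b (F : List ℕ → ℚ) →
  ∑ (allLists (suc l) b) F ≡ ∑ (allLists l b) λ u → ∑ (upTo b) λ e → F (u ++ e ∷ [])
∑-allLists-∷ʳ zero b F = begin
  ∑ (allLists 1 b) F                              ≡⟨ ∑-allLists-suc 0 b F ⟩
  ∑ (upTo b) (λ x → F (x ∷ []) +ℚ 0ℚ)             ≡⟨ ∑-cong (upTo b) (λ x → K.+-identityʳ (F (x ∷ []))) ⟩
  ∑ (upTo b) (λ x → F (x ∷ []))                   ≡⟨ K.+-identityʳ _ ⟨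
  ∑ (upTo b) (λ x → F (x ∷ [])) +ℚ 0ℚ             ∎
∑-allLists-∷ʳ (suc l) b F = begin
  ∑ (allLists (suc (suc l)) b) F
    ≡⟨ ∑-allLists-suc (suc l) b F ⟩
  ∑ (upTo b) (λ x → ∑ (allLists (suc l) b) λ t → F (x ∷ t))
    ≡⟨ ∑-cong (upTo b) (λ x → ∑-allLists-∷ʳ l b (F ∘ (x ∷_))) ⟩
  ∑ (upTo b) (λ x → ∑ (allLists l b) λ u → ∑ (upTo b) λ e → F (x ∷ u ++ e ∷ []))
    ≡⟨ ∑-allLists-suc l b (λ u → ∑ (upTo b) λ e → F (u ++ e ∷ [])) ⟨
  ∑ (allLists (suc l) b) (λ u → ∑ (upTo b) λ e → F (u ++ e ∷ [])) ∎

-- Rows and columns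

-- Coefficient of a Cauchy product, with a two-index weight in place of a product: later `h a b` is
-- a functional of degree b applied to a weight that already depends on a.
conv : ℕ → (ℕ → ℕ → ℚ) → ℚ
conv zero    h = h 0 0
conv (suc l) h = h 0 (suc l) +ℚ conv l (λ a b → h (suc a) b)

conv-cong : ∀ l {h h′ : ℕ → ℕ → ℚ} → (∀ a b → a + b ≡ l → h a b ≡ h′ a b) → conv l h ≡ conv l h′
conv-cong zero    eq = eq 0 0 refl
conv-cong (suc l) eq = cong₂ _+ℚ_ (eq 0 (suc l) refl) (conv-cong l λ a b p → eq (suc a) b (cong suc p))

conv-+ : ∀ l (h h′ : ℕ → ℕ → ℚ) → conv l (λ a b → h a b +ℚ h′ a b) ≡ conv l h +ℚ conv l h′
conv-+ zero    h h′ = refl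
conv-+ (suc l) h h′ =
  trans (cong ((h 0 (suc l) +ℚ h′ 0 (suc l)) +ℚ_) (conv-+ l _ _)) (+ℚ-interchange (h 0 (suc l)) _ _ _)

conv-*ˡ : ∀ c l (h : ℕ → ℕ → ℚ) → conv l (λ a b → c *ℚ h a b) ≡ c *ℚ conv l h
conv-*ˡ c zero    h = refl
conv-*ˡ c (suc l) h = trans (cong (c *ℚ h 0 (suc l) +ℚ_) (conv-*ˡ c l _)) (sym (K.distribˡ c _ _))

-- The coefficient of xᵃ in (1 + x) / (1 − x).
κ : ℕ → ℚ
κ zero    = 1ℚ
κ (suc _) = 2ℚ

-- `κ` is 2 except at 0, and the extra `h 0 l` makes up the difference. This form needs no
-- subtraction.
conv-κ : ∀ l (h : ℕ → ℕ → ℚ) →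
         conv l (λ a b → κ a *ℚ h a b) +ℚ h 0 l ≡ 2ℚ *ℚ conv l h
conv-κ zero    h = solve 1 (λ x → con 1 :* x :+ x := con 2 :* x) refl (h 0 0)
conv-κ (suc l) h = begin
  (1ℚ *ℚ x +ℚ conv l (λ a b → 2ℚ *ℚ h (suc a) b)) +ℚ x
    ≡⟨ cong (λ y → (1ℚ *ℚ x +ℚ y) +ℚ x) (conv-*ˡ 2ℚ l _) ⟩
  (1ℚ *ℚ x +ℚ 2ℚ *ℚ y) +ℚ x
    ≡⟨ solve 2 (λ x y → (con 1 :* x :+ con 2 :* y) :+ x := con 2 :* (x :+ y)) refl x y ⟩
  2ℚ *ℚ (x +ℚ y) ∎
  where
  x = h 0 (suc l)
  y = conv l (λ a b → h (suc a) b)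

-- On exponent vectors this is multiplication by x_v^r. An index past the end changes nothing, in
-- agreement with `content` and `weight`, which tabulate only the m variables.
addAt : ℕ → ℕ → Vec ℕ m → Vec ℕ m
addAt v       r []       = []
addAt zero    r (d ∷ ds) = (r + d) ∷ ds
addAt (suc v) r (d ∷ ds) = d ∷ addAt v r ds

tabulate-addAt : ∀ v r {g h : Fin m → ℕ} →
  (∀ j → h j ≡ (if v ≡ᵇ toℕ j then r else 0) + g j) → tabulate h ≡ addAt v r (tabulate g)
tabulate-addAt {zero}  v       r eq = refl
tabulate-addAt {suc m} zero    r eq = cong₂ _∷_ (eq Fin.zero) (tabulate-cong (eq ∘ Fin.suc))
tabulate-addAt {suc m} (suc v) r eq = cong₂ _∷_ (eq Fin.zero) (tabulate-addAt v r (eq ∘ Fin.suc))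

content-∷ : ∀ m x t → content m (x ∷ t) ≡ addAt (x / 2) 1 (content m t)
content-∷ m x t = tabulate-addAt (x / 2) 1 λ j → pointwise (toℕ j)
  where
  pointwise : ∀ j → length (filter (λ e → unmarkedValue e ℕ.≟ j) (x ∷ t))
                  ≡ (if x / 2 ≡ᵇ j then 1 else 0) + length (filter (λ e → unmarkedValue e ℕ.≟ j) t)
  pointwise j with x / 2 ≡ᵇ j
  ... | true  = refl
  ... | false = refl

weight-∷ : ∀ m r lam v f → weight m (r ∷ lam) (v ∷ f) ≡ addAt v r (weight m lam f)
weight-∷ m r lam v f = tabulate-addAt v r λ j → pointwise (toℕ j)
  where
  pointwise : ∀ j → sum (map proj₁ (filter (λ p → proj₂ p ℕ.≟ j) (zip (r ∷ lam) (v ∷ f))))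
                  ≡ (if v ≡ᵇ j then r else 0) + sum (map proj₁ (filter (λ p → proj₂ p ℕ.≟ j) (zip lam f)))
  pointwise j with v ≡ᵇ j
  ... | true  = refl
  ... | false = refl

[2+m]/2 : ∀ x → (2 + x) / 2 ≡ suc (x / 2)
[2+m]/2 x = +-distrib-/-∣ˡ x (∣-refl {2})

content-shift : ∀ m t → content (suc m) (map (2 +_) t) ≡ 0 ∷ content m t
content-shift m []      = cong (0 ∷_) refl
content-shift m (x ∷ t) = begin
  content (suc m) (2 + x ∷ map (2 +_) t)                 ≡⟨ content-∷ (suc m) (2 + x) (map (2 +_) t) ⟩
  addAt ((2 + x) / 2) 1 (content (suc m) (map (2 +_) t)) ≡⟨ cong₂ (λ v → addAt v 1) ([2+m]/2 x) (content-shift m t) ⟩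
  0 ∷ addAt (x / 2) 1 (content m t)                      ≡⟨ cong (0 ∷_) (content-∷ m x t) ⟨
  0 ∷ content m (x ∷ t)                                  ∎

-- y may stand below x in a column, resp. to the right of x in a row.
colLE rowLE : ℕ → ℕ → Bool
colLE zero          y             = true
colLE (suc zero)    zero          = false
colLE (suc zero)    (suc zero)    = false
colLE (suc zero)    (suc (suc y)) = true
colLE (suc (suc x)) zero          = false
colLE (suc (suc x)) (suc zero)    = false
colLE (suc (suc x)) (suc (suc y)) = colLE x y
rowLE zero          zero          = false
rowLE zero          (suc y)       = true
rowLE (suc zero)    zero          = false
rowLE (suc zero)    (suc y)       = true
rowLE (suc (suc x)) zero          = false
rowLE (suc (suc x)) (suc zero)    = false
rowLE (suc (suc x)) (suc (suc y)) = rowLE x y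

-- All pairs are compared, not only neighbours, to match `isMarkedTableau`.
chain : {A : Set} → (A → A → Bool) → List A → Bool
chain R []      = true
chain R (x ∷ t) = all (R x) t ∧ chain R t

all-cong : {A : Set} {p q : A → Bool} → (∀ y → p y ≡ q y) → ∀ t → all p t ≡ all q t
all-cong eq []      = refl
all-cong eq (x ∷ t) = cong₂ _∧_ (eq x) (all-cong eq t)

all-0≤ᵇ : ∀ t → all (0 ≤ᵇ_) t ≡ true
all-0≤ᵇ []      = refl
all-0≤ᵇ (x ∷ t) = all-0≤ᵇ t

all-∧-absorb : ∀ {p q : ℕ → Bool} → (∀ y → p y ≡ true → q y ≡ true) →
               ∀ t → all q t ∧ all p t ≡ all p t
all-∧-absorb         imp []      = refl
all-∧-absorb {p} {q} imp (x ∷ t) with p x | imp x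
... | true  | px⇒qx rewrite px⇒qx refl = all-∧-absorb imp t
... | false | _ = ∧-zeroʳ _

suc-≤ᵇ : ∀ k x → (suc k ≤ᵇ suc x) ≡ (k ≤ᵇ x)
suc-≤ᵇ zero    x = refl
suc-≤ᵇ (suc k) x = refl

≤ᵇ-trans : ∀ k {x y} → (k ≤ᵇ x) ≡ true → (x ≤ᵇ y) ≡ true → (k ≤ᵇ y) ≡ true
≤ᵇ-trans zero                    p q = refl
≤ᵇ-trans (suc k) {suc x} {suc y} p q =
  trans (suc-≤ᵇ k y) (≤ᵇ-trans k (trans (sym (suc-≤ᵇ k x)) p) (trans (sym (suc-≤ᵇ x y)) q))

∑-upTo-≤ᵇ : ∀ {k b} → k < b → (g : ℕ → ℚ) →
  ∑ (upTo b) (λ x → ⟦ k ≤ᵇ x ⟧ *ℚ g x) ≡ g k +ℚ ∑ (upTo b) (λ x → ⟦ suc k ≤ᵇ x ⟧ *ℚ g x)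
∑-upTo-≤ᵇ {zero} {suc b} _ g = begin
  ∑ (upTo (suc b)) (λ x → 1ℚ *ℚ g x)
    ≡⟨ ∑-upTo-suc b (λ x → 1ℚ *ℚ g x) ⟩
  1ℚ *ℚ g 0 +ℚ r
    ≡⟨ solve 2 (λ x r → con 1 :* x :+ r := x :+ (con 0 :* x :+ r)) refl (g 0) r ⟩
  g 0 +ℚ (0ℚ *ℚ g 0 +ℚ r)
    ≡⟨ cong (g 0 +ℚ_) (∑-upTo-suc b (λ x → ⟦ 1 ≤ᵇ x ⟧ *ℚ g x)) ⟨
  g 0 +ℚ ∑ (upTo (suc b)) (λ x → ⟦ 1 ≤ᵇ x ⟧ *ℚ g x) ∎
  where
  r = ∑ (upTo b) (λ x → 1ℚ *ℚ g (suc x))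
∑-upTo-≤ᵇ {suc k} {suc b} (s≤s k<b) g = begin
  ∑ (upTo (suc b)) (λ x → ⟦ suc k ≤ᵇ x ⟧ *ℚ g x)
    ≡⟨ ∑-upTo-suc b (λ x → ⟦ suc k ≤ᵇ x ⟧ *ℚ g x) ⟩
  0ℚ *ℚ g 0 +ℚ ∑ (upTo b) (λ x → ⟦ suc k ≤ᵇ suc x ⟧ *ℚ g (suc x))
    ≡⟨ cong (0ℚ *ℚ g 0 +ℚ_) (∑-cong (upTo b) λ x → cong (λ c → ⟦ c ⟧ *ℚ g (suc x)) (suc-≤ᵇ k x)) ⟩
  0ℚ *ℚ g 0 +ℚ ∑ (upTo b) (λ x → ⟦ k ≤ᵇ x ⟧ *ℚ g (suc x))
    ≡⟨ cong (0ℚ *ℚ g 0 +ℚ_) (∑-upTo-≤ᵇ k<b (g ∘ suc)) ⟩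
  0ℚ *ℚ g 0 +ℚ (g (suc k) +ℚ r)
    ≡⟨ solve 3 (λ x y r → con 0 :* x :+ (y :+ r) := y :+ (con 0 :* x :+ r)) refl (g 0) (g (suc k)) r ⟩
  g (suc k) +ℚ (0ℚ *ℚ g 0 +ℚ r)
    ≡⟨ cong (g (suc k) +ℚ_) (∑-upTo-suc b (λ x → ⟦ suc (suc k) ≤ᵇ x ⟧ *ℚ g x)) ⟨
  g (suc k) +ℚ ∑ (upTo (suc b)) (λ x → ⟦ suc (suc k) ≤ᵇ x ⟧ *ℚ g x) ∎
  where
  r = ∑ (upTo b) (λ x → ⟦ suc k ≤ᵇ x ⟧ *ℚ g (suc x))

-- Rows and columns are increasing words for two different relations. Removing the letters 1' and 1
-- in turn, and with them the first variable, uses only that the relation refines ≤ and is unchanged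
-- when both codes grow by 2.
module Peel (R : ℕ → ℕ → Bool)
            (R⇒≤ : ∀ x y → R x y ≡ true → (x ≤ᵇ y) ≡ true)
            (R-shift : ∀ x y → R (2 + x) (2 + y) ≡ R x y) where

  chains≥ : ℕ → ℕ → ℕ → (List ℕ → ℚ) → ℚ
  chains≥ k b l F = ∑ (allLists l b) λ t → ⟦ all (k ≤ᵇ_) t ∧ chain R t ⟧ *ℚ F t

  chains≥-suc : ∀ k b l F → chains≥ k b (suc l) F ≡
    ∑ (upTo b) λ x → ⟦ k ≤ᵇ x ⟧ *ℚ ∑ (allLists l b) λ t → ⟦ all (R x) t ∧ chain R t ⟧ *ℚ F (x ∷ t)
  chains≥-suc k b l F = trans (∑-allLists-suc l b _)
    (∑-cong (upTo b) λ x → trans (∑-cong (allLists l b) (split x)) (∑-*ˡ ⟦ k ≤ᵇ x ⟧ (allLists l b) _))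
    where
    split : ∀ x t → ⟦ all (k ≤ᵇ_) (x ∷ t) ∧ chain R (x ∷ t) ⟧ *ℚ F (x ∷ t)
                  ≡ ⟦ k ≤ᵇ x ⟧ *ℚ (⟦ all (R x) t ∧ chain R t ⟧ *ℚ F (x ∷ t))
    split x t with k ≤ᵇ x in k≤x
    ... | false = trans (K.zeroˡ (F (x ∷ t))) (sym (K.zeroˡ _))
    ... | true  = trans (cong (λ c → ⟦ c ⟧ *ℚ F (x ∷ t)) absorb) (sym (K.*-identityˡ _))
      where
      absorb : all (k ≤ᵇ_) t ∧ (all (R x) t ∧ chain R t) ≡ all (R x) t ∧ chain R t
      absorb = trans (sym (∧-assoc (all (k ≤ᵇ_) t) (all (R x) t) (chain R t)))
        (cong (_∧ chain R t) (all-∧-absorb (λ y r → ≤ᵇ-trans k k≤x (R⇒≤ x y r)) t))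

  -- The first letter of an increasing word is its least, so k stands in front or does not occur.
  -- The threshold s is the least letter that may follow k: k itself if it may repeat, the next code
  -- otherwise.
  peel : ∀ {k b} s l F → k < b → (∀ y → R k y ≡ (s ≤ᵇ y)) →
         chains≥ k b (suc l) F ≡ chains≥ s b l (F ∘ (k ∷_)) +ℚ chains≥ (suc k) b (suc l) F
  peel {k} {b} s l F k<b Rk = begin
    chains≥ k b (suc l) F
      ≡⟨ chains≥-suc k b l F ⟩
    ∑ (upTo b) (λ x → ⟦ k ≤ᵇ x ⟧ *ℚ g x)
      ≡⟨ ∑-upTo-≤ᵇ k<b g ⟩
    g k +ℚ ∑ (upTo b) (λ x → ⟦ suc k ≤ᵇ x ⟧ *ℚ g x)
      ≡⟨ cong₂ _+ℚ_ (∑-cong (allLists l b) λ t → cong (λ c → ⟦ c ∧ chain R t ⟧ *ℚ F (k ∷ t)) (all-cong Rk t))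
                    (sym (chains≥-suc (suc k) b l F)) ⟩
    chains≥ s b l (F ∘ (k ∷_)) +ℚ chains≥ (suc k) b (suc l) F ∎
    where
    g : ℕ → ℚ
    g x = ∑ (allLists l b) λ t → ⟦ all (R x) t ∧ chain R t ⟧ *ℚ F (x ∷ t)

  legal : ℕ → ∀ m → (Vec ℕ m → ℚ) → ℚ
  legal l m f = ∑ (allLists l (2 * m)) λ t → ⟦ chain R t ⟧ *ℚ f (content m t)

  chain-shift : ∀ t → chain R (map (2 +_) t) ≡ chain R t
  chain-shift []      = refl
  chain-shift (x ∷ t) = cong₂ _∧_ (all-shift t) (chain-shift t)
    where
    all-shift : ∀ t → all (R (2 + x)) (map (2 +_) t) ≡ all (R x) t
    all-shift []      = refl
    all-shift (y ∷ t) = cong₂ _∧_ (R-shift x y) (all-shift t)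

  ∑-allLists-≥2 : ∀ l b (H : List ℕ → ℚ) →
    ∑ (allLists l (2 + b)) (λ t → ⟦ all (2 ≤ᵇ_) t ⟧ *ℚ H t) ≡ ∑ (allLists l b) (H ∘ map (2 +_))
  ∑-allLists-≥2 zero    b H = cong (_+ℚ 0ℚ) (K.*-identityˡ (H []))
  ∑-allLists-≥2 (suc l) b H = begin
    ∑ (allLists (suc l) (2 + b)) (λ t → ⟦ all (2 ≤ᵇ_) t ⟧ *ℚ H t)
      ≡⟨ ∑-allLists-suc l (2 + b) _ ⟩
    ∑ (upTo (2 + b)) G
      ≡⟨ trans (∑-upTo-suc (suc b) G) (cong (G 0 +ℚ_) (∑-upTo-suc b (G ∘ suc))) ⟩
    G 0 +ℚ (G 1 +ℚ ∑ (upTo b) (G ∘ (2 +_)))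
      ≡⟨ cong₂ (λ x y → x +ℚ (y +ℚ ∑ (upTo b) (G ∘ (2 +_)))) (vanish 0) (vanish 1) ⟩
    0ℚ +ℚ (0ℚ +ℚ ∑ (upTo b) (G ∘ (2 +_)))
      ≡⟨ trans (K.+-identityˡ _) (K.+-identityˡ _) ⟩
    ∑ (upTo b) (G ∘ (2 +_))
      ≡⟨ ∑-cong (upTo b) (λ x → ∑-allLists-≥2 l b (H ∘ (2 + x ∷_))) ⟩
    ∑ (upTo b) (λ x → ∑ (allLists l b) (λ t → H (map (2 +_) (x ∷ t))))
      ≡⟨ ∑-allLists-suc l b (H ∘ map (2 +_)) ⟨
    ∑ (allLists (suc l) b) (H ∘ map (2 +_)) ∎
    where
    G : ℕ → ℚ
    G x = ∑ (allLists l (2 + b)) λ t → ⟦ all (2 ≤ᵇ_) (x ∷ t) ⟧ *ℚ H (x ∷ t)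
    vanish : ∀ x → ∑ (allLists l (2 + b)) (λ t → 0ℚ *ℚ H (x ∷ t)) ≡ 0ℚ
    vanish x = trans (∑-cong (allLists l (2 + b)) λ t → K.zeroˡ (H (x ∷ t))) (∑-zero (allLists l (2 + b)))

  chains≥2 : ∀ l m (f : Vec ℕ (suc m) → ℚ) →
    chains≥ 2 (2 + 2 * m) l (f ∘ content (suc m)) ≡ legal l m (f ∘ (0 ∷_))
  chains≥2 l m f = begin
    chains≥ 2 (2 + 2 * m) l (f ∘ content (suc m))
      ≡⟨ ∑-cong (allLists l (2 + 2 * m)) (λ t → trans
           (cong (_*ℚ f (content (suc m) t)) (⟦∧⟧ (all (2 ≤ᵇ_) t) (chain R t))) (K.*-assoc ⟦ all (2 ≤ᵇ_) t ⟧ _ _)) ⟩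
    ∑ (allLists l (2 + 2 * m)) (λ t → ⟦ all (2 ≤ᵇ_) t ⟧ *ℚ (⟦ chain R t ⟧ *ℚ f (content (suc m) t)))
      ≡⟨ ∑-allLists-≥2 l (2 * m) _ ⟩
    ∑ (allLists l (2 * m)) (λ t → ⟦ chain R (map (2 +_) t) ⟧ *ℚ f (content (suc m) (map (2 +_) t)))
      ≡⟨ ∑-cong (allLists l (2 * m)) (λ t →
           cong₂ (λ c d → ⟦ c ⟧ *ℚ f d) (chain-shift t) (content-shift m t)) ⟩
    legal l m (f ∘ (0 ∷_)) ∎

  legal-chains≥ : ∀ l m f → legal l (suc m) f ≡ chains≥ 0 (2 + 2 * m) l (f ∘ content (suc m))
  legal-chains≥ l m f = trans
    (cong (λ b → ∑ (allLists l b) λ t → ⟦ chain R t ⟧ *ℚ f (content (suc m) t)) (ℕ.*-suc 2 m))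
    (∑-cong (allLists l (2 + 2 * m)) λ t →
      cong (λ c → ⟦ c ∧ chain R t ⟧ *ℚ f (content (suc m) t)) (sym (all-0≤ᵇ t)))

  chains≥-∷ : ∀ k b l m (f : Vec ℕ m → ℚ) x →
    chains≥ k b l (λ t → f (content m (x ∷ t))) ≡ chains≥ k b l ((f ∘ addAt (x / 2) 1) ∘ content m)
  chains≥-∷ k b l m f x = ∑-cong (allLists l b) λ t →
    cong (λ d → ⟦ all (k ≤ᵇ_) t ∧ chain R t ⟧ *ℚ f d) (content-∷ m x t)

rowLE⇒≤ : ∀ x y → rowLE x y ≡ true → (x ≤ᵇ y) ≡ true
rowLE⇒≤ zero          y             r = refl
rowLE⇒≤ (suc zero)    (suc y)       r = refl
rowLE⇒≤ (suc (suc x)) (suc (suc y)) r = trans (suc-≤ᵇ x y) (rowLE⇒≤ x y r)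

colLE⇒≤ : ∀ x y → colLE x y ≡ true → (x ≤ᵇ y) ≡ true
colLE⇒≤ zero          y             r = refl
colLE⇒≤ (suc zero)    (suc (suc y)) r = refl
colLE⇒≤ (suc (suc x)) (suc (suc y)) r = trans (suc-≤ᵇ x y) (colLE⇒≤ x y r)

module Row = Peel rowLE rowLE⇒≤ (λ _ _ → refl)
module Col = Peel colLE colLE⇒≤ (λ _ _ → refl)

open Row using () renaming (legal to rows)
open Col using () renaming (legal to cols)

conv-κ-suc : ∀ l (h : ℕ → ℕ → ℚ) → conv (suc l) (λ a b → κ a *ℚ h a b) ≡
  (h 0 (suc l) +ℚ conv l (λ a b → h (suc a) b)) +ℚ conv l (λ a b → h (suc a) b)
conv-κ-suc l h = begin
  1ℚ *ℚ h 0 (suc l) +ℚ conv l (λ a b → 2ℚ *ℚ h (suc a) b)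
    ≡⟨ cong (1ℚ *ℚ h 0 (suc l) +ℚ_) (conv-*ˡ 2ℚ l _) ⟩
  1ℚ *ℚ h 0 (suc l) +ℚ 2ℚ *ℚ r
    ≡⟨ solve 2 (λ x r → con 1 :* x :+ con 2 :* r := (x :+ r) :+ r) refl (h 0 (suc l)) r ⟩
  (h 0 (suc l) +ℚ r) +ℚ r ∎
  where
  r = conv l (λ a b → h (suc a) b)

-- Once 1' is excluded, a row starts with any number a of letters 1, since unmarked letters may
-- repeat in a row.
rows≥1-conv : ∀ l m (f : Vec ℕ (suc m) → ℚ) →
  Row.chains≥ 1 (2 + 2 * m) l (f ∘ content (suc m)) ≡ conv l (λ a b → rows b m (λ d → f (a ∷ d)))
rows≥1-conv zero    m f = Row.chains≥2 0 m f
rows≥1-conv (suc l) m f = begin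
  Row.chains≥ 1 B (suc l) F
    ≡⟨ Row.peel 1 l F (s<s z<s) (λ { zero → refl ; (suc y) → refl }) ⟩
  Row.chains≥ 1 B l (F ∘ (1 ∷_)) +ℚ Row.chains≥ 2 B (suc l) F
    ≡⟨ cong₂ _+ℚ_ (trans (Row.chains≥-∷ 1 B l (suc m) f 1) (rows≥1-conv l m (f ∘ addAt 0 1))) (Row.chains≥2 (suc l) m f) ⟩
  conv l (λ a b → rows b m (λ d → f (suc a ∷ d))) +ℚ rows (suc l) m (f ∘ (0 ∷_))
    ≡⟨ K.+-comm (conv l (λ a b → rows b m (λ d → f (suc a ∷ d)))) _ ⟩
  conv (suc l) (λ a b → rows b m (λ d → f (a ∷ d))) ∎
  where
  B = 2 + 2 * m
  F = f ∘ content (suc m)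

-- One factor (1 + x)/(1 - x) for the first variable: a block of a letters of value 1 is unmarked
-- throughout or has its first letter marked, which is two choices if a > 0.
rows-suc : ∀ l m (f : Vec ℕ (suc m) → ℚ) →
  rows l (suc m) f ≡ conv l (λ a b → κ a *ℚ rows b m (λ d → f (a ∷ d)))
rows-suc zero    m f = trans (Row.legal-chains≥ 0 m f) (trans (Row.chains≥2 0 m f) (sym (K.*-identityˡ _)))
rows-suc (suc l) m f = begin
  rows (suc l) (suc m) f
    ≡⟨ Row.legal-chains≥ (suc l) m f ⟩
  Row.chains≥ 0 B (suc l) F
    ≡⟨ Row.peel 1 l F z<s (λ { zero → refl ; (suc y) → refl }) ⟩
  Row.chains≥ 1 B l (F ∘ (0 ∷_)) +ℚ Row.chains≥ 1 B (suc l) F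
    ≡⟨ cong₂ _+ℚ_ (trans (Row.chains≥-∷ 1 B l (suc m) f 0) (rows≥1-conv l m (f ∘ addAt 0 1))) (rows≥1-conv (suc l) m f) ⟩
  conv l (λ a b → h (suc a) b) +ℚ (h 0 (suc l) +ℚ conv l (λ a b → h (suc a) b))
    ≡⟨ K.+-comm (conv l (λ a b → h (suc a) b)) _ ⟩
  (h 0 (suc l) +ℚ conv l (λ a b → h (suc a) b)) +ℚ conv l (λ a b → h (suc a) b)
    ≡⟨ conv-κ-suc l h ⟨
  conv (suc l) (λ a b → κ a *ℚ h a b) ∎
  where
  B = 2 + 2 * m
  F = f ∘ content (suc m)
  h : ℕ → ℕ → ℚ
  h a b = rows b m (λ d → f (a ∷ d))

-- In a column the roles are exchanged: 1' repeats freely and at most one 1 follows. The factor for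
-- the first variable is nevertheless the same.
cols≥0-conv : ∀ l m (f : Vec ℕ (suc m) → ℚ) →
  Col.chains≥ 0 (2 + 2 * m) l (f ∘ content (suc m)) ≡ conv l (λ a b → κ a *ℚ cols b m (λ d → f (a ∷ d)))
cols≥0-conv zero    m f = trans (Col.chains≥2 0 m f) (sym (K.*-identityˡ _))
cols≥0-conv (suc l) m f = begin
  Col.chains≥ 0 B (suc l) F
    ≡⟨ Col.peel 0 l F z<s (λ _ → refl) ⟩
  Col.chains≥ 0 B l (F ∘ (0 ∷_)) +ℚ Col.chains≥ 1 B (suc l) F
    ≡⟨ cong₂ _+ℚ_ (trans (Col.chains≥-∷ 0 B l (suc m) f 0) (cols≥0-conv l m (f ∘ addAt 0 1)))
         (Col.peel 2 l F (s<s z<s) (λ { zero → refl ; (suc zero) → refl ; (suc (suc y)) → refl })) ⟩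
  conv l (λ a b → κ a *ℚ h (suc a) b) +ℚ (Col.chains≥ 2 B l (F ∘ (1 ∷_)) +ℚ Col.chains≥ 2 B (suc l) F)
    ≡⟨ cong (conv l (λ a b → κ a *ℚ h (suc a) b) +ℚ_) (cong₂ _+ℚ_
         (trans (Col.chains≥-∷ 2 B l (suc m) f 1) (Col.chains≥2 l m (f ∘ addAt 0 1))) (Col.chains≥2 (suc l) m f)) ⟩
  conv l (λ a b → κ a *ℚ h (suc a) b) +ℚ (h 1 l +ℚ h 0 (suc l))
    ≡⟨ K.+-assoc (conv l (λ a b → κ a *ℚ h (suc a) b)) _ _ ⟨
  (conv l (λ a b → κ a *ℚ h (suc a) b) +ℚ h 1 l) +ℚ h 0 (suc l)
    -- `h 1 l`, from the columns whose only letter of value 1 is an unmarked one, is exactly the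
    -- correction that `conv-κ` asks for.
    ≡⟨ cong (_+ℚ h 0 (suc l)) (conv-κ l (λ a b → h (suc a) b)) ⟩
  2ℚ *ℚ r +ℚ h 0 (suc l)
    ≡⟨ solve 2 (λ x r → con 2 :* r :+ x := (x :+ r) :+ r) refl (h 0 (suc l)) r ⟩
  (h 0 (suc l) +ℚ r) +ℚ r
    ≡⟨ conv-κ-suc l h ⟨
  conv (suc l) (λ a b → κ a *ℚ h a b) ∎
  where
  B = 2 + 2 * m
  F = f ∘ content (suc m)
  h : ℕ → ℕ → ℚ
  h a b = cols b m (λ d → f (a ∷ d))
  r = conv l (λ a b → h (suc a) b)

-- Both sides obey the same recursion in the number of variables, and without variables only the
-- empty word exists.
cols≡rows : ∀ l m (f : Vec ℕ m → ℚ) → cols l m f ≡ rows l m f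
cols≡rows zero    zero    f = refl
cols≡rows (suc l) zero    f = refl
cols≡rows l       (suc m) f = begin
  cols l (suc m) f                                        ≡⟨ Col.legal-chains≥ l m f ⟩
  Col.chains≥ 0 (2 + 2 * m) l (f ∘ content (suc m))       ≡⟨ cols≥0-conv l m f ⟩
  conv l (λ a b → κ a *ℚ cols b m (λ d → f (a ∷ d)))      ≡⟨ conv-cong l (λ a b _ → cong (κ a *ℚ_) (cols≡rows b m (f ∘ (a ∷_)))) ⟩
  conv l (λ a b → κ a *ℚ rows b m (λ d → f (a ∷ d)))      ≡⟨ rows-suc l m f ⟨
  rows l (suc m) f                                        ∎

-- The recursion for products of rows

conv-zero : ∀ l {h : ℕ → ℕ → ℚ} → (∀ a b → h a b ≡ 0ℚ) → conv l h ≡ 0ℚ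
conv-zero zero    h≡0 = h≡0 0 0
conv-zero (suc l) h≡0 =
  trans (cong₂ _+ℚ_ (h≡0 0 (suc l)) (conv-zero l λ a b → h≡0 (suc a) b)) (K.+-identityˡ 0ℚ)

conv-∷ʳ : ∀ l (h : ℕ → ℕ → ℚ) → conv (suc l) h ≡ conv l (λ a b → h a (suc b)) +ℚ h (suc l) 0
conv-∷ʳ zero    h = refl
conv-∷ʳ (suc l) h =
  trans (cong (h 0 (suc (suc l)) +ℚ_) (conv-∷ʳ l λ a b → h (suc a) b)) (sym (K.+-assoc _ _ _))

conv-comm : ∀ l (h : ℕ → ℕ → ℚ) → conv l h ≡ conv l (λ a b → h b a)
conv-comm zero    h = refl
conv-comm (suc l) h = begin
  h 0 (suc l) +ℚ conv l (λ a b → h (suc a) b)      ≡⟨ K.+-comm (h 0 (suc l)) _ ⟩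
  conv l (λ a b → h (suc a) b) +ℚ h 0 (suc l)      ≡⟨ cong (_+ℚ h 0 (suc l)) (conv-comm l λ a b → h (suc a) b) ⟩
  conv l (λ a b → h (suc b) a) +ℚ h 0 (suc l)      ≡⟨ conv-∷ʳ l (λ a b → h b a) ⟨
  conv (suc l) (λ a b → h b a)                     ∎

conv-assoc : ∀ l (h : ℕ → ℕ → ℕ → ℚ) →
  conv l (λ a c → conv a (λ x y → h x y c)) ≡ conv l (λ x b → conv b (λ y z → h x y z))
conv-assoc zero    h = refl
conv-assoc (suc l) h = begin
  h 0 0 (suc l) +ℚ conv l (λ a c → h 0 (suc a) c +ℚ conv a (λ x y → h (suc x) y c))
    ≡⟨ cong (h 0 0 (suc l) +ℚ_) (conv-+ l (λ a c → h 0 (suc a) c) (λ a c → conv a (λ x y → h (suc x) y c))) ⟩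
  h 0 0 (suc l) +ℚ (conv l (λ a c → h 0 (suc a) c) +ℚ conv l (λ a c → conv a (λ x y → h (suc x) y c)))
    ≡⟨ K.+-assoc (h 0 0 (suc l)) _ _ ⟨
  conv (suc l) (h 0) +ℚ conv l (λ a c → conv a (λ x y → h (suc x) y c))
    ≡⟨ cong (conv (suc l) (h 0) +ℚ_) (conv-assoc l (λ x y z → h (suc x) y z)) ⟩
  conv (suc l) (λ x b → conv b (λ y z → h x y z)) ∎

conv-exchange : ∀ l (h : ℕ → ℕ → ℕ → ℚ) →
  conv l (λ a b → conv b (λ r c → h a r c)) ≡ conv l (λ r b → conv b (λ a c → h a r c))
conv-exchange l h = begin
  conv l (λ a b → conv b (λ r c → h a r c))  ≡⟨ conv-assoc l h ⟨
  conv l (λ s c → conv s (λ a r → h a r c))  ≡⟨ conv-cong l (λ s c _ → conv-comm s (λ a r → h a r c)) ⟩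
  conv l (λ s c → conv s (λ r a → h a r c))  ≡⟨ conv-assoc l (λ r a c → h a r c) ⟩
  conv l (λ r b → conv b (λ a c → h a r c))  ∎

conv-∑ : ∀ l (xs : List A) (h : ℕ → ℕ → A → ℚ) →
  conv l (λ a b → ∑ xs (h a b)) ≡ ∑ xs (λ x → conv l (λ a b → h a b x))
conv-∑ zero    xs h = refl
conv-∑ (suc l) xs h =
  trans (cong (∑ xs (h 0 (suc l)) +ℚ_) (conv-∑ l xs λ a b → h (suc a) b)) (sym (∑-+ xs _ _))

odd : ℕ → Bool
odd zero          = false
odd (suc zero)    = true
odd (suc (suc n)) = odd n

-- Logarithmic derivative: x d/dx log((1 + x)/(1 − x)) = 2 ∑_{r odd} xʳ.
κ-rec : ∀ a → ℕtoℚ a *ℚ κ a ≡ 2ℚ *ℚ conv a (λ r b → ⟦ odd r ⟧ *ℚ κ b)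
κ-rec a = trans (n*κ a) (cong (2ℚ *ℚ_) (sym (count a)))
  where
  n*κ : ∀ a → ℕtoℚ a *ℚ κ a ≡ 2ℚ *ℚ ℕtoℚ a
  n*κ zero    = trans (K.zeroˡ 1ℚ) (sym (K.zeroʳ 2ℚ))
  n*κ (suc a) = K.*-comm (ℕtoℚ (suc a)) 2ℚ
  count : ∀ a → conv a (λ r b → ⟦ odd r ⟧ *ℚ κ b) ≡ ℕtoℚ a
  count zero          = K.zeroˡ 1ℚ
  count (suc zero)    = solve 0 (con 0 :* con 2 :+ con 1 :* con 1 := con 1) refl
  count (suc (suc a)) = begin
    0ℚ *ℚ 2ℚ +ℚ (1ℚ *ℚ 2ℚ +ℚ conv a (λ r b → ⟦ odd r ⟧ *ℚ κ b))
      ≡⟨ cong (λ x → 0ℚ *ℚ 2ℚ +ℚ (1ℚ *ℚ 2ℚ +ℚ x)) (count a) ⟩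
    0ℚ *ℚ 2ℚ +ℚ (1ℚ *ℚ 2ℚ +ℚ ℕtoℚ a)
      ≡⟨ solve 1 (λ x → con 0 :* con 2 :+ (con 1 :* con 2 :+ x) := con 2 :+ x) refl (ℕtoℚ a) ⟩
    2ℚ +ℚ ℕtoℚ a
      ≡⟨ cong (_+ℚ ℕtoℚ a) (ℕtoℚ-+ 1 1) ⟨
    ℕtoℚ 2 +ℚ ℕtoℚ a
      ≡⟨ ℕtoℚ-+ 2 a ⟨
    ℕtoℚ (suc (suc a)) ∎

rows-cong : ∀ l m {f g : Vec ℕ m → ℚ} → (∀ d → f d ≡ g d) → rows l m f ≡ rows l m g
rows-cong l m eq = ∑-cong (allLists l (2 * m)) λ t → cong (⟦ chain rowLE t ⟧ *ℚ_) (eq (content m t))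

-- Coefficientwise form of  l q_l = 2 ∑_{r odd} p_r q_{l−r}.
rows-rec : ∀ l m (f : Vec ℕ m → ℚ) →
  ℕtoℚ l *ℚ rows l m f ≡ 2ℚ *ℚ conv l (λ r b → ⟦ odd r ⟧ *ℚ ∑ (upTo m) (λ v → rows b m (f ∘ addAt v r)))
rows-rec l zero f = begin
  ℕtoℚ l *ℚ rows l 0 f   ≡⟨ left l ⟩
  0ℚ                     ≡⟨ K.zeroʳ 2ℚ ⟨
  2ℚ *ℚ 0ℚ               ≡⟨ cong (2ℚ *ℚ_) (conv-zero l λ r b → K.zeroʳ ⟦ odd r ⟧) ⟨
  2ℚ *ℚ conv l (λ r b → ⟦ odd r ⟧ *ℚ 0ℚ) ∎
  where
  left : ∀ l → ℕtoℚ l *ℚ rows l 0 f ≡ 0ℚ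
  left zero    = K.zeroˡ _
  left (suc l) = K.zeroʳ _
rows-rec l (suc m) f = begin
  ℕtoℚ l *ℚ rows l (suc m) f
    ≡⟨ cong (ℕtoℚ l *ℚ_) (rows-suc l m f) ⟩
  ℕtoℚ l *ℚ conv l (λ a b → κ a *ℚ Q a b)
    ≡⟨ conv-*ˡ (ℕtoℚ l) l _ ⟨
  conv l (λ a b → ℕtoℚ l *ℚ (κ a *ℚ Q a b))
    -- Leibniz rule: the degree l = a + b is shared between the first variable, where `κ-rec`
    -- applies, and the others, where induction on m applies.
    ≡⟨ conv-cong l leibniz ⟩
  conv l (λ a b → (ℕtoℚ a *ℚ κ a) *ℚ Q a b +ℚ κ a *ℚ (ℕtoℚ b *ℚ Q a b))
    ≡⟨ conv-+ l _ _ ⟩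
  conv l (λ a b → (ℕtoℚ a *ℚ κ a) *ℚ Q a b) +ℚ conv l (λ a b → κ a *ℚ (ℕtoℚ b *ℚ Q a b))
    ≡⟨ cong₂ _+ℚ_ head-part tail-part ⟩
  2ℚ *ℚ conv l (λ r b → ⟦ odd r ⟧ *ℚ rows b (suc m) (f ∘ addAt 0 r)) +ℚ
  2ℚ *ℚ conv l (λ r b → ⟦ odd r ⟧ *ℚ ∑ (upTo m) (λ v → rows b (suc m) (f ∘ addAt (suc v) r)))
    ≡⟨ K.distribˡ 2ℚ _ _ ⟨
  2ℚ *ℚ (conv l (λ r b → ⟦ odd r ⟧ *ℚ rows b (suc m) (f ∘ addAt 0 r)) +ℚ
         conv l (λ r b → ⟦ odd r ⟧ *ℚ ∑ (upTo m) (λ v → rows b (suc m) (f ∘ addAt (suc v) r))))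
    ≡⟨ cong (2ℚ *ℚ_) (conv-+ l _ _) ⟨
  2ℚ *ℚ conv l (λ r b → ⟦ odd r ⟧ *ℚ rows b (suc m) (f ∘ addAt 0 r) +ℚ
                        ⟦ odd r ⟧ *ℚ ∑ (upTo m) (λ v → rows b (suc m) (f ∘ addAt (suc v) r)))
    ≡⟨ cong (2ℚ *ℚ_) (conv-cong l λ r b _ → trans (sym (K.distribˡ ⟦ odd r ⟧ _ _))
         (cong (⟦ odd r ⟧ *ℚ_) (sym (∑-upTo-suc m λ v → rows b (suc m) (f ∘ addAt v r))))) ⟩
  2ℚ *ℚ conv l (λ r b → ⟦ odd r ⟧ *ℚ ∑ (upTo (suc m)) (λ v → rows b (suc m) (f ∘ addAt v r))) ∎
  where
  Q : ℕ → ℕ → ℚ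
  Q a b = rows b m (λ d → f (a ∷ d))

  leibniz : ∀ a b → a + b ≡ l →
    ℕtoℚ l *ℚ (κ a *ℚ Q a b) ≡ (ℕtoℚ a *ℚ κ a) *ℚ Q a b +ℚ κ a *ℚ (ℕtoℚ b *ℚ Q a b)
  leibniz a b refl = trans (cong (_*ℚ (κ a *ℚ Q a b)) (ℕtoℚ-+ a b))
    (solve 4 (λ x y k q → (x :+ y) :* (k :* q) := (x :* k) :* q :+ k :* (y :* q)) refl
      (ℕtoℚ a) (ℕtoℚ b) (κ a) (Q a b))

  head-part : conv l (λ a b → (ℕtoℚ a *ℚ κ a) *ℚ Q a b)
            ≡ 2ℚ *ℚ conv l (λ r b → ⟦ odd r ⟧ *ℚ rows b (suc m) (f ∘ addAt 0 r))
  head-part = begin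
    conv l (λ a b → (ℕtoℚ a *ℚ κ a) *ℚ Q a b)
      ≡⟨ conv-cong l (λ a b _ → expand a b) ⟩
    conv l (λ a b → 2ℚ *ℚ conv a (λ r c → ⟦ odd r ⟧ *ℚ (κ c *ℚ Q (r + c) b)))
      ≡⟨ conv-*ˡ 2ℚ l _ ⟩
    2ℚ *ℚ conv l (λ a b → conv a (λ r c → ⟦ odd r ⟧ *ℚ (κ c *ℚ Q (r + c) b)))
      ≡⟨ cong (2ℚ *ℚ_) (conv-assoc l λ r c b → ⟦ odd r ⟧ *ℚ (κ c *ℚ Q (r + c) b)) ⟩
    2ℚ *ℚ conv l (λ r b → conv b (λ c b′ → ⟦ odd r ⟧ *ℚ (κ c *ℚ Q (r + c) b′)))
      ≡⟨ cong (2ℚ *ℚ_) (conv-cong l λ r b _ → trans (conv-*ˡ ⟦ odd r ⟧ b _)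
           (cong (⟦ odd r ⟧ *ℚ_) (sym (rows-suc b m (f ∘ addAt 0 r))))) ⟩
    2ℚ *ℚ conv l (λ r b → ⟦ odd r ⟧ *ℚ rows b (suc m) (f ∘ addAt 0 r)) ∎
    where
    expand : ∀ a b → (ℕtoℚ a *ℚ κ a) *ℚ Q a b
                   ≡ 2ℚ *ℚ conv a (λ r c → ⟦ odd r ⟧ *ℚ (κ c *ℚ Q (r + c) b))
    expand a b = begin
      (ℕtoℚ a *ℚ κ a) *ℚ Q a b
        ≡⟨ cong (_*ℚ Q a b) (κ-rec a) ⟩
      (2ℚ *ℚ conv a (λ r c → ⟦ odd r ⟧ *ℚ κ c)) *ℚ Q a b
        ≡⟨ solve 3 (λ x y z → (x :* y) :* z := x :* (z :* y)) refl 2ℚ _ (Q a b) ⟩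
      2ℚ *ℚ (Q a b *ℚ conv a (λ r c → ⟦ odd r ⟧ *ℚ κ c))
        ≡⟨ cong (2ℚ *ℚ_) (conv-*ˡ (Q a b) a _) ⟨
      2ℚ *ℚ conv a (λ r c → Q a b *ℚ (⟦ odd r ⟧ *ℚ κ c))
        ≡⟨ cong (2ℚ *ℚ_) (conv-cong a λ { r c refl →
             solve 3 (λ x y z → x :* (y :* z) := y :* (z :* x)) refl (Q (r + c) b) ⟦ odd r ⟧ (κ c) }) ⟩
      2ℚ *ℚ conv a (λ r c → ⟦ odd r ⟧ *ℚ (κ c *ℚ Q (r + c) b)) ∎

  tail-part : conv l (λ a b → κ a *ℚ (ℕtoℚ b *ℚ Q a b))
            ≡ 2ℚ *ℚ conv l (λ r b → ⟦ odd r ⟧ *ℚ ∑ (upTo m) (λ v → rows b (suc m) (f ∘ addAt (suc v) r)))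
  tail-part = begin
    conv l (λ a b → κ a *ℚ (ℕtoℚ b *ℚ Q a b))
      ≡⟨ conv-cong l (λ a b _ → expand a b) ⟩
    conv l (λ a b → 2ℚ *ℚ conv b (λ r c → ⟦ odd r ⟧ *ℚ (κ a *ℚ S a r c)))
      ≡⟨ conv-*ˡ 2ℚ l _ ⟩
    2ℚ *ℚ conv l (λ a b → conv b (λ r c → ⟦ odd r ⟧ *ℚ (κ a *ℚ S a r c)))
      ≡⟨ cong (2ℚ *ℚ_) (conv-exchange l λ a r c → ⟦ odd r ⟧ *ℚ (κ a *ℚ S a r c)) ⟩
    2ℚ *ℚ conv l (λ r b → conv b (λ a c → ⟦ odd r ⟧ *ℚ (κ a *ℚ S a r c)))
      ≡⟨ cong (2ℚ *ℚ_) (conv-cong l λ r b _ → trans (conv-*ˡ ⟦ odd r ⟧ b _)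
           (cong (⟦ odd r ⟧ *ℚ_) (collect r b))) ⟩
    2ℚ *ℚ conv l (λ r b → ⟦ odd r ⟧ *ℚ ∑ (upTo m) (λ v → rows b (suc m) (f ∘ addAt (suc v) r))) ∎
    where
    S : ℕ → ℕ → ℕ → ℚ
    S a r c = ∑ (upTo m) (λ v → rows c m (λ d → f (a ∷ addAt v r d)))
    expand : ∀ a b → κ a *ℚ (ℕtoℚ b *ℚ Q a b)
                   ≡ 2ℚ *ℚ conv b (λ r c → ⟦ odd r ⟧ *ℚ (κ a *ℚ S a r c))
    expand a b = begin
      κ a *ℚ (ℕtoℚ b *ℚ Q a b)
        ≡⟨ cong (κ a *ℚ_) (rows-rec b m (λ d → f (a ∷ d))) ⟩
      κ a *ℚ (2ℚ *ℚ conv b (λ r c → ⟦ odd r ⟧ *ℚ S a r c))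
        ≡⟨ solve 3 (λ x y z → x :* (y :* z) := y :* (x :* z)) refl (κ a) 2ℚ _ ⟩
      2ℚ *ℚ (κ a *ℚ conv b (λ r c → ⟦ odd r ⟧ *ℚ S a r c))
        ≡⟨ cong (2ℚ *ℚ_) (conv-*ˡ (κ a) b _) ⟨
      2ℚ *ℚ conv b (λ r c → κ a *ℚ (⟦ odd r ⟧ *ℚ S a r c))
        ≡⟨ cong (2ℚ *ℚ_) (conv-cong b λ r c _ →
             solve 3 (λ x y z → x :* (y :* z) := y :* (x :* z)) refl (κ a) ⟦ odd r ⟧ (S a r c)) ⟩
      2ℚ *ℚ conv b (λ r c → ⟦ odd r ⟧ *ℚ (κ a *ℚ S a r c)) ∎
    collect : ∀ r b → conv b (λ a c → κ a *ℚ S a r c)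
                    ≡ ∑ (upTo m) (λ v → rows b (suc m) (f ∘ addAt (suc v) r))
    collect r b = begin
      conv b (λ a c → κ a *ℚ S a r c)
        ≡⟨ conv-cong b (λ a c _ → ∑-*ˡ (κ a) (upTo m) (λ v → rows c m (λ d → f (a ∷ addAt v r d)))) ⟨
      conv b (λ a c → ∑ (upTo m) (λ v → κ a *ℚ rows c m (λ d → f (a ∷ addAt v r d))))
        ≡⟨ conv-∑ b (upTo m) (λ a c v → κ a *ℚ rows c m (λ d → f (a ∷ addAt v r d))) ⟩
      ∑ (upTo m) (λ v → conv b (λ a c → κ a *ℚ rows c m (λ d → f (a ∷ addAt v r d))))
        ≡⟨ ∑-cong (upTo m) (λ v → rows-suc b m (f ∘ addAt (suc v) r)) ⟨
      ∑ (upTo m) (λ v → rows b (suc m) (f ∘ addAt (suc v) r)) ∎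

-- Products of two rows

_⊞_ : Vec ℕ m → Vec ℕ m → Vec ℕ m
_⊞_ = zipWith _+_

addAt-⊞ : ∀ v r (d e : Vec ℕ m) → addAt v r d ⊞ e ≡ addAt v r (d ⊞ e)
addAt-⊞ v       r []       []       = refl
addAt-⊞ zero    r (x ∷ d) (y ∷ e) = cong (_∷ d ⊞ e) (ℕ.+-assoc r x y)
addAt-⊞ (suc v) r (x ∷ d) (y ∷ e) = cong (x + y ∷_) (addAt-⊞ v r d e)

-- The product q_i q_j.
rowPairs : ℕ → ℕ → ∀ m → (Vec ℕ m → ℚ) → ℚ
rowPairs i j m f = rows i m λ d → rows j m λ e → f (d ⊞ e)

rows-swap : ∀ i j m (F : Vec ℕ m → Vec ℕ m → ℚ) →
  rows i m (λ d → rows j m (F d)) ≡ rows j m (λ e → rows i m (λ d → F d e))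
rows-swap i j m F = begin
  ∑ U (λ u → c u *ℚ ∑ V (λ v → c v *ℚ F (content m u) (content m v)))
    ≡⟨ ∑-cong U (λ u → sym (∑-*ˡ (c u) V _)) ⟩
  ∑ U (λ u → ∑ V (λ v → c u *ℚ (c v *ℚ F (content m u) (content m v))))
    ≡⟨ ∑-swap U V _ ⟩
  ∑ V (λ v → ∑ U (λ u → c u *ℚ (c v *ℚ F (content m u) (content m v))))
    ≡⟨ ∑-cong V (λ v → trans (∑-cong U λ u → exchange (c u) (c v) _) (∑-*ˡ (c v) U _)) ⟩
  ∑ V (λ v → c v *ℚ ∑ U (λ u → c u *ℚ F (content m u) (content m v))) ∎
  where
  U = allLists i (2 * m)
  V = allLists j (2 * m)
  c : List ℕ → ℚ
  c t = ⟦ chain rowLE t ⟧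
  exchange : ∀ x y z → x *ℚ (y *ℚ z) ≡ y *ℚ (x *ℚ z)
  exchange = solve 3 (λ x y z → x :* (y :* z) := y :* (x :* z)) refl

rowPairs-comm : ∀ i j m f → rowPairs i j m f ≡ rowPairs j i m f
rowPairs-comm i j m f = trans (rows-swap i j m λ d e → f (d ⊞ e))
  (rows-cong j m λ e → rows-cong i m λ d → cong f (zipWith-comm ℕ.+-comm d e))

rowPairs-recˡ : ∀ i j m f → ℕtoℚ i *ℚ rowPairs i j m f ≡
  2ℚ *ℚ conv i (λ r b → ⟦ odd r ⟧ *ℚ ∑ (upTo m) (λ v → rowPairs b j m (f ∘ addAt v r)))
rowPairs-recˡ i j m f = trans (rows-rec i m λ d → rows j m λ e → f (d ⊞ e))
  (cong (2ℚ *ℚ_) (conv-cong i λ r b _ → cong (⟦ odd r ⟧ *ℚ_) (∑-cong (upTo m) λ v →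
    rows-cong b m λ d → rows-cong j m λ e → cong f (addAt-⊞ v r d e))))

-- Leibniz rule for the two rows. Working with the total degree gives the same factor 2/(i + j) to
-- every part split off, from whichever row; this is why `wt` depends on the composition alone.
rowPairs-rec : ∀ i j m f → ℕtoℚ (i + j) *ℚ rowPairs i j m f ≡ 2ℚ *ℚ
  (conv i (λ r b → ⟦ odd r ⟧ *ℚ ∑ (upTo m) (λ v → rowPairs b j m (f ∘ addAt v r))) +ℚ
   conv j (λ r b → ⟦ odd r ⟧ *ℚ ∑ (upTo m) (λ v → rowPairs i b m (f ∘ addAt v r))))
rowPairs-rec i j m f = begin
  ℕtoℚ (i + j) *ℚ rowPairs i j m f
    ≡⟨ cong (_*ℚ rowPairs i j m f) (ℕtoℚ-+ i j) ⟩
  (ℕtoℚ i +ℚ ℕtoℚ j) *ℚ rowPairs i j m f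
    ≡⟨ K.distribʳ (rowPairs i j m f) (ℕtoℚ i) (ℕtoℚ j) ⟩
  ℕtoℚ i *ℚ rowPairs i j m f +ℚ ℕtoℚ j *ℚ rowPairs i j m f
    ≡⟨ cong₂ _+ℚ_ (rowPairs-recˡ i j m f)
         (trans (cong (ℕtoℚ j *ℚ_) (rowPairs-comm i j m f)) (rowPairs-recˡ j i m f)) ⟩
  2ℚ *ℚ X +ℚ 2ℚ *ℚ conv j (λ r b → ⟦ odd r ⟧ *ℚ ∑ (upTo m) (λ v → rowPairs b i m (f ∘ addAt v r)))
    ≡⟨ cong (λ y → 2ℚ *ℚ X +ℚ 2ℚ *ℚ y) (conv-cong j λ r b _ → cong (⟦ odd r ⟧ *ℚ_)
         (∑-cong (upTo m) λ v → rowPairs-comm b i m (f ∘ addAt v r))) ⟩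
  2ℚ *ℚ X +ℚ 2ℚ *ℚ Y
    ≡⟨ K.distribˡ 2ℚ X Y ⟨
  2ℚ *ℚ (X +ℚ Y) ∎
  where
  X = conv i (λ r b → ⟦ odd r ⟧ *ℚ ∑ (upTo m) (λ v → rowPairs b j m (f ∘ addAt v r)))
  Y = conv j (λ r b → ⟦ odd r ⟧ *ℚ ∑ (upTo m) (λ v → rowPairs i b m (f ∘ addAt v r)))

-- Expansion over odd compositions

-- The coefficient of tⁱ in tʳ ∑ᵢ (h i) tⁱ, with z in the role of zero.
shift : A → ℕ → (ℕ → A) → ℕ → A
shift z zero    h i       = h i
shift z (suc r) h zero    = z
shift z (suc r) h (suc i) = shift z r h i

data ShiftView (r i : ℕ) : Set where
  inside  : ∀ b → i ≡ r + b → ShiftView r i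
  outside : i < r → ShiftView r i

shiftView : ∀ r i → ShiftView r i
shiftView zero    i       = inside i refl
shiftView (suc r) zero    = outside z<s
shiftView (suc r) (suc i) with shiftView r i
... | inside b p = inside b (cong suc p)
... | outside p  = outside (s<s p)

shift-+ : ∀ (z : A) r h b → shift z r h (r + b) ≡ h b
shift-+ z zero    h b = refl
shift-+ z (suc r) h b = shift-+ z r h b

shift-< : ∀ (z : A) {r i} h → i < r → shift z r h i ≡ z
shift-< z {suc r} {zero}  h p       = refl
shift-< z {suc r} {suc i} h (s≤s p) = shift-< z h p

shift-cong : ∀ r i {g h : ℕ → ℚ} → (∀ b → g b ≡ h b) → shift 0ℚ r g i ≡ shift 0ℚ r h i
shift-cong zero    i       eq = eq i
shift-cong (suc r) zero    eq = refl
shift-cong (suc r) (suc i) eq = shift-cong r i eq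

-- Lets the recursions for i and for j run over one common range of r, so that they can be added
-- part by part.
conv-shift : ∀ i B (h : ℕ → ℕ → ℚ) → i < B → conv i h ≡ ∑ (upTo B) (λ r → shift 0ℚ r (h r) i)
conv-shift zero    (suc B) h _ = begin
  h 0 0                                               ≡⟨ K.+-identityʳ (h 0 0) ⟨
  h 0 0 +ℚ 0ℚ                                         ≡⟨ cong (h 0 0 +ℚ_) (∑-zero (upTo B)) ⟨
  h 0 0 +ℚ ∑ (upTo B) (λ r → 0ℚ)                      ≡⟨ ∑-upTo-suc B (λ r → shift 0ℚ r (h r) 0) ⟨
  ∑ (upTo (suc B)) (λ r → shift 0ℚ r (h r) 0)         ∎
conv-shift (suc i) (suc B) h (s≤s i<B) = begin
  h 0 (suc i) +ℚ conv i (λ a b → h (suc a) b)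
    ≡⟨ cong (h 0 (suc i) +ℚ_) (conv-shift i B (λ a b → h (suc a) b) i<B) ⟩
  h 0 (suc i) +ℚ ∑ (upTo B) (λ r → shift 0ℚ r (h (suc r)) i)
    ≡⟨ ∑-upTo-suc B (λ r → shift 0ℚ r (h r) (suc i)) ⟨
  ∑ (upTo (suc B)) (λ r → shift 0ℚ r (h r) (suc i)) ∎

-- The compositions of n into odd parts; t is fuel, and any t ≥ n suffices.
oddComps : ℕ → ℕ → List (List ℕ)
oddCompsFrom : ℕ → ℕ → ℕ → List (List ℕ)
oddComps t       zero    = [] ∷ []
oddComps zero    (suc n) = []
oddComps (suc t) (suc n) = concatMap (oddCompsFrom t (suc n)) (upTo (2 + n))
oddCompsFrom t n r = if odd r then shift [] r (λ b → map (r ∷_) (oddComps t b)) n else []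

∑-oddComps-suc : ∀ t n (F : List ℕ → ℚ) → ∑ (oddComps (suc t) (suc n)) F ≡
  ∑ (upTo (2 + n)) λ r → ⟦ odd r ⟧ *ℚ shift 0ℚ r (λ b → ∑ (oddComps t b) (F ∘ (r ∷_))) (suc n)
∑-oddComps-suc t n F =
  trans (∑-concatMap (oddCompsFrom t (suc n)) (upTo (2 + n)) F) (∑-cong (upTo (2 + n)) first)
  where
  push : ∀ r i (g : ℕ → List (List ℕ)) → ∑ (shift [] r g i) F ≡ shift 0ℚ r (λ b → ∑ (g b) F) i
  push zero    i       g = refl
  push (suc r) zero    g = refl
  push (suc r) (suc i) g = push r i g
  first : ∀ r → ∑ (oddCompsFrom t (suc n) r) F
              ≡ ⟦ odd r ⟧ *ℚ shift 0ℚ r (λ b → ∑ (oddComps t b) (F ∘ (r ∷_))) (suc n)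
  first r with odd r
  ... | true  = trans (push r (suc n) _) (trans
    (shift-cong r (suc n) λ b → ∑-map (r ∷_) (oddComps t b) F) (sym (K.*-identityˡ _)))
  ... | false = sym (K.zeroˡ _)

data OddComp : ℕ → List ℕ → Set where
  []  : OddComp 0 []
  _∷_ : ∀ {r b ρ} → odd r ≡ true → OddComp b ρ → OddComp (r + b) (r ∷ ρ)

OddComp⇒sum : ∀ {n ρ} → OddComp n ρ → sum ρ ≡ n
OddComp⇒sum []                = refl
OddComp⇒sum (_∷_ {r = r} _ c) = cong (r +_) (OddComp⇒sum c)

∈-oddComps⁻ : ∀ t n {ρ} → ρ ∈ oddComps t n → OddComp n ρ
∈-oddComps⁻ t       zero    (here refl) = []
∈-oddComps⁻ (suc t) (suc n) ρ∈ = let r , ρ∈r = satisfied (∈-concatMap⁻ (oddCompsFrom t (suc n)) {xs = upTo (2 + n)} ρ∈) in from r ρ∈r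
  where
  from : ∀ r {ρ} → ρ ∈ oddCompsFrom t (suc n) r → OddComp (suc n) ρ
  from r {ρ} ρ∈r with odd r in odd-r | shiftView r (suc n)
  ... | true | outside n<r
    with () ← subst (ρ ∈_) (shift-< [] (λ b → map (r ∷_) (oddComps t b)) n<r) ρ∈r
  ... | true | inside b n≡
    with ρ′ , ρ′∈ , refl ← ∈-map⁻ (r ∷_) (subst (ρ ∈_) (trans (cong (shift [] r _) n≡)
           (shift-+ [] r (λ b → map (r ∷_) (oddComps t b)) b)) ρ∈r)
    = subst (λ n → OddComp n (r ∷ ρ′)) (sym n≡) (odd-r ∷ ∈-oddComps⁻ t b ρ′∈)

odd⇒1≤ : ∀ {r} → odd r ≡ true → 1 ≤ r
odd⇒1≤ {suc r} _ = s≤s z≤n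

∈-oddComps⁺ : ∀ {t n ρ} → OddComp n ρ → n ≤ t → ρ ∈ oddComps t n
∈-oddComps⁺ [] _ = here refl
∈-oddComps⁺ {suc t} (_∷_ {suc r} {b} {ρ} odd-r c) (s≤s r+b≤t) =
  ∈-concatMap⁺ (oddCompsFrom t (suc r + b)) (lose (∈-upTo⁺ (s≤s (s≤s (ℕ.m≤m+n r b)))) from)
  where
  from : suc r ∷ ρ ∈ oddCompsFrom t (suc r + b) (suc r)
  from rewrite odd-r = subst (suc r ∷ ρ ∈_) (sym (shift-+ [] r (λ b → map (suc r ∷_) (oddComps t b)) b))
    (∈-map⁺ (suc r ∷_) (∈-oddComps⁺ c (ℕ.≤-trans (ℕ.m≤n+m b r) r+b≤t)))

inv : ℕ → ℚ
inv zero    = 0ℚ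
inv (suc n) = ℚ.1/_ (ℕtoℚ (suc n)) {{ℚ.pos⇒nonZero (ℕtoℚ (suc n)) {{ℚ.normalize-pos (suc n) 1}}}}

inv-inverse : ∀ n → inv (suc n) *ℚ ℕtoℚ (suc n) ≡ 1ℚ
inv-inverse n = trans (*ℚ-def (inv (suc n)) (ℕtoℚ (suc n)))
  (ℚ.*-inverseˡ (ℕtoℚ (suc n)) {{ℚ.pos⇒nonZero (ℕtoℚ (suc n)) {{ℚ.normalize-pos (suc n) 1}}}})

-- Summed over the rearrangements of λ, the weights give 2^ℓ(λ) / z_λ.
wt : List ℕ → ℚ
wt []      = 1ℚ
wt (r ∷ ρ) = (2ℚ *ℚ inv (sum (r ∷ ρ))) *ℚ wt ρ

-- The coefficient of tⁱ in ∏ (1 + tʳ), r ∈ ρ.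
N : List ℕ → ℕ → ℚ
N []      zero    = 1ℚ
N []      (suc i) = 0ℚ
N (r ∷ ρ) i       = N ρ i +ℚ shift 0ℚ r (N ρ) i

N-vanish : ∀ ρ i → sum ρ < i → N ρ i ≡ 0ℚ
N-vanish []      (suc i) _ = refl
N-vanish (r ∷ ρ) i       p with shiftView r i
... | outside i<r     = trans (cong₂ _+ℚ_ (N-vanish ρ i (ℕ.≤-<-trans (ℕ.m≤n+m (sum ρ) r) p))
  (shift-< 0ℚ (N ρ) i<r)) (K.+-identityˡ 0ℚ)
... | inside b refl = trans (cong₂ _+ℚ_ (N-vanish ρ i (ℕ.≤-<-trans (ℕ.m≤n+m (sum ρ) r) p))
  (trans (shift-+ 0ℚ r (N ρ) b) (N-vanish ρ b (ℕ.+-cancelˡ-< r (sum ρ) b p)))) (K.+-identityˡ 0ℚ)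

powerSum : List ℕ → ∀ m → (Vec ℕ m → ℚ) → ℚ
powerSum ρ m f = ∑ (allLists (length ρ) m) λ g → f (weight m ρ g)

powerSum-∷ : ∀ r ρ m f → powerSum (r ∷ ρ) m f ≡ ∑ (upTo m) (λ v → powerSum ρ m (f ∘ addAt v r))
powerSum-∷ r ρ m f = trans (∑-allLists-suc (length ρ) m _) (∑-cong (upTo m) λ v →
  ∑-cong (allLists (length ρ) m) λ g → cong f (weight-∷ m r ρ v g))

rowPairs-zero : ∀ m f → rowPairs 0 0 m f ≡ powerSum [] m f
rowPairs-zero m f = begin
  1ℚ *ℚ (1ℚ *ℚ f (content m [] ⊞ content m []) +ℚ 0ℚ) +ℚ 0ℚ
    ≡⟨ cong (λ d → 1ℚ *ℚ (1ℚ *ℚ f d +ℚ 0ℚ) +ℚ 0ℚ) (zeros m) ⟩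
  1ℚ *ℚ (1ℚ *ℚ f (weight m [] []) +ℚ 0ℚ) +ℚ 0ℚ
    ≡⟨ solve 1 (λ x → con 1 :* (con 1 :* x :+ con 0) :+ con 0 := x :+ con 0) refl (f (weight m [] [])) ⟩
  f (weight m [] []) +ℚ 0ℚ ∎
  where
  zeros : ∀ m → content m [] ⊞ content m [] ≡ weight m [] []
  zeros zero    = refl
  zeros (suc m) = cong (0 ∷_) (zeros m)

private
  -- The contribution to the recursion of a part r taken from the row of length i. `L` is the share
  -- of `N` belonging to that row and `M` what it becomes after r is removed; leaving `L`, `M` and
  -- `g` general makes the lemma serve both rows. If r > i the right side is empty, so `L` has to
  -- vanish on the compositions of n - r.
  half : ∀ m t f r n i j (M : List ℕ → ℕ → ℚ) (g : ℕ → (Vec ℕ m → ℚ) → ℚ) → n ≡ i + j → n ≤ suc t → odd r ≡ true →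
    (∀ b → b + j ≤ t → ∀ f → g b f ≡ ∑ (oddComps t (b + j)) (λ ρ → (wt ρ *ℚ M ρ b) *ℚ powerSum ρ m f)) →
    (L : List ℕ → ℚ) →
    (∀ b {ρ} → i ≡ r + b → ρ ∈ oddComps t (b + j) → L ρ ≡ M ρ b) →
    (∀ b {ρ} → i < r → n ≡ r + b → ρ ∈ oddComps t b → L ρ ≡ 0ℚ) →
    shift 0ℚ r (λ b → ∑ (oddComps t b) λ ρ → (wt ρ *ℚ L ρ) *ℚ powerSum (r ∷ ρ) m f) n ≡
    shift 0ℚ r (λ b → ∑ (upTo m) λ v → g b (f ∘ addAt v r)) i
  half m t f r n i j M g n≡ n≤ odd-r IH L in-case out-case with shiftView r i
  ... | inside b refl = begin
    shift 0ℚ r H n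
      ≡⟨ cong (shift 0ℚ r H) n≡r+b+j ⟩
    shift 0ℚ r H (r + (b + j))
      ≡⟨ shift-+ 0ℚ r H (b + j) ⟩
    ∑ C (λ ρ → (wt ρ *ℚ L ρ) *ℚ powerSum (r ∷ ρ) m f)
      ≡⟨ ∑-cong-∈ C (λ {ρ} ρ∈ → cong₂ (λ x y → (wt ρ *ℚ x) *ℚ y) (in-case b refl ρ∈) (powerSum-∷ r ρ m f)) ⟩
    ∑ C (λ ρ → (wt ρ *ℚ M ρ b) *ℚ ∑ (upTo m) (λ v → powerSum ρ m (f ∘ addAt v r)))
      ≡⟨ ∑-cong C (λ ρ → sym (∑-*ˡ (wt ρ *ℚ M ρ b) (upTo m) _)) ⟩
    ∑ C (λ ρ → ∑ (upTo m) (λ v → (wt ρ *ℚ M ρ b) *ℚ powerSum ρ m (f ∘ addAt v r)))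
      ≡⟨ ∑-swap C (upTo m) _ ⟩
    ∑ (upTo m) (λ v → ∑ C (λ ρ → (wt ρ *ℚ M ρ b) *ℚ powerSum ρ m (f ∘ addAt v r)))
      ≡⟨ ∑-cong (upTo m) (λ v → IH b b+j≤t (f ∘ addAt v r)) ⟨
    ∑ (upTo m) (λ v → g b (f ∘ addAt v r))
      ≡⟨ shift-+ 0ℚ r _ b ⟨
    shift 0ℚ r (λ b → ∑ (upTo m) λ v → g b (f ∘ addAt v r)) (r + b) ∎
    where
    H : ℕ → ℚ
    H b = ∑ (oddComps t b) λ ρ → (wt ρ *ℚ L ρ) *ℚ powerSum (r ∷ ρ) m f
    C = oddComps t (b + j)
    n≡r+b+j : n ≡ r + (b + j)
    n≡r+b+j = trans n≡ (ℕ.+-assoc r b j)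
    b+j≤t : b + j ≤ t
    b+j≤t = s≤s⁻¹ (ℕ.≤-trans (ℕ.+-monoˡ-≤ (b + j) (odd⇒1≤ {r} odd-r)) (subst (_≤ suc t) n≡r+b+j n≤))
  ... | outside i<r = trans (left (shiftView r n)) (sym (shift-< 0ℚ _ i<r))
    where
    H : ℕ → ℚ
    H b = ∑ (oddComps t b) λ ρ → (wt ρ *ℚ L ρ) *ℚ powerSum (r ∷ ρ) m f
    left : ShiftView r n → shift 0ℚ r H n ≡ 0ℚ
    left (outside n<r)   = shift-< 0ℚ H n<r
    left (inside b n≡′) = trans (trans (cong (shift 0ℚ r H) n≡′) (shift-+ 0ℚ r H b)) (trans
      (∑-cong-∈ (oddComps t b) λ {ρ} ρ∈ → trans (cong (λ x → (wt ρ *ℚ x) *ℚ powerSum (r ∷ ρ) m f) (out-case b i<r n≡′ ρ∈))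
        (solve 2 (λ x y → (x :* con 0) :* y := con 0) refl (wt ρ) (powerSum (r ∷ ρ) m f)))
      (∑-zero (oddComps t b)))

shift-*ˡ : ∀ c r (h : ℕ → ℚ) i → shift 0ℚ r (λ b → c *ℚ h b) i ≡ c *ℚ shift 0ℚ r h i
shift-*ˡ c zero    h i       = refl
shift-*ˡ c (suc r) h zero    = sym (K.zeroʳ c)
shift-*ˡ c (suc r) h (suc i) = shift-*ˡ c r h i

shift-⊕ : ∀ r (g h : ℕ → ℚ) i → shift 0ℚ r (λ b → g b +ℚ h b) i ≡ shift 0ℚ r g i +ℚ shift 0ℚ r h i
shift-⊕ zero    g h i       = refl
shift-⊕ (suc r) g h zero    = sym (K.+-identityˡ 0ℚ)
shift-⊕ (suc r) g h (suc i) = shift-⊕ r g h i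

-- Induction on n. The two summands of `N (r ∷ ρ) i` say where the part r is taken: from q_j, so
-- that ρ must supply all of tⁱ, or from q_i, so that it supplies t^(i - r). They match the two sums
-- of `rowPairs-rec`.
rowPairs-expansion : ∀ t n i j → i + j ≡ n → n ≤ t → ∀ {m} f →
  rowPairs i j m f ≡ ∑ (oddComps t n) λ ρ → (wt ρ *ℚ N ρ i) *ℚ powerSum ρ m f
rowPairs-expansion t zero zero zero refl _ {m} f = trans (rowPairs-zero m f)
  (solve 1 (λ x → x := (con 1 :* con 1) :* x :+ con 0) refl (powerSum [] m f))
rowPairs-expansion (suc t) (suc n) i j i+j≡ n≤t {m} f = begin
  rowPairs i j m f
    ≡⟨ K.*-identityˡ _ ⟨
  1ℚ *ℚ rowPairs i j m f
    ≡⟨ cong (_*ℚ rowPairs i j m f) (inv-inverse n) ⟨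
  (inv (suc n) *ℚ ℕtoℚ (suc n)) *ℚ rowPairs i j m f
    ≡⟨ K.*-assoc (inv (suc n)) _ _ ⟩
  inv (suc n) *ℚ (ℕtoℚ (suc n) *ℚ rowPairs i j m f)
    ≡⟨ cong (inv (suc n) *ℚ_) (subst (λ s → ℕtoℚ s *ℚ rowPairs i j m f ≡ 2ℚ *ℚ (conv i gᵢ +ℚ conv j gⱼ)) i+j≡ (rowPairs-rec i j m f)) ⟩
  inv (suc n) *ℚ (2ℚ *ℚ (conv i gᵢ +ℚ conv j gⱼ))
    ≡⟨ cong (λ x → inv (suc n) *ℚ (2ℚ *ℚ x)) (trans (cong₂ _+ℚ_ (conv-shift i B gᵢ i<B) (conv-shift j B gⱼ j<B)) (sym (∑-+ (upTo B) _ _))) ⟩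
  inv (suc n) *ℚ (2ℚ *ℚ ∑ (upTo B) (λ r → shift 0ℚ r (gᵢ r) i +ℚ shift 0ℚ r (gⱼ r) j))
    ≡⟨ solve 3 (λ x y z → x :* (y :* z) := (y :* x) :* z) refl (inv (suc n)) 2ℚ _ ⟩
  (2ℚ *ℚ inv (suc n)) *ℚ ∑ (upTo B) (λ r → shift 0ℚ r (gᵢ r) i +ℚ shift 0ℚ r (gⱼ r) j)
    ≡⟨ ∑-*ˡ (2ℚ *ℚ inv (suc n)) (upTo B) _ ⟨
  ∑ (upTo B) (λ r → (2ℚ *ℚ inv (suc n)) *ℚ (shift 0ℚ r (gᵢ r) i +ℚ shift 0ℚ r (gⱼ r) j))
    ≡⟨ ∑-cong (upTo B) term ⟩
  ∑ (upTo B) (λ r → ⟦ odd r ⟧ *ℚ shift 0ℚ r (λ b → ∑ (oddComps t b) (F ∘ (r ∷_))) (suc n))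
    ≡⟨ ∑-oddComps-suc t n F ⟨
  ∑ (oddComps (suc t) (suc n)) F ∎
  where
  B = 2 + n
  gᵢ gⱼ : ℕ → ℕ → ℚ
  gᵢ r b = ⟦ odd r ⟧ *ℚ ∑ (upTo m) (λ v → rowPairs b j m (f ∘ addAt v r))
  gⱼ r b = ⟦ odd r ⟧ *ℚ ∑ (upTo m) (λ v → rowPairs i b m (f ∘ addAt v r))
  F : List ℕ → ℚ
  F ρ = (wt ρ *ℚ N ρ i) *ℚ powerSum ρ m f
  i<B : i < B
  i<B = s≤s (ℕ.≤-trans (ℕ.m≤m+n i j) (ℕ.≤-reflexive i+j≡))
  j<B : j < B
  j<B = s≤s (ℕ.≤-trans (ℕ.m≤n+m j i) (ℕ.≤-reflexive i+j≡))
  c = 2ℚ *ℚ inv (suc n)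

  Lᵢ Lⱼ : ℕ → List ℕ → ℚ
  Lᵢ r ρ = shift 0ℚ r (N ρ) i
  Lⱼ r ρ = N ρ i

  H : (ℕ → List ℕ → ℚ) → ℕ → ℕ → ℚ
  H L r b = ∑ (oddComps t b) λ ρ → (wt ρ *ℚ L r ρ) *ℚ powerSum (r ∷ ρ) m f

  leading : ∀ r → shift 0ℚ r (λ b → ∑ (oddComps t b) (F ∘ (r ∷_))) (suc n)
                ≡ shift 0ℚ r (λ b → c *ℚ (H Lᵢ r b +ℚ H Lⱼ r b)) (suc n)
  leading r with shiftView r (suc n)
  ... | outside n<r   = trans (shift-< 0ℚ _ n<r) (sym (shift-< 0ℚ _ n<r))
  ... | inside b n≡ = trans (at-b _) (trans (trans (∑-cong-∈ (oddComps t b) split)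
          (trans (∑-*ˡ c (oddComps t b) _) (cong (c *ℚ_) (∑-+ (oddComps t b) _ _)))) (sym (at-b _)))
    where
    at-b : ∀ (h : ℕ → ℚ) → shift 0ℚ r h (suc n) ≡ h b
    at-b h = trans (cong (shift 0ℚ r h) n≡) (shift-+ 0ℚ r h b)
    split : ∀ {ρ} → ρ ∈ oddComps t b → F (r ∷ ρ) ≡
      c *ℚ ((wt ρ *ℚ Lᵢ r ρ) *ℚ powerSum (r ∷ ρ) m f +ℚ (wt ρ *ℚ Lⱼ r ρ) *ℚ powerSum (r ∷ ρ) m f)
    split {ρ} ρ∈ = trans
      (cong (λ s → (((2ℚ *ℚ inv s) *ℚ wt ρ) *ℚ N (r ∷ ρ) i) *ℚ powerSum (r ∷ ρ) m f)
        (trans (cong (r +_) (OddComp⇒sum (∈-oddComps⁻ t b ρ∈))) (sym n≡)))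
      (solve 5 (λ c wt x y p → ((c :* wt) :* (x :+ y)) :* p := c :* ((wt :* y) :* p :+ (wt :* x) :* p)) refl
        c (wt ρ) (N ρ i) (shift 0ℚ r (N ρ) i) (powerSum (r ∷ ρ) m f))

  halfᵢ : ∀ r → odd r ≡ true → shift 0ℚ r (H Lᵢ r) (suc n) ≡
    shift 0ℚ r (λ b → ∑ (upTo m) λ v → rowPairs b j m (f ∘ addAt v r)) i
  halfᵢ r odd-r = half m t f r (suc n) i j N (λ b f → rowPairs b j m f) (sym i+j≡) n≤t odd-r
    (λ b b+j≤t f → rowPairs-expansion t (b + j) b j refl b+j≤t f) (Lᵢ r)
    (λ { b {ρ} refl _ → shift-+ 0ℚ r (N ρ) b })
    (λ { b {ρ} i<r _ _ → shift-< 0ℚ (N ρ) i<r })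

  halfⱼ : ∀ r → odd r ≡ true → shift 0ℚ r (H Lⱼ r) (suc n) ≡
    shift 0ℚ r (λ b → ∑ (upTo m) λ v → rowPairs i b m (f ∘ addAt v r)) j
  halfⱼ r odd-r = half m t f r (suc n) j i (λ ρ _ → N ρ i) (λ b f → rowPairs i b m f)
    (trans (sym i+j≡) (ℕ.+-comm i j)) n≤t odd-r
    (λ b b+i≤t f → rowPairs-expansion t (b + i) i b (ℕ.+-comm i b) b+i≤t f) (Lⱼ r)
    (λ _ _ _ → refl)
    -- For r > j the rest has total b = i + j - r < i, so its polynomial does not reach degree i.
    (λ { b {ρ} j<r n≡ ρ∈ → N-vanish ρ i (subst (_< i) (sym (OddComp⇒sum (∈-oddComps⁻ t b ρ∈)))
      (b<i b j<r (trans i+j≡ n≡))) })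
    where
    b<i : ∀ b → j < r → i + j ≡ r + b → b < i
    b<i b j<r p = ℕ.+-cancelʳ-< j b i (ℕ.<-≤-trans (ℕ.+-monoʳ-< b j<r)
      (ℕ.≤-reflexive (trans (ℕ.+-comm b r) (sym p))))

  term : ∀ r → c *ℚ (shift 0ℚ r (gᵢ r) i +ℚ shift 0ℚ r (gⱼ r) j) ≡
    ⟦ odd r ⟧ *ℚ shift 0ℚ r (λ b → ∑ (oddComps t b) (F ∘ (r ∷_))) (suc n)
  term r = begin
    c *ℚ (shift 0ℚ r (gᵢ r) i +ℚ shift 0ℚ r (gⱼ r) j)
      ≡⟨ cong (c *ℚ_) (cong₂ _+ℚ_ (shift-*ˡ ⟦ odd r ⟧ r _ i) (shift-*ˡ ⟦ odd r ⟧ r _ j)) ⟩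
    c *ℚ (⟦ odd r ⟧ *ℚ X +ℚ ⟦ odd r ⟧ *ℚ Y)
      ≡⟨ solve 4 (λ c o x y → c :* (o :* x :+ o :* y) := o :* (c :* (x :+ y))) refl c ⟦ odd r ⟧ X Y ⟩
    ⟦ odd r ⟧ *ℚ (c *ℚ (X +ℚ Y))
      ≡⟨ rest (odd r) refl ⟩
    ⟦ odd r ⟧ *ℚ shift 0ℚ r (λ b → ∑ (oddComps t b) (F ∘ (r ∷_))) (suc n) ∎
    where
    X = shift 0ℚ r (λ b → ∑ (upTo m) λ v → rowPairs b j m (f ∘ addAt v r)) i
    Y = shift 0ℚ r (λ b → ∑ (upTo m) λ v → rowPairs i b m (f ∘ addAt v r)) j
    Z = shift 0ℚ r (λ b → ∑ (oddComps t b) (F ∘ (r ∷_))) (suc n)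
    rest : ∀ o → odd r ≡ o → ⟦ o ⟧ *ℚ (c *ℚ (X +ℚ Y)) ≡ ⟦ o ⟧ *ℚ Z
    rest false _     = trans (K.zeroˡ _) (sym (K.zeroˡ _))
    rest true  odd-r = cong (1ℚ *ℚ_) (begin
      c *ℚ (X +ℚ Y)
        ≡⟨ cong (c *ℚ_) (cong₂ _+ℚ_ (halfᵢ r odd-r) (halfⱼ r odd-r)) ⟨
      c *ℚ (shift 0ℚ r (H Lᵢ r) (suc n) +ℚ shift 0ℚ r (H Lⱼ r) (suc n))
        ≡⟨ cong (c *ℚ_) (shift-⊕ r (H Lᵢ r) (H Lⱼ r) (suc n)) ⟨
      c *ℚ shift 0ℚ r (λ b → H Lᵢ r b +ℚ H Lⱼ r b) (suc n)
        ≡⟨ shift-*ˡ c r _ (suc n) ⟨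
      shift 0ℚ r (λ b → c *ℚ (H Lᵢ r b +ℚ H Lⱼ r b)) (suc n)
        ≡⟨ leading r ⟨
      Z ∎)

-1^ : ℕ → ℚ
-1^ zero    = 1ℚ
-1^ (suc i) = -ℚ (-1^ i)

-- The coefficient of tⁱ in ∏ (1 + tʳ) / (1 + t), r ∈ ρ.
Nalt : List ℕ → ℕ → ℚ
Nalt []      i = -1^ i
Nalt (r ∷ ρ) i = Nalt ρ i +ℚ shift 0ℚ r (Nalt ρ) i

-- Clearing the denominator 1 + t. The result is the recursion in i that `Hook-suc` imposes on
-- hooks.
Nalt-zero : ∀ ρ → Nalt ρ 0 ≡ N ρ 0
Nalt-suc  : ∀ ρ i → Nalt ρ (suc i) +ℚ Nalt ρ i ≡ N ρ (suc i)
Nalt-zero [] = refl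
Nalt-zero (r ∷ ρ) = cong₂ _+ℚ_ (Nalt-zero ρ) (shifted r)
  where
  shifted : ∀ r → shift 0ℚ r (Nalt ρ) 0 ≡ shift 0ℚ r (N ρ) 0
  shifted zero    = Nalt-zero ρ
  shifted (suc r) = refl
Nalt-suc [] i = K.-‿inverseˡ (-1^ i)
Nalt-suc (r ∷ ρ) i = trans (+ℚ-interchange (Nalt ρ (suc i)) _ _ _) (cong₂ _+ℚ_ (Nalt-suc ρ i) (shifted r i))
  where
  shifted : ∀ r i → shift 0ℚ r (Nalt ρ) (suc i) +ℚ shift 0ℚ r (Nalt ρ) i ≡ shift 0ℚ r (N ρ) (suc i)
  shifted zero          i       = Nalt-suc ρ i
  shifted (suc zero)    zero    = trans (K.+-identityʳ _) (Nalt-zero ρ)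
  shifted (suc (suc r)) zero    = K.+-identityʳ _
  shifted (suc r)       (suc i) = shifted r i

-- Gluing a column to a row

colLE-spec : ∀ x y → (x ≤ᵇ y) ∧ not (not (isMarked x) ∧ not (isMarked y) ∧ (unmarkedValue x ≡ᵇ unmarkedValue y))
                   ≡ colLE x y
colLE-spec zero          y             = refl
colLE-spec (suc zero)    zero          = refl
colLE-spec (suc zero)    (suc zero)    = refl
colLE-spec (suc zero)    (suc (suc y)) rewrite [2+m]/2 y = cong not (∧-zeroʳ (not (isMarked y)))
colLE-spec (suc (suc x)) zero          = refl
colLE-spec (suc (suc x)) (suc zero)    = refl
colLE-spec (suc (suc x)) (suc (suc y)) rewrite [2+m]/2 x | [2+m]/2 y | suc-≤ᵇ x y = colLE-spec x y

rowLE-spec : ∀ x y → (x ≤ᵇ y) ∧ not (isMarked x ∧ isMarked y ∧ (unmarkedValue x ≡ᵇ unmarkedValue y))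
                   ≡ rowLE x y
rowLE-spec zero          zero          = refl
rowLE-spec zero          (suc zero)    = refl
rowLE-spec zero          (suc (suc y)) rewrite [2+m]/2 y = cong not (∧-zeroʳ (isMarked y))
rowLE-spec (suc zero)    zero          = refl
rowLE-spec (suc zero)    (suc y)       = refl
rowLE-spec (suc (suc x)) zero          = refl
rowLE-spec (suc (suc x)) (suc zero)    = refl
rowLE-spec (suc (suc x)) (suc (suc y)) rewrite [2+m]/2 x | [2+m]/2 y | suc-≤ᵇ x y = rowLE-spec x y

colLE-trans : ∀ x y z → colLE x y ≡ true → colLE y z ≡ true → colLE x z ≡ true
colLE-trans zero          y             z             p q = refl
colLE-trans (suc zero)    (suc (suc y)) (suc (suc z)) p q = refl
colLE-trans (suc (suc x)) (suc (suc y)) (suc (suc z)) p q = colLE-trans x y z p q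

rowLE-trans : ∀ x y z → rowLE x y ≡ true → rowLE y z ≡ true → rowLE x z ≡ true
rowLE-trans zero          (suc zero)    (suc z)       p q = refl
rowLE-trans zero          (suc (suc y)) (suc (suc z)) p q = refl
rowLE-trans (suc zero)    (suc zero)    (suc z)       p q = refl
rowLE-trans (suc zero)    (suc (suc y)) (suc (suc z)) p q = refl
rowLE-trans (suc (suc x)) (suc (suc y)) (suc (suc z)) p q = rowLE-trans x y z p q

-- The dichotomy behind the gluing: distinct letters are decided by their order, while two equal
-- letters fit only in a column if marked and only in a row if unmarked.
rowLE-not-colLE : ∀ x y → rowLE y x ≡ not (colLE x y)
rowLE-not-colLE zero          zero          = refl
rowLE-not-colLE zero          (suc zero)    = refl
rowLE-not-colLE zero          (suc (suc y)) = refl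
rowLE-not-colLE (suc zero)    zero          = refl
rowLE-not-colLE (suc zero)    (suc zero)    = refl
rowLE-not-colLE (suc zero)    (suc (suc y)) = refl
rowLE-not-colLE (suc (suc x)) zero          = refl
rowLE-not-colLE (suc (suc x)) (suc zero)    = refl
rowLE-not-colLE (suc (suc x)) (suc (suc y)) = rowLE-not-colLE x y

all-++ : (p : A → Bool) (s t : List A) → all p (s ++ t) ≡ all p s ∧ all p t
all-++ p []      t = refl
all-++ p (x ∷ s) t = trans (cong (p x ∧_) (all-++ p s t)) (sym (∧-assoc (p x) _ _))

all-∧ : (p q : A → Bool) (t : List A) → all (λ x → p x ∧ q x) t ≡ all p t ∧ all q t
all-∧ p q []      = refl
all-∧ p q (x ∷ t) rewrite all-∧ p q t with p x | q x | all p t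
... | false | _     | _     = refl
... | true  | true  | _     = refl
... | true  | false | true  = refl
... | true  | false | false = refl

all-mono : ∀ {p q : ℕ → Bool} → (∀ x → p x ≡ true → q x ≡ true) → ∀ t → all p t ≡ true → all q t ≡ true
all-mono         imp []      _ = refl
all-mono {p} {q} imp (x ∷ t) h with p x | imp x
... | true | px⇒qx rewrite px⇒qx refl = all-mono imp t h

∧-interchange : ∀ a b c d → (a ∧ b) ∧ (c ∧ d) ≡ (a ∧ c) ∧ (b ∧ d)
∧-interchange false b     c     d = refl
∧-interchange true  false false d = refl
∧-interchange true  false true  d = refl
∧-interchange true  true  c     d = refl

chain-∷ʳ : ∀ (R : ℕ → ℕ → Bool) t e → chain R (t ++ e ∷ []) ≡ chain R t ∧ all (λ x → R x e) t
chain-∷ʳ R []      e = refl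
chain-∷ʳ R (x ∷ t) e = trans
  (cong₂ _∧_ (trans (all-++ (R x) t (e ∷ [])) (cong (all (R x) t ∧_) (∧-identityʳ (R x e)))) (chain-∷ʳ R t e))
  (∧-interchange (all (R x) t) (R x e) (chain R t) (all (λ y → R y e) t))

-- A filling of the hook: u above the corner, v to its left, e in the corner.
hookOK : List ℕ → List ℕ → ℕ → Bool
hookOK u v e = chain colLE u ∧ all (λ x → colLE x e) u ∧ chain rowLE (v ++ e ∷ [])

Hook : ℕ → ℕ → ∀ m → (Vec ℕ m → ℚ) → ℚ
Hook i j m f = ∑ (allLists i (2 * m)) λ u → ∑ (allLists j (2 * m)) λ v → ∑ (upTo (2 * m)) λ e →
  ⟦ hookOK u v e ⟧ *ℚ f (content m u ⊞ content m (v ++ e ∷ []))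

content-[]-⊞ : ∀ m (d : Vec ℕ m) → content m [] ⊞ d ≡ d
content-[]-⊞ zero    []       = refl
content-[]-⊞ (suc m) (x ∷ d) = cong (x ∷_) (content-[]-⊞ m d)

content-++ : ∀ m u v → content m (u ++ v) ≡ content m u ⊞ content m v
content-++ m []      v = sym (content-[]-⊞ m (content m v))
content-++ m (x ∷ u) v = begin
  content m (x ∷ u ++ v)                             ≡⟨ content-∷ m x (u ++ v) ⟩
  addAt (unmarkedValue x) 1 (content m (u ++ v))     ≡⟨ cong (addAt (unmarkedValue x) 1) (content-++ m u v) ⟩
  addAt (unmarkedValue x) 1 (content m u ⊞ content m v)
    ≡⟨ addAt-⊞ (unmarkedValue x) 1 (content m u) (content m v) ⟨
  addAt (unmarkedValue x) 1 (content m u) ⊞ content m v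
    ≡⟨ cong (_⊞ content m v) (content-∷ m x u) ⟨
  content m (x ∷ u) ⊞ content m v                    ∎

⊞-comm : (d e : Vec ℕ m) → d ⊞ e ≡ e ⊞ d
⊞-comm = zipWith-comm ℕ.+-comm

⊞-assoc : (d e g : Vec ℕ m) → (d ⊞ e) ⊞ g ≡ d ⊞ (e ⊞ g)
⊞-assoc = zipWith-assoc ℕ.+-assoc

Hook-0ˡ : ∀ j m f → Hook 0 j m f ≡ rowPairs 0 (suc j) m f
Hook-0ˡ j m f = begin
  ∑ (allLists j (2 * m)) (λ v → ∑ (upTo (2 * m)) λ e → F (v ++ e ∷ [])) +ℚ 0ℚ
    ≡⟨ cong (_+ℚ 0ℚ) (∑-allLists-∷ʳ j (2 * m) F) ⟨
  ∑ (allLists (suc j) (2 * m)) F +ℚ 0ℚ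
    ≡⟨ cong (_+ℚ 0ℚ) (K.*-identityˡ _) ⟨
  rowPairs 0 (suc j) m f ∎
  where
  F : List ℕ → ℚ
  F t = ⟦ chain rowLE t ⟧ *ℚ f (content m [] ⊞ content m t)

colRowPairs : ℕ → ℕ → ∀ m → (Vec ℕ m → ℚ) → ℚ
colRowPairs i j m f = cols i m λ d → rows j m λ e → f (d ⊞ e)

colRowPairs≡rowPairs : ∀ i j m f → colRowPairs i j m f ≡ rowPairs i j m f
colRowPairs≡rowPairs i j m f = cols≡rows i m λ d → rows j m λ e → f (d ⊞ e)

Hook-0ʳ : ∀ i m f → Hook i 0 m f ≡ rowPairs (suc i) 0 m f
Hook-0ʳ i m f = begin
  ∑ (allLists i (2 * m)) (λ u → ∑ (upTo (2 * m)) (λ e →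
    ⟦ hookOK u [] e ⟧ *ℚ f (content m u ⊞ content m (e ∷ []))) +ℚ 0ℚ)
    ≡⟨ ∑-cong (allLists i (2 * m)) (λ u → trans (K.+-identityʳ _) (∑-cong (upTo (2 * m)) (λ e →
         cong₂ (λ b d → ⟦ b ⟧ *ℚ f d) (ok u e) (sym (content-++ m u (e ∷ [])))))) ⟩
  ∑ (allLists i (2 * m)) (λ u → ∑ (upTo (2 * m)) (λ e → F (u ++ e ∷ [])))
    ≡⟨ ∑-allLists-∷ʳ i (2 * m) F ⟨
  cols (suc i) m f
    ≡⟨ ∑-cong (allLists (suc i) (2 * m)) (λ t → cong (⟦ chain colLE t ⟧ *ℚ_) (pad t)) ⟩
  colRowPairs (suc i) 0 m f
    ≡⟨ colRowPairs≡rowPairs (suc i) 0 m f ⟩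
  rowPairs (suc i) 0 m f ∎
  where
  F : List ℕ → ℚ
  F t = ⟦ chain colLE t ⟧ *ℚ f (content m t)
  ok : ∀ u e → hookOK u [] e ≡ chain colLE (u ++ e ∷ [])
  ok u e = trans (cong (chain colLE u ∧_) (∧-identityʳ _)) (sym (chain-∷ʳ colLE u e))
  pad : ∀ t → f (content m t) ≡ 1ℚ *ℚ f (content m t ⊞ content m []) +ℚ 0ℚ
  pad t = sym (trans (K.+-identityʳ _) (trans (K.*-identityˡ _)
    (cong f (trans (⊞-comm (content m t) (content m [])) (content-[]-⊞ m (content m t))))))

-- Of a column ending in x and a row ending in e, exactly one of the two ways to glue them is
-- admissible: x on top of e, or x to the right of e.
hookOK-split : ∀ u x v e →
  ⟦ hookOK (u ++ x ∷ []) v e ⟧ +ℚ ⟦ hookOK u (v ++ e ∷ []) x ⟧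
  ≡ ⟦ chain colLE (u ++ x ∷ []) ⟧ *ℚ ⟦ chain rowLE (v ++ e ∷ []) ⟧
hookOK-split u x v e = trans (cong₂ (λ a b → ⟦ a ⟧ +ℚ ⟦ b ⟧) eq₁ eq₂) (trans
  (split C p p′ s W q
    -- Only the pair x, e at the joint has to be tested. Transitivity extends the outcome to the
    -- rest of the column if x may stand on e, and to the rest of the row otherwise.
    (λ s≡true → all-mono (λ y r → colLE-trans y x e r s≡true) u)
    (λ s≡false W≡true → all-mono (λ y r → rowLE-trans y e x r (trans (rowLE-not-colLE x e) (cong not s≡false))) v
      (∧-conicalʳ (chain rowLE v) _ (trans (sym (chain-∷ʳ rowLE v e)) W≡true))))
  (cong (λ a → ⟦ a ⟧ *ℚ ⟦ W ⟧) (sym (chain-∷ʳ colLE u x))))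
  where
  C = chain colLE u
  p = all (λ y → colLE y x) u
  p′ = all (λ y → colLE y e) u
  s = colLE x e
  W = chain rowLE (v ++ e ∷ [])
  q = all (λ y → rowLE y x) v
  eq₁ : hookOK (u ++ x ∷ []) v e ≡ (C ∧ p) ∧ (p′ ∧ (s ∧ true)) ∧ W
  eq₁ = cong₂ (λ a b → a ∧ b ∧ W) (chain-∷ʳ colLE u x) (all-++ (λ y → colLE y e) u (x ∷ []))
  eq₂ : hookOK u (v ++ e ∷ []) x ≡ C ∧ p ∧ (W ∧ (q ∧ (not s ∧ true)))
  eq₂ = cong (λ a → C ∧ p ∧ a) (trans (chain-∷ʳ rowLE (v ++ e ∷ []) x) (cong (W ∧_)
    (trans (all-++ (λ y → rowLE y x) v (e ∷ [])) (cong (λ r → q ∧ (r ∧ true)) (rowLE-not-colLE x e)))))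
  ∧-conicalʳ : ∀ a b → a ∧ b ≡ true → b ≡ true
  ∧-conicalʳ true b p = p
  split : ∀ C p p′ s W q → (s ≡ true → p ≡ true → p′ ≡ true) → (s ≡ false → W ≡ true → q ≡ true) →
    ⟦ (C ∧ p) ∧ (p′ ∧ (s ∧ true)) ∧ W ⟧ +ℚ ⟦ C ∧ p ∧ (W ∧ (q ∧ (not s ∧ true))) ⟧ ≡ ⟦ C ∧ p ⟧ *ℚ ⟦ W ⟧
  split false p     p′    s     W     q     _ _ = trans (K.+-identityˡ 0ℚ) (sym (K.zeroˡ ⟦ W ⟧))
  split true  false p′    s     W     q     _ _ = trans (K.+-identityˡ 0ℚ) (sym (K.zeroˡ ⟦ W ⟧))
  split true  true  false true  W     q     h _ with () ← h refl refl
  split true  true  true  true  false q     _ _ = solve 0 (con 0 :+ con 0 := con 1 :* con 0) refl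
  split true  true  true  true  true  false _ _ = solve 0 (con 1 :+ con 0 := con 1 :* con 1) refl
  split true  true  true  true  true  true  _ _ = solve 0 (con 1 :+ con 0 := con 1 :* con 1) refl
  split true  true  false false false q     _ _ = solve 0 (con 0 :+ con 0 := con 1 :* con 0) refl
  split true  true  true  false false q     _ _ = solve 0 (con 0 :+ con 0 := con 1 :* con 0) refl
  split true  true  p′    false true  false _ h with () ← h refl refl
  split true  true  false false true  true  _ _ = solve 0 (con 0 :+ con 1 := con 1 :* con 1) refl
  split true  true  true  false true  true  _ _ = solve 0 (con 0 :+ con 1 := con 1 :* con 1) refl

Hook-suc : ∀ i j m f → Hook (suc i) j m f +ℚ Hook i (suc j) m f ≡ rowPairs (suc i) (suc j) m f
Hook-suc i j m f = begin
  Hook (suc i) j m f +ℚ Hook i (suc j) m f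
    -- In the first hook x ends the column above the corner e; in the second x is itself the corner
    -- and e its left neighbour. The sums are reordered to run over u, x, v, e in both.
    ≡⟨ cong₂ _+ℚ_ (∑-allLists-∷ʳ i B _) (∑-cong U λ u → trans (∑-allLists-∷ʳ j B _) (trans
         (∑-cong V λ v → ∑-swap X X _) (∑-swap V X _))) ⟩
  ∑ U (λ u → ∑ X λ x → ∑ V λ v → ∑ X λ e → ⟦ hookOK (u ++ x ∷ []) v e ⟧ *ℚ D u x v e) +ℚ
  ∑ U (λ u → ∑ X λ x → ∑ V λ v → ∑ X λ e → ⟦ hookOK u (v ++ e ∷ []) x ⟧ *ℚ D′ u x v e)
    ≡⟨ merge ⟩
  ∑ U (λ u → ∑ X λ x → ∑ V λ v → ∑ X λ e →
    ⟦ hookOK (u ++ x ∷ []) v e ⟧ *ℚ D u x v e +ℚ ⟦ hookOK u (v ++ e ∷ []) x ⟧ *ℚ D′ u x v e)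
    ≡⟨ (∑-cong U λ u → ∑-cong X λ x → trans (∑-cong V λ v → trans (∑-cong X λ e → term u x v e)
         (∑-*ˡ (c u x) X _)) (∑-*ˡ (c u x) V _)) ⟩
  ∑ U (λ u → ∑ X λ x → c u x *ℚ ∑ V λ v → ∑ X λ e → ⟦ chain rowLE (v ++ e ∷ []) ⟧ *ℚ D u x v e)
    ≡⟨ (∑-cong U λ u → ∑-cong X λ x → cong (c u x *ℚ_) (∑-allLists-∷ʳ j B _)) ⟨
  ∑ U (λ u → ∑ X λ x → c u x *ℚ rows (suc j) m (λ d → f (content m (u ++ x ∷ []) ⊞ d)))
    ≡⟨ ∑-allLists-∷ʳ i B _ ⟨
  colRowPairs (suc i) (suc j) m f
    ≡⟨ colRowPairs≡rowPairs (suc i) (suc j) m f ⟩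
  rowPairs (suc i) (suc j) m f ∎
  where
  B = 2 * m
  U = allLists i B
  V = allLists j B
  X = upTo B
  c : List ℕ → ℕ → ℚ
  c u x = ⟦ chain colLE (u ++ x ∷ []) ⟧
  D D′ : List ℕ → ℕ → List ℕ → ℕ → ℚ
  D  u x v e = f (content m (u ++ x ∷ []) ⊞ content m (v ++ e ∷ []))
  D′ u x v e = f (content m u ⊞ content m ((v ++ e ∷ []) ++ x ∷ []))
  D≡D′ : ∀ u x v e → D′ u x v e ≡ D u x v e
  D≡D′ u x v e = cong f (begin
    content m u ⊞ content m ((v ++ e ∷ []) ++ x ∷ [])
      ≡⟨ cong (content m u ⊞_) (trans (content-++ m (v ++ e ∷ []) (x ∷ [])) (⊞-comm _ _)) ⟩
    content m u ⊞ (content m (x ∷ []) ⊞ content m (v ++ e ∷ []))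
      ≡⟨ ⊞-assoc (content m u) (content m (x ∷ [])) (content m (v ++ e ∷ [])) ⟨
    (content m u ⊞ content m (x ∷ [])) ⊞ content m (v ++ e ∷ [])
      ≡⟨ cong (_⊞ content m (v ++ e ∷ [])) (content-++ m u (x ∷ [])) ⟨
    content m (u ++ x ∷ []) ⊞ content m (v ++ e ∷ []) ∎)
  term : ∀ u x v e → ⟦ hookOK (u ++ x ∷ []) v e ⟧ *ℚ D u x v e +ℚ ⟦ hookOK u (v ++ e ∷ []) x ⟧ *ℚ D′ u x v e
                   ≡ c u x *ℚ (⟦ chain rowLE (v ++ e ∷ []) ⟧ *ℚ D u x v e)
  term u x v e = trans (cong (λ d → ⟦ hookOK (u ++ x ∷ []) v e ⟧ *ℚ D u x v e +ℚ ⟦ hookOK u (v ++ e ∷ []) x ⟧ *ℚ d) (D≡D′ u x v e))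
    (trans (sym (K.distribʳ (D u x v e) _ _)) (trans (cong (_*ℚ D u x v e) (hookOK-split u x v e)) (K.*-assoc (c u x) _ _)))
  merge : ∀ {g h : List ℕ → ℕ → List ℕ → ℕ → ℚ} →
    ∑ U (λ u → ∑ X λ x → ∑ V λ v → ∑ X (g u x v)) +ℚ ∑ U (λ u → ∑ X λ x → ∑ V λ v → ∑ X (h u x v)) ≡
    ∑ U (λ u → ∑ X λ x → ∑ V λ v → ∑ X λ e → g u x v e +ℚ h u x v e)
  merge = sym (trans (∑-cong U λ u → trans (∑-cong X λ x → trans (∑-cong V λ v → ∑-+ X _ _) (∑-+ V _ _)) (∑-+ X _ _)) (∑-+ U _ _))

+ℚ-cancelˡ : ∀ a {b c} → a +ℚ b ≡ a +ℚ c → b ≡ c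
+ℚ-cancelˡ a {b} {c} eq = begin
  b                     ≡⟨ K.+-identityˡ b ⟨
  0ℚ +ℚ b               ≡⟨ cong (_+ℚ b) (K.-‿inverseˡ a) ⟨
  (-ℚ a +ℚ a) +ℚ b      ≡⟨ K.+-assoc (-ℚ a) a b ⟩
  -ℚ a +ℚ (a +ℚ b)      ≡⟨ cong (-ℚ a +ℚ_) eq ⟩
  -ℚ a +ℚ (a +ℚ c)      ≡⟨ K.+-assoc (-ℚ a) a c ⟨
  (-ℚ a +ℚ a) +ℚ c      ≡⟨ cong (_+ℚ c) (K.-‿inverseˡ a) ⟩
  0ℚ +ℚ c               ≡⟨ K.+-identityˡ c ⟩
  c                     ∎

-- Induction on i: the right side of `Hook-suc` is symmetric, and at i = 0 a single row is compared
-- with a single column.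
Hook-sym : ∀ i j m f → Hook i j m f ≡ Hook j i m f
Hook-sym zero    j m f = trans (Hook-0ˡ j m f) (trans (rowPairs-comm 0 (suc j) m f) (sym (Hook-0ʳ j m f)))
Hook-sym (suc i) j m f = +ℚ-cancelˡ (Hook i (suc j) m f) (begin
  Hook i (suc j) m f +ℚ Hook (suc i) j m f   ≡⟨ K.+-comm (Hook i (suc j) m f) _ ⟩
  Hook (suc i) j m f +ℚ Hook i (suc j) m f   ≡⟨ Hook-suc i j m f ⟩
  rowPairs (suc i) (suc j) m f               ≡⟨ rowPairs-comm (suc i) (suc j) m f ⟩
  rowPairs (suc j) (suc i) m f               ≡⟨ Hook-suc j i m f ⟨
  Hook (suc j) i m f +ℚ Hook j (suc i) m f   ≡⟨ cong (_+ℚ Hook j (suc i) m f) (Hook-sym i (suc j) m f) ⟨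
  Hook i (suc j) m f +ℚ Hook j (suc i) m f   ∎)

-- Both sides satisfy the same two-term recursion, by `Hook-suc` and `Nalt-suc`. Cancelling one term
-- at each step avoids writing out the alternating sum of products.
Hook-expansion : ∀ i j m f →
  Hook i j m f ≡ ∑ (oddComps (i + suc j) (i + suc j)) λ ρ → (wt ρ *ℚ Nalt ρ i) *ℚ powerSum ρ m f
Hook-expansion zero    j m f = trans (Hook-0ˡ j m f) (trans
  (rowPairs-expansion (suc j) (suc j) 0 (suc j) refl ℕ.≤-refl f)
  (∑-cong (oddComps (suc j) (suc j)) λ ρ → cong (λ x → (wt ρ *ℚ x) *ℚ powerSum ρ m f) (sym (Nalt-zero ρ))))
Hook-expansion (suc i) j m f = +ℚ-cancelˡ (Hook i (suc j) m f) (begin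
  Hook i (suc j) m f +ℚ Hook (suc i) j m f
    ≡⟨ trans (K.+-comm (Hook i (suc j) m f) _) (Hook-suc i j m f) ⟩
  rowPairs (suc i) (suc j) m f
    ≡⟨ rowPairs-expansion n n (suc i) (suc j) refl ℕ.≤-refl f ⟩
  ∑ C (λ ρ → (wt ρ *ℚ N ρ (suc i)) *ℚ powerSum ρ m f)
    ≡⟨ ∑-cong C (λ ρ → trans (cong (λ x → (wt ρ *ℚ x) *ℚ powerSum ρ m f) (sym (Nalt-suc ρ i)))
         (solve 4 (λ wt x y p → (wt :* (x :+ y)) :* p := (wt :* y) :* p :+ (wt :* x) :* p) refl
           (wt ρ) (Nalt ρ (suc i)) (Nalt ρ i) (powerSum ρ m f))) ⟩
  ∑ C (λ ρ → (wt ρ *ℚ Nalt ρ i) *ℚ powerSum ρ m f +ℚ (wt ρ *ℚ Nalt ρ (suc i)) *ℚ powerSum ρ m f)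
    ≡⟨ ∑-+ C _ _ ⟩
  ∑ C (λ ρ → (wt ρ *ℚ Nalt ρ i) *ℚ powerSum ρ m f) +ℚ ∑ C (λ ρ → (wt ρ *ℚ Nalt ρ (suc i)) *ℚ powerSum ρ m f)
    ≡⟨ cong (_+ℚ ∑ C (λ ρ → (wt ρ *ℚ Nalt ρ (suc i)) *ℚ powerSum ρ m f)) (trans (Hook-expansion i (suc j) m f)
         (cong (λ s → ∑ (oddComps s s) λ ρ → (wt ρ *ℚ Nalt ρ i) *ℚ powerSum ρ m f) (ℕ.+-suc i (suc j)))) ⟨
  Hook i (suc j) m f +ℚ ∑ C (λ ρ → (wt ρ *ℚ Nalt ρ (suc i)) *ℚ powerSum ρ m f) ∎)
  where
  n = suc i + suc j
  C = oddComps n n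

-- Marked tableaux of hook shape

≡ᵇ-refl : ∀ n → (n ≡ᵇ n) ≡ true
≡ᵇ-refl zero    = refl
≡ᵇ-refl (suc n) = ≡ᵇ-refl n

<⇒<ᵇ≡true : ∀ {a b} → a < b → (a <ᵇ b) ≡ true
<⇒<ᵇ≡true {zero}  {suc b} _       = refl
<⇒<ᵇ≡true {suc a} {suc b} (s≤s p) = <⇒<ᵇ≡true p

≤⇒<ᵇ≡false : ∀ {a b} → a ≤ b → (b <ᵇ a) ≡ false
≤⇒<ᵇ≡false {b = b} z≤n = refl
≤⇒<ᵇ≡false (s≤s p)     = ≤⇒<ᵇ≡false p

<⇒≡ᵇ≡false : ∀ {a b} → a < b → (a ≡ᵇ b) ≡ false
<⇒≡ᵇ≡false {zero}  {suc b} _       = refl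
<⇒≡ᵇ≡false {suc a} {suc b} (s≤s p) = <⇒≡ᵇ≡false p

>⇒≡ᵇ≡false : ∀ {a b} → b < a → (a ≡ᵇ b) ≡ false
>⇒≡ᵇ≡false {suc a} {zero}  _       = refl
>⇒≡ᵇ≡false {suc a} {suc b} (s≤s p) = >⇒≡ᵇ≡false p

Cell : Set
Cell = (ℕ × ℕ) × ℕ

pairOK-below : ∀ {r r′} c x y → r < r′ → pairOK ((r , c) , x) ((r′ , c) , y) ≡ colLE x y
pairOK-below {r} {r′} c x y r<r′
  rewrite <⇒≡ᵇ≡false r<r′ | ≡ᵇ-refl c | <⇒<ᵇ≡true r<r′ = colLE-spec x y

pairOK-right : ∀ r {c c′} x y → c < c′ → pairOK ((r , c) , x) ((r , c′) , y) ≡ rowLE x y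
pairOK-right r {c} {c′} x y c<c′
  rewrite <⇒≡ᵇ≡false c<c′ | ≡ᵇ-refl r | <⇒<ᵇ≡true c<c′ =
  trans (cong ((x ≤ᵇ y) ∧_) (∧-identityʳ _)) (rowLE-spec x y)

pairOK-apart : ∀ {r r′ c c′} x y → r < r′ → c′ < c → pairOK ((r , c) , x) ((r′ , c′) , y) ≡ true
pairOK-apart x y r<r′ c′<c rewrite <⇒≡ᵇ≡false r<r′ | >⇒≡ᵇ≡false c′<c = refl

pairOK-above : ∀ {r r′} c c′ x y → r′ < r → pairOK ((r , c) , x) ((r′ , c′) , y) ≡ true
pairOK-above {r} {r′} c c′ x y r′<r
  rewrite >⇒≡ᵇ≡false r′<r | ≤⇒<ᵇ≡false (ℕ.<⇒≤ r′<r) | ∧-zeroʳ (c ≡ᵇ c′) = refl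

pairOK-left : ∀ r {c c′} x y → c′ ≤ c → pairOK ((r , c) , x) ((r , c′) , y) ≡ true
pairOK-left r {c} {c′} x y c′≤c
  rewrite ≤⇒<ᵇ≡false c′≤c | ∧-zeroʳ (r ≡ᵇ r) | ≤⇒<ᵇ≡false (ℕ.≤-refl {r}) | ∧-zeroʳ (c ≡ᵇ c′) = refl

allPairsOK : List Cell → Bool
allPairsOK z = all (λ a → all (λ b → pairOK a b) z) z

-- `isMarkedTableau` tests ordered pairs in both directions and each box against itself. With the
-- boxes listed downwards and then rightwards, the backward tests are vacuous, and only comparisons
-- with later boxes count.
allPairsOK-∷ : ∀ a z → pairOK a a ≡ true → all (λ b → pairOK b a) z ≡ true →
               allPairsOK (a ∷ z) ≡ all (pairOK a) z ∧ allPairsOK z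
allPairsOK-∷ a z diag back = begin
  (pairOK a a ∧ all (pairOK a) z) ∧ all (λ b → pairOK b a ∧ all (pairOK b) z) z
    ≡⟨ cong₂ (λ p q → (p ∧ all (pairOK a) z) ∧ q) diag (all-∧ (λ b → pairOK b a) (λ b → all (pairOK b) z) z) ⟩
  all (pairOK a) z ∧ (all (λ b → pairOK b a) z ∧ allPairsOK z)
    ≡⟨ cong (λ p → all (pairOK a) z ∧ (p ∧ allPairsOK z)) back ⟩
  all (pairOK a) z ∧ allPairsOK z ∎

colCells : ℕ → ℕ → List ℕ → List Cell
colCells r c []      = []
colCells r c (x ∷ u) = ((r , c) , x) ∷ colCells (suc r) c u

rowCells : ℕ → ℕ → List ℕ → List Cell
rowCells r c []      = []
rowCells r c (x ∷ w) = ((r , c) , x) ∷ rowCells r (suc c) w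

all-colCells : (p : Cell → Bool) (q : ℕ → Bool) → ∀ r {c} → (∀ {r′} y → r ≤ r′ → p ((r′ , c) , y) ≡ q y) →
               ∀ u → all p (colCells r c u) ≡ all q u
all-colCells p q r eq []      = refl
all-colCells p q r eq (x ∷ u) = cong₂ _∧_ (eq x ℕ.≤-refl) (all-colCells p q (suc r) (λ y s → eq y (ℕ.<⇒≤ s)) u)

all-rowCells : (p : Cell → Bool) (q : ℕ → Bool) → ∀ {r} c → (∀ {c′} y → c ≤ c′ → p ((r , c′) , y) ≡ q y) →
               ∀ w → all p (rowCells r c w) ≡ all q w
all-rowCells p q c eq []      = refl
all-rowCells p q c eq (x ∷ w) = cong₂ _∧_ (eq x ℕ.≤-refl) (all-rowCells p q (suc c) (λ y s → eq y (ℕ.<⇒≤ s)) w)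

all-const : ∀ (t : List A) → all (λ _ → true) t ≡ true
all-const []      = refl
all-const (x ∷ t) = all-const t

allPairsOK-row : ∀ r c w → allPairsOK (rowCells r c w) ≡ chain rowLE w
allPairsOK-row r c []      = refl
allPairsOK-row r c (x ∷ w) = trans
  (allPairsOK-∷ ((r , c) , x) (rowCells r (suc c) w) (pairOK-left r x x (ℕ.≤-refl {c}))
    (trans (all-rowCells _ (λ _ → true) (suc c) (λ y c<c′ → pairOK-left r y x (ℕ.<⇒≤ c<c′)) w) (all-const w)))
  (cong₂ _∧_ (all-rowCells _ (rowLE x) (suc c) (λ y c<c′ → pairOK-right r x y c<c′) w) (allPairsOK-row r (suc c) w))

-- A box of the column meets the bottom row only in the corner; the other boxes of that row lie
-- below and strictly to the left, where nothing is compared.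
all-corner : ∀ {r R} x v e c → r < R →
  all (pairOK ((r , c + length v) , x)) (rowCells R c (v ++ e ∷ [])) ≡ colLE x e
all-corner x []      e c r<R rewrite ℕ.+-identityʳ c = trans (∧-identityʳ _) (pairOK-below c x e r<R)
all-corner x (y ∷ v) e c r<R rewrite ℕ.+-suc c (length v) = cong₂ _∧_
  (pairOK-apart {c = suc (c + length v)} {c′ = c} x y r<R (s≤s (ℕ.m≤m+n c (length v)))) (all-corner x v e (suc c) r<R)

allPairsOK-hook : ∀ r u v e → allPairsOK
  (colCells r (1 + length v) u ++ rowCells (r + length u) 1 (v ++ e ∷ [])) ≡ hookOK u v e
allPairsOK-hook r []      v e = allPairsOK-row (r + 0) 1 (v ++ e ∷ [])
allPairsOK-hook r (x ∷ u) v e = begin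
  allPairsOK (a ∷ Z ++ W)
    ≡⟨ allPairsOK-∷ a (Z ++ W) (pairOK-left r x x (ℕ.≤-refl {C})) back ⟩
  all (pairOK a) (Z ++ W) ∧ allPairsOK (Z ++ W)
    ≡⟨ cong₂ _∧_ (trans (all-++ (pairOK a) Z W) (cong₂ _∧_
         (all-colCells (pairOK a) (colLE x) (suc r) (λ y r<r′ → pairOK-below C x y r<r′) u)
         (all-corner x v e 1 r<R)))
       (trans (cong (λ R → allPairsOK (Z ++ rowCells R 1 (v ++ e ∷ []))) (ℕ.+-suc r (length u)))
         (allPairsOK-hook (suc r) u v e)) ⟩
  (all (colLE x) u ∧ colLE x e) ∧ (chain colLE u ∧ (all (λ y → colLE y e) u ∧ chain rowLE (v ++ e ∷ [])))
    ≡⟨ ∧-interchange (all (colLE x) u) (colLE x e) (chain colLE u) _ ⟩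
  (all (colLE x) u ∧ chain colLE u) ∧ (colLE x e ∧ (all (λ y → colLE y e) u ∧ chain rowLE (v ++ e ∷ [])))
    ≡⟨ cong ((all (colLE x) u ∧ chain colLE u) ∧_) (∧-assoc (colLE x e) _ _) ⟨
  hookOK (x ∷ u) v e ∎
  where
  C = 1 + length v
  a = ((r , C) , x)
  Z = colCells (suc r) C u
  W = rowCells (r + suc (length u)) 1 (v ++ e ∷ [])
  r<R : r < r + suc (length u)
  r<R = ℕ.m<m+n r z<s
  back : all (λ b → pairOK b a) (Z ++ W) ≡ true
  back = trans (all-++ _ Z W) (cong₂ _∧_
    (trans (all-colCells _ (λ _ → true) (suc r) (λ y r<r′ → pairOK-above C C y x r<r′) u) (all-const u))
    (trans (all-rowCells _ (λ _ → true) 1 (λ {c′} y _ → pairOK-above c′ C y x r<R) (v ++ e ∷ [])) (all-const (v ++ e ∷ []))))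

hookShape : ℕ → ℕ → List ℕ
hookShape i j = replicate i 1 ++ suc j ∷ []

colBoxes : ℕ → ℕ → ℕ → List (ℕ × ℕ)
colBoxes r c zero    = []
colBoxes r c (suc i) = (r , c) ∷ colBoxes (suc r) c i

-- Each row of length 1 starts in the column where the row below ends, so these rows stack up over
-- the last box of the bottom row. The resulting order of boxes is why a filling is read as
-- `u ++ v ++ e ∷ []`.
ribbonAux-hookShape : ∀ r i j → proj₁ (ribbonAux r (hookShape i j)) ≡
                               colBoxes r (suc j) i ++ rowBoxes (r + i) 1 (suc j)
ribbonAux-column : ∀ r i j → proj₂ (ribbonAux r (hookShape (suc i) j)) ≡ suc j
ribbonAux-column r zero    j = refl
ribbonAux-column r (suc i) j = trans (ℕ.m+n∸n≡m _ 1) (ribbonAux-column (suc r) i j)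
ribbonAux-hookShape r zero          j = cong (λ R → rowBoxes R 1 (suc j)) (sym (ℕ.+-identityʳ r))
ribbonAux-hookShape r (suc zero)    j = cong₂ (λ c R → (r , c) ∷ rowBoxes R 1 (suc j)) (ℕ.+-identityʳ (suc j)) (sym (ℕ.+-comm r 1))
ribbonAux-hookShape r (suc (suc i)) j = cong₂ _∷_
  (cong (r ,_) (trans (ℕ.+-identityʳ _) (ribbonAux-column r (suc i) j)))
  (trans (ribbonAux-hookShape (suc r) (suc i) j)
    (cong (λ R → colBoxes (suc r) (suc j) (suc i) ++ rowBoxes R 1 (suc j)) (sym (ℕ.+-suc r (suc i)))))

rowBoxes-suc : ∀ r c a → rowBoxes r c (suc a) ≡ (r , c) ∷ rowBoxes r (suc c) a
rowBoxes-suc r c a = cong₂ _∷_ (cong (r ,_) (ℕ.+-identityʳ c)) (go a (λ t → t))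
  where
  go : ∀ a (g : ℕ → ℕ) → map (λ t → (r , c + t)) (applyUpTo (λ t → suc (g t)) a) ≡
                         map (λ t → (r , suc c + t)) (applyUpTo g a)
  go zero    g = refl
  go (suc a) g = cong₂ _∷_ (cong (r ,_) (ℕ.+-suc c (g 0))) (go a (g ∘ suc))

zip-rowBoxes : ∀ r c w → zip (rowBoxes r c (length w)) w ≡ rowCells r c w
zip-rowBoxes r c []      = refl
zip-rowBoxes r c (x ∷ w) = trans (cong (λ bs → zip bs (x ∷ w)) (rowBoxes-suc r c (length w)))
  (cong (((r , c) , x) ∷_) (zip-rowBoxes r (suc c) w))

zip-colBoxes-++ : ∀ r c u bs w → zip (colBoxes r c (length u) ++ bs) (u ++ w) ≡ colCells r c u ++ zip bs w
zip-colBoxes-++ r c []      bs w = refl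
zip-colBoxes-++ r c (x ∷ u) bs w = cong (((r , c) , x) ∷_) (zip-colBoxes-++ (suc r) c u bs w)

length-∷ʳ : ∀ (v : List ℕ) e → length (v ++ e ∷ []) ≡ suc (length v)
length-∷ʳ v e = trans (length-++ v) (ℕ.+-comm (length v) 1)

isMarkedTableau-hook : ∀ u v e →
  isMarkedTableau (ribbon (hookShape (length u) (length v))) (u ++ v ++ e ∷ []) ≡ hookOK u v e
isMarkedTableau-hook u v e = trans (cong allPairsOK (begin
  zip (ribbon (hookShape (length u) (length v))) (u ++ w)
    ≡⟨ cong (λ bs → zip bs (u ++ w)) (ribbonAux-hookShape 1 (length u) (length v)) ⟩
  zip (colBoxes 1 (suc (length v)) (length u) ++ rowBoxes R 1 (suc (length v))) (u ++ w)
    ≡⟨ zip-colBoxes-++ 1 (suc (length v)) u _ w ⟩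
  colCells 1 (suc (length v)) u ++ zip (rowBoxes R 1 (suc (length v))) w
    ≡⟨ cong (λ l → colCells 1 (suc (length v)) u ++ zip (rowBoxes R 1 l) w) (sym (length-∷ʳ v e)) ⟩
  colCells 1 (suc (length v)) u ++ zip (rowBoxes R 1 (length w)) w
    ≡⟨ cong (colCells 1 (suc (length v)) u ++_) (zip-rowBoxes R 1 w) ⟩
  colCells 1 (suc (length v)) u ++ rowCells R 1 w ∎)) (allPairsOK-hook 1 u v e)
  where
  w = v ++ e ∷ []
  R = 1 + length u

length-colBoxes : ∀ r c i → length (colBoxes r c i) ≡ i
length-colBoxes r c zero    = refl
length-colBoxes r c (suc i) = cong suc (length-colBoxes (suc r) c i)

length-ribbon-hookShape : ∀ i j → length (ribbon (hookShape i j)) ≡ i + suc j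
length-ribbon-hookShape i j = begin
  length (ribbon (hookShape i j))
    ≡⟨ cong length (ribbonAux-hookShape 1 i j) ⟩
  length (colBoxes 1 (suc j) i ++ rowBoxes (1 + i) 1 (suc j))
    ≡⟨ length-++ (colBoxes 1 (suc j) i) ⟩
  length (colBoxes 1 (suc j) i) + length (rowBoxes (1 + i) 1 (suc j))
    ≡⟨ cong₂ _+_ (length-colBoxes 1 (suc j) i) (trans (length-map _ (upTo (suc j))) (length-upTo (suc j))) ⟩
  i + suc j ∎

∈-allLists⇒length : ∀ l b {t} → t ∈ allLists l b → length t ≡ l
∈-allLists⇒length zero    b (here refl) = refl
∈-allLists⇒length (suc l) b t∈
  with x , t∈x ← satisfied (∈-concatMap⁻ (λ x → map (x ∷_) (allLists l b)) {xs = upTo b} t∈)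
  with t′ , t′∈ , refl ← ∈-map⁻ (x ∷_) t∈x
  = cong suc (∈-allLists⇒length l b t′∈)

ribbonCoeff-hookShape : ∀ i j m c →
  ℕtoℚ (ribbonCoeff (hookShape i j) m c) ≡ Hook i j m (λ d → ⟦ vecEq d c ⟧)
ribbonCoeff-hookShape i j m c = begin
  ℕtoℚ (ribbonCoeff (hookShape i j) m c)
    ≡⟨ ℕtoℚ-length-filterᵇ _ (allLists (length (ribbon (hookShape i j))) B) ⟩
  ∑ (allLists (length (ribbon (hookShape i j))) B) F
    ≡⟨ cong (λ l → ∑ (allLists l B) F) (length-ribbon-hookShape i j) ⟩
  ∑ (allLists (i + suc j) B) F
    ≡⟨ ∑-allLists-++ i (suc j) B F ⟩
  ∑ (allLists i B) (λ u → ∑ (allLists (suc j) B) λ w → F (u ++ w))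
    ≡⟨ (∑-cong (allLists i B) λ u → ∑-allLists-∷ʳ j B (F ∘ (u ++_))) ⟩
  ∑ (allLists i B) (λ u → ∑ (allLists j B) λ v → ∑ (upTo B) λ e → F (u ++ v ++ e ∷ []))
    ≡⟨ (∑-cong-∈ (allLists i B) λ {u} u∈ → ∑-cong-∈ (allLists j B) λ {v} v∈ → ∑-cong (upTo B) λ e →
         term u v e (∈-allLists⇒length i B u∈) (∈-allLists⇒length j B v∈)) ⟩
  Hook i j m (λ d → ⟦ vecEq d c ⟧) ∎
  where
  B = 2 * m
  F : List ℕ → ℚ
  F t = ⟦ isMarkedTableau (ribbon (hookShape i j)) t ∧ vecEq (content m t) c ⟧
  term : ∀ u v e → length u ≡ i → length v ≡ j → F (u ++ v ++ e ∷ []) ≡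
         ⟦ hookOK u v e ⟧ *ℚ ⟦ vecEq (content m u ⊞ content m (v ++ e ∷ [])) c ⟧
  term u v e refl refl = trans (⟦∧⟧ (isMarkedTableau (ribbon (hookShape i j)) (u ++ v ++ e ∷ [])) _)
    (cong₂ (λ a d → ⟦ a ⟧ *ℚ ⟦ vecEq d c ⟧) (isMarkedTableau-hook u v e) (content-++ m u (v ++ e ∷ [])))

-- From compositions to partitions

∑-upTo-≡ᵇ : ∀ {k b} → k < b → (g : ℕ → ℚ) → ∑ (upTo b) (λ x → ⟦ k ≡ᵇ x ⟧ *ℚ g x) ≡ g k
∑-upTo-≡ᵇ {zero} {suc b} _ g = begin
  ∑ (upTo (suc b)) (λ x → ⟦ 0 ≡ᵇ x ⟧ *ℚ g x)           ≡⟨ ∑-upTo-suc b (λ x → ⟦ 0 ≡ᵇ x ⟧ *ℚ g x) ⟩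
  1ℚ *ℚ g 0 +ℚ ∑ (upTo b) (λ x → 0ℚ *ℚ g (suc x))      ≡⟨ cong (1ℚ *ℚ g 0 +ℚ_) (trans (∑-cong (upTo b) λ x → K.zeroˡ (g (suc x))) (∑-zero (upTo b))) ⟩
  1ℚ *ℚ g 0 +ℚ 0ℚ                                      ≡⟨ trans (K.+-identityʳ _) (K.*-identityˡ _) ⟩
  g 0                                                  ∎
∑-upTo-≡ᵇ {suc k} {suc b} (s≤s k<b) g = begin
  ∑ (upTo (suc b)) (λ x → ⟦ suc k ≡ᵇ x ⟧ *ℚ g x)       ≡⟨ ∑-upTo-suc b (λ x → ⟦ suc k ≡ᵇ x ⟧ *ℚ g x) ⟩
  0ℚ *ℚ g 0 +ℚ ∑ (upTo b) (λ x → ⟦ k ≡ᵇ x ⟧ *ℚ g (suc x)) ≡⟨ cong₂ _+ℚ_ (K.zeroˡ (g 0)) (∑-upTo-≡ᵇ k<b (g ∘ suc)) ⟩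
  0ℚ +ℚ g (suc k)                                      ≡⟨ K.+-identityˡ _ ⟩
  g (suc k)                                            ∎

_==_ : List ℕ → List ℕ → Bool
[]      == []      = true
[]      == (y ∷ t) = false
(x ∷ s) == []      = false
(x ∷ s) == (y ∷ t) = (x ≡ᵇ y) ∧ (s == t)

≡ᵇ⇒≡ : ∀ x y → (x ≡ᵇ y) ≡ true → x ≡ y
≡ᵇ⇒≡ x y eq = ℕ.≡ᵇ⇒≡ x y (subst Data.Bool.T (sym eq) _)

∧-true : ∀ {a b} → a ∧ b ≡ true → a ≡ true × b ≡ true
∧-true {true} {true} _ = refl , refl

==⇒≡ : ∀ s t → (s == t) ≡ true → s ≡ t
==⇒≡ []      []      _ = refl
==⇒≡ (x ∷ s) (y ∷ t) p with q , r ← ∧-true {x ≡ᵇ y} p = cong₂ _∷_ (≡ᵇ⇒≡ x y q) (==⇒≡ s t r)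

==-refl : ∀ s → (s == s) ≡ true
==-refl []      = refl
==-refl (x ∷ s) = cong₂ _∧_ (≡ᵇ-refl x) (==-refl s)

-- Each word over the alphabet occurs exactly once among the words of its length.
∑-allLists-== : ∀ σ l b → All (_< b) σ → (h : List ℕ → ℚ) →
  ∑ (allLists l b) (λ t → ⟦ σ == t ⟧ *ℚ h t) ≡ ⟦ length σ ≡ᵇ l ⟧ *ℚ h σ
∑-allLists-== []      zero    b _ h = K.+-identityʳ _
∑-allLists-== (x ∷ σ) zero    b _ h = trans (K.+-identityʳ _) (trans (K.zeroˡ _) (sym (K.zeroˡ _)))
∑-allLists-== []      (suc l) b _ h = begin
  ∑ (allLists (suc l) b) (λ t → ⟦ [] == t ⟧ *ℚ h t)
    ≡⟨ ∑-allLists-suc l b _ ⟩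
  ∑ (upTo b) (λ y → ∑ (allLists l b) λ t → 0ℚ *ℚ h (y ∷ t))
    ≡⟨ ∑-cong (upTo b) (λ y → trans (∑-cong (allLists l b) λ t → K.zeroˡ (h (y ∷ t))) (∑-zero (allLists l b))) ⟩
  ∑ (upTo b) (λ y → 0ℚ)
    ≡⟨ trans (∑-zero (upTo b)) (sym (K.zeroˡ (h []))) ⟩
  0ℚ *ℚ h [] ∎
∑-allLists-== (x ∷ σ) (suc l) b (x<b ∷ σ<b) h = begin
  ∑ (allLists (suc l) b) (λ t → ⟦ (x ∷ σ) == t ⟧ *ℚ h t)
    ≡⟨ ∑-allLists-suc l b _ ⟩
  ∑ (upTo b) (λ y → ∑ (allLists l b) λ t → ⟦ (x ≡ᵇ y) ∧ (σ == t) ⟧ *ℚ h (y ∷ t))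
    ≡⟨ (∑-cong (upTo b) λ y → trans (∑-cong (allLists l b) λ t →
         trans (cong (_*ℚ h (y ∷ t)) (⟦∧⟧ (x ≡ᵇ y) (σ == t))) (K.*-assoc ⟦ x ≡ᵇ y ⟧ _ _))
         (∑-*ˡ ⟦ x ≡ᵇ y ⟧ (allLists l b) _)) ⟩
  ∑ (upTo b) (λ y → ⟦ x ≡ᵇ y ⟧ *ℚ ∑ (allLists l b) λ t → ⟦ σ == t ⟧ *ℚ h (y ∷ t))
    ≡⟨ ∑-upTo-≡ᵇ x<b _ ⟩
  ∑ (allLists l b) (λ t → ⟦ σ == t ⟧ *ℚ h (x ∷ t))
    ≡⟨ ∑-allLists-== σ l b σ<b (h ∘ (x ∷_)) ⟩
  ⟦ length σ ≡ᵇ l ⟧ *ℚ h (x ∷ σ) ∎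

-- Partitions as sorted lists

≥-decTotalOrder : DecTotalOrder _ _ _
≥-decTotalOrder = Flip.decTotalOrder ℕ.≤-decTotalOrder

open Sort ≥-decTotalOrder using (sort; sort-↭; sort-↗)

record Partition (n : ℕ) (lam : List ℕ) : Set where
  constructor partition
  field
    sums     : sum lam ≡ n
    positive : All (1 ≤_) lam
    sorted   : Linked _≥_ lam
open Partition

all⇒All : ∀ t → all (1 ≤ᵇ_) t ≡ true → All (1 ≤_) t
all⇒All []          _ = []
all⇒All (suc x ∷ t) p = s≤s z≤n ∷ all⇒All t p

All⇒all : ∀ {t} → All (1 ≤_) t → all (1 ≤ᵇ_) t ≡ true
All⇒all []            = refl
All⇒all (s≤s _ ∷ pos) = All⇒all pos

≤ᵇ⇒≤ : ∀ x y → (x ≤ᵇ y) ≡ true → x ≤ y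
≤ᵇ⇒≤ x y eq = ℕ.≤ᵇ⇒≤ x y (subst Data.Bool.T (sym eq) _)

≤⇒≤ᵇ : ∀ {x y} → x ≤ y → (x ≤ᵇ y) ≡ true
≤⇒≤ᵇ z≤n     = refl
≤⇒≤ᵇ (s≤s p) = <⇒<ᵇ≡true (s≤s p)

-- The two sides call the local function of isPartition with different values of its unused
-- parameters, which conversion ignores.
isPartition-∷∷ : ∀ n x y t → (sum (x ∷ y ∷ t) ≡ᵇ n) ≡ true → all (1 ≤ᵇ_) (x ∷ y ∷ t) ≡ true →
  isPartition n (x ∷ y ∷ t) ≡ ((y ≤ᵇ x) ∧ isPartition (sum (y ∷ t)) (y ∷ t))
isPartition-∷∷ n x y t s p rewrite s | p | ≡ᵇ-refl (sum (y ∷ t)) | proj₂ (∧-true {1 ≤ᵇ x} p) = refl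

isPartition⇒Partition : ∀ n lam → isPartition n lam ≡ true → Partition n lam
isPartition⇒Partition n lam p = partition (≡ᵇ⇒≡ (sum lam) n (proj₁ q)) (all⇒All lam (proj₁ r)) (linked n lam p)
  where
  q : (sum lam ≡ᵇ n) ≡ true × _
  q = ∧-true p
  r : all (1 ≤ᵇ_) lam ≡ true × _
  r = ∧-true (proj₂ q)
  linked : ∀ n lam → isPartition n lam ≡ true → Linked _≥_ lam
  linked n []          _ = []
  linked n (x ∷ [])    _ = [-]
  linked n (x ∷ y ∷ t) p =
    let s , p′  = ∧-true p
        pos , _ = ∧-true p′
        y≤x , p″ = ∧-true {y ≤ᵇ x} (trans (sym (isPartition-∷∷ n x y t s pos)) p)
    in ≤ᵇ⇒≤ y x y≤x ∷ linked (sum (y ∷ t)) (y ∷ t) p″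

Partition⇒isPartition : ∀ {n lam} → Partition n lam → isPartition n lam ≡ true
Partition⇒isPartition {lam = []}          (partition refl _ _)             = refl
Partition⇒isPartition {lam = x ∷ []}      (partition refl pos@(s≤s _ ∷ []) _) rewrite ≡ᵇ-refl (x + 0) = refl
Partition⇒isPartition {lam = x ∷ y ∷ t} (partition refl (1≤x ∷ pos) (y≤x ∷ srt)) =
  trans (isPartition-∷∷ _ x y t (≡ᵇ-refl (x + (y + sum t))) (All⇒all (1≤x ∷ pos)))
    (cong₂ _∧_ (≤⇒≤ᵇ y≤x) (Partition⇒isPartition (partition refl pos srt)))

length≤sum : ∀ {t} → All (1 ≤_) t → length t ≤ sum t
length≤sum []          = z≤n
length≤sum (1≤x ∷ pos) = ℕ.+-mono-≤ 1≤x (length≤sum pos)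

All≤sum : ∀ t → All (_≤ sum t) t
All≤sum []      = []
All≤sum (x ∷ t) = ℕ.m≤m+n x (sum t) ∷ All.map (λ p → ℕ.≤-trans p (ℕ.m≤n+m (sum t) x)) (All≤sum t)

∑-partitions-expand : ∀ n (g : List ℕ → ℚ) → ∑ (partitions n) g ≡
  ∑ (upTo (suc n)) λ l → ∑ (allLists l (suc n)) λ t → ⟦ isPartition n t ⟧ *ℚ g t
∑-partitions-expand n g = trans
  (∑-filterᵇ (isPartition n) (concatMap (λ l → allLists l (suc n)) (upTo (suc n))) g)
  (∑-concatMap (λ l → allLists l (suc n)) (upTo (suc n)) _)

-- The form in which it is used that `partitions n` lists every partition of n exactly once.
∑-partitions-single : ∀ {n σ} → Partition n σ → (g : List ℕ → ℚ) →
  ∑ (partitions n) (λ lam → ⟦ σ == lam ⟧ *ℚ g lam) ≡ g σ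
∑-partitions-single {n} {σ} σ⊢n g = begin
  ∑ (partitions n) (λ lam → ⟦ σ == lam ⟧ *ℚ g lam)
    ≡⟨ ∑-partitions-expand n _ ⟩
  ∑ (upTo (suc n)) (λ l → ∑ (allLists l (suc n)) λ t → ⟦ isPartition n t ⟧ *ℚ (⟦ σ == t ⟧ *ℚ g t))
    ≡⟨ (∑-cong (upTo (suc n)) λ l → trans
         (∑-cong (allLists l (suc n)) λ t → exchange ⟦ isPartition n t ⟧ ⟦ σ == t ⟧ (g t))
         (∑-allLists-== σ l (suc n) σ<1+n (λ t → ⟦ isPartition n t ⟧ *ℚ g t))) ⟩
  ∑ (upTo (suc n)) (λ l → ⟦ length σ ≡ᵇ l ⟧ *ℚ (⟦ isPartition n σ ⟧ *ℚ g σ))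
    ≡⟨ ∑-upTo-≡ᵇ (s≤s |σ|≤n) (λ _ → ⟦ isPartition n σ ⟧ *ℚ g σ) ⟩
  ⟦ isPartition n σ ⟧ *ℚ g σ
    ≡⟨ cong (λ b → ⟦ b ⟧ *ℚ g σ) (Partition⇒isPartition σ⊢n) ⟩
  1ℚ *ℚ g σ
    ≡⟨ K.*-identityˡ (g σ) ⟩
  g σ ∎
  where
  exchange : ∀ x y z → x *ℚ (y *ℚ z) ≡ y *ℚ (x *ℚ z)
  exchange = solve 3 (λ x y z → x :* (y :* z) := y :* (x :* z)) refl
  σ<1+n : All (_< suc n) σ
  σ<1+n = All.map (λ p → s≤s (subst (_ ≤_) (sums σ⊢n) p)) (All≤sum σ)
  |σ|≤n : length σ ≤ n
  |σ|≤n = subst (length σ ≤_) (sums σ⊢n) (length≤sum (positive σ⊢n))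

∑-partitions-cong : ∀ n {g h : List ℕ → ℚ} → (∀ lam → Partition n lam → g lam ≡ h lam) →
  ∑ (partitions n) g ≡ ∑ (partitions n) h
∑-partitions-cong n {g} {h} eq = trans (∑-partitions-expand n g) (trans
  (∑-cong (upTo (suc n)) λ l → ∑-cong (allLists l (suc n)) λ t → term t (isPartition n t) refl)
  (sym (∑-partitions-expand n h)))
  where
  term : ∀ t b → isPartition n t ≡ b → ⟦ b ⟧ *ℚ g t ≡ ⟦ b ⟧ *ℚ h t
  term t false _ = trans (K.zeroˡ (g t)) (sym (K.zeroˡ (h t)))
  term t true  p = cong (1ℚ *ℚ_) (eq t (isPartition⇒Partition n t p))

Partition-↭ : ∀ {n σ τ} → Partition n σ → Partition n τ → σ ↭ τ → σ ≡ τ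
Partition-↭ σ⊢n τ⊢n σ↭τ = Pointwise-≡⇒≡
  (↗↭↗⇒≋ (DecTotalOrder.totalOrder ≥-decTotalOrder) (sorted σ⊢n) (sorted τ⊢n) (↭⇒↭ₛ σ↭τ))

OddComp⇒positive : ∀ {n ρ} → OddComp n ρ → All (1 ≤_) ρ
OddComp⇒positive []                = []
OddComp⇒positive (_∷_ {r} odd-r c) = odd⇒1≤ {r} odd-r ∷ OddComp⇒positive c

sort-Partition : ∀ {n ρ} → OddComp n ρ → Partition n (sort ρ)
sort-Partition {ρ = ρ} c = partition (trans (sum-↭ (sort-↭ ρ)) (OddComp⇒sum c))
  (All-resp-↭ (↭-sym (sort-↭ ρ)) (OddComp⇒positive c)) (sort-↗ ρ)

addAt-comm : ∀ v r v′ r′ (d : Vec ℕ m) → addAt v r (addAt v′ r′ d) ≡ addAt v′ r′ (addAt v r d)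
addAt-comm v       r v′       r′ []      = refl
addAt-comm zero    r zero     r′ (x ∷ d) = cong (_∷ d) (trans (sym (ℕ.+-assoc r r′ x))
  (trans (cong (_+ x) (ℕ.+-comm r r′)) (ℕ.+-assoc r′ r x)))
addAt-comm zero    r (suc v′) r′ (x ∷ d) = refl
addAt-comm (suc v) r zero     r′ (x ∷ d) = refl
addAt-comm (suc v) r (suc v′) r′ (x ∷ d) = cong (x ∷_) (addAt-comm v r v′ r′ d)

powerSum-cong : ∀ ρ m {f g : Vec ℕ m → ℚ} → (∀ d → f d ≡ g d) → powerSum ρ m f ≡ powerSum ρ m g
powerSum-cong ρ m eq = ∑-cong (allLists (length ρ) m) λ t → eq (weight m ρ t)

powerSum-↭ : ∀ {ρ σ} m f → ρ ↭ σ → powerSum ρ m f ≡ powerSum σ m f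
powerSum-↭ m f ↭.refl = refl
powerSum-↭ {r ∷ ρ} {r ∷ σ} m f (↭.prep r p) = trans (powerSum-∷ r ρ m f)
  (trans (∑-cong (upTo m) λ v → powerSum-↭ m (f ∘ addAt v r) p) (sym (powerSum-∷ r σ m f)))
powerSum-↭ {r ∷ s ∷ ρ} {s ∷ r ∷ σ} m f (↭.swap r s p) = begin
  powerSum (r ∷ s ∷ ρ) m f
    ≡⟨ trans (powerSum-∷ r (s ∷ ρ) m f) (∑-cong (upTo m) λ v → powerSum-∷ s ρ m (f ∘ addAt v r)) ⟩
  ∑ (upTo m) (λ v → ∑ (upTo m) λ v′ → powerSum ρ m (f ∘ addAt v r ∘ addAt v′ s))
    ≡⟨ ∑-swap (upTo m) (upTo m) _ ⟩
  ∑ (upTo m) (λ v′ → ∑ (upTo m) λ v → powerSum ρ m (f ∘ addAt v r ∘ addAt v′ s))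
    ≡⟨ (∑-cong (upTo m) λ v′ → ∑-cong (upTo m) λ v → trans
         (powerSum-cong ρ m λ d → cong f (addAt-comm v r v′ s d)) (powerSum-↭ m (f ∘ addAt v′ s ∘ addAt v r) p)) ⟩
  ∑ (upTo m) (λ v′ → ∑ (upTo m) λ v → powerSum σ m (f ∘ addAt v′ s ∘ addAt v r))
    ≡⟨ trans (powerSum-∷ s (r ∷ σ) m f) (∑-cong (upTo m) λ v′ → powerSum-∷ r σ m (f ∘ addAt v′ s)) ⟨
  powerSum (s ∷ r ∷ σ) m f ∎
powerSum-↭ m f (↭.trans p q) = trans (powerSum-↭ m f p) (powerSum-↭ m f q)

shift-∘ : ∀ r s (h : ℕ → ℚ) i → shift 0ℚ r (shift 0ℚ s h) i ≡ shift 0ℚ (r + s) h i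
shift-∘ zero    s h i       = refl
shift-∘ (suc r) s h zero    = refl
shift-∘ (suc r) s h (suc i) = shift-∘ r s h i

Nalt-↭ : ∀ {ρ σ} → ρ ↭ σ → ∀ i → Nalt ρ i ≡ Nalt σ i
Nalt-↭ ↭.refl i = refl
Nalt-↭ (↭.prep r p) i = cong₂ _+ℚ_ (Nalt-↭ p i) (shift-cong r i (Nalt-↭ p))
Nalt-↭ (↭.swap {ρ} {σ} r s p) i = begin
  (Nalt ρ i +ℚ shift 0ℚ s (Nalt ρ) i) +ℚ shift 0ℚ r (Nalt (s ∷ ρ)) i
    ≡⟨ cong₂ _+ℚ_ (cong₂ _+ℚ_ (Nalt-↭ p i) (shift-cong s i (Nalt-↭ p))) (trans
         (shift-cong r i λ b → cong₂ _+ℚ_ (Nalt-↭ p b) (shift-cong s b (Nalt-↭ p)))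
         (shift-⊕ r (Nalt σ) (shift 0ℚ s (Nalt σ)) i)) ⟩
  (Nalt σ i +ℚ shift 0ℚ s (Nalt σ) i) +ℚ (shift 0ℚ r (Nalt σ) i +ℚ shift 0ℚ r (shift 0ℚ s (Nalt σ)) i)
    ≡⟨ +ℚ-interchange (Nalt σ i) _ _ _ ⟩
  (Nalt σ i +ℚ shift 0ℚ r (Nalt σ) i) +ℚ (shift 0ℚ s (Nalt σ) i +ℚ shift 0ℚ r (shift 0ℚ s (Nalt σ)) i)
    ≡⟨ cong (λ x → (Nalt σ i +ℚ shift 0ℚ r (Nalt σ) i) +ℚ (shift 0ℚ s (Nalt σ) i +ℚ x)) (trans
         (shift-∘ r s (Nalt σ) i) (trans (cong (λ q → shift 0ℚ q (Nalt σ) i) (ℕ.+-comm r s)) (sym (shift-∘ s r (Nalt σ) i)))) ⟩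
  (Nalt σ i +ℚ shift 0ℚ r (Nalt σ) i) +ℚ (shift 0ℚ s (Nalt σ) i +ℚ shift 0ℚ s (shift 0ℚ r (Nalt σ)) i)
    ≡⟨ cong ((Nalt σ i +ℚ shift 0ℚ r (Nalt σ) i) +ℚ_) (shift-⊕ s (Nalt σ) (shift 0ℚ r (Nalt σ)) i) ⟨
  (Nalt σ i +ℚ shift 0ℚ r (Nalt σ) i) +ℚ shift 0ℚ s (Nalt (r ∷ σ)) i ∎
Nalt-↭ (↭.trans p q) i = trans (Nalt-↭ p i) (Nalt-↭ q i)

-- The coefficient of p_lam after compositions are grouped by their decreasing rearrangement.
collect : List (List ℕ) → (List ℕ → ℚ) → List ℕ → ℚ
collect C c lam = ∑ C λ ρ → ⟦ sort ρ == lam ⟧ *ℚ c ρ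

collect-expansion : ∀ n C c m f → (∀ {ρ} → ρ ∈ C → OddComp n ρ) →
  ∑ C (λ ρ → c ρ *ℚ powerSum ρ m f) ≡ ∑ (partitions n) (λ lam → collect C c lam *ℚ powerSum lam m f)
collect-expansion n C c m f odds = begin
  ∑ C (λ ρ → c ρ *ℚ powerSum ρ m f)
    ≡⟨ ∑-cong-∈ C (λ {ρ} ρ∈ → single ρ (odds ρ∈)) ⟩
  ∑ C (λ ρ → ∑ (partitions n) λ lam → (⟦ sort ρ == lam ⟧ *ℚ c ρ) *ℚ powerSum lam m f)
    ≡⟨ ∑-swap C (partitions n) _ ⟩
  ∑ (partitions n) (λ lam → ∑ C λ ρ → (⟦ sort ρ == lam ⟧ *ℚ c ρ) *ℚ powerSum lam m f)
    ≡⟨ ∑-cong (partitions n) (λ lam → ∑-*ʳ (powerSum lam m f) C _) ⟩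
  ∑ (partitions n) (λ lam → collect C c lam *ℚ powerSum lam m f) ∎
  where
  single : ∀ ρ → OddComp n ρ →
    c ρ *ℚ powerSum ρ m f ≡ ∑ (partitions n) λ lam → (⟦ sort ρ == lam ⟧ *ℚ c ρ) *ℚ powerSum lam m f
  single ρ ρ⊢n = begin
    c ρ *ℚ powerSum ρ m f
      ≡⟨ cong (c ρ *ℚ_) (powerSum-↭ m f (↭-sym (sort-↭ ρ))) ⟩
    c ρ *ℚ powerSum (sort ρ) m f
      ≡⟨ ∑-partitions-single (sort-Partition ρ⊢n) (λ lam → c ρ *ℚ powerSum lam m f) ⟨
    ∑ (partitions n) (λ lam → ⟦ sort ρ == lam ⟧ *ℚ (c ρ *ℚ powerSum lam m f))
      ≡⟨ ∑-cong (partitions n) (λ lam → K.*-assoc ⟦ sort ρ == lam ⟧ (c ρ) (powerSum lam m f)) ⟨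
    ∑ (partitions n) (λ lam → (⟦ sort ρ == lam ⟧ *ℚ c ρ) *ℚ powerSum lam m f) ∎

-- Linear independence of power sums

nonzeros : Vec ℕ m → List ℕ
nonzeros []            = []
nonzeros (zero  ∷ d)   = nonzeros d
nonzeros (suc x ∷ d)   = suc x ∷ nonzeros d

nonzeros-fromList : ∀ {σ} → All (1 ≤_) σ → nonzeros (fromList σ) ≡ σ
nonzeros-fromList []              = refl
nonzeros-fromList (s≤s _ ∷ pos) = cong (_ ∷_) (nonzeros-fromList pos)

nonzeros-addAt : ∀ v {r} → 1 ≤ r → (d : Vec ℕ m) →
  nonzeros (addAt v r d) ↭ r ∷ nonzeros d ⊎ length (nonzeros (addAt v r d)) ≡ length (nonzeros d)
nonzeros-addAt v       (s≤s _) []            = inj₂ refl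
nonzeros-addAt zero {suc r} (s≤s _) (zero  ∷ d)
  rewrite ℕ.+-identityʳ r = inj₁ ↭.refl
nonzeros-addAt zero    (s≤s _) (suc x ∷ d)   = inj₂ refl
nonzeros-addAt (suc v) 1≤r     (zero  ∷ d)   = nonzeros-addAt v 1≤r d
nonzeros-addAt (suc v) 1≤r     (suc x ∷ d)   with nonzeros-addAt v 1≤r d
... | inj₁ p  = inj₁ (↭.trans (↭.prep (suc x) p) (↭.swap (suc x) _ ↭.refl))
... | inj₂ eq = inj₂ (cong suc eq)

nonzeros-weight-[] : ∀ m lam → nonzeros (weight m lam []) ≡ []
nonzeros-weight-[] zero    lam       = refl
nonzeros-weight-[] (suc m) []        = nonzeros-weight-[] m []
nonzeros-weight-[] (suc m) (x ∷ lam) = nonzeros-weight-[] m []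

-- A map from parts to variables either keeps the parts in separate variables, and then the
-- exponents are the parts, or merges or drops some, and then fewer exponents remain.
nonzeros-weight : ∀ m {lam} → All (1 ≤_) lam → ∀ g →
  nonzeros (weight m lam g) ↭ lam ⊎ length (nonzeros (weight m lam g)) < length lam
nonzeros-weight m []                g rewrite nonzeros-weight-[] m [] = inj₁ ↭.refl
nonzeros-weight m {r ∷ lam} (1≤r ∷ pos) []
  rewrite nonzeros-weight-[] m (r ∷ lam) = inj₂ z<s
nonzeros-weight m {r ∷ lam} (1≤r ∷ pos) (v ∷ g)
  rewrite weight-∷ m r lam v g with nonzeros-addAt v 1≤r (weight m lam g) | nonzeros-weight m pos g
... | inj₁ p  | inj₁ q = inj₁ (↭.trans p (↭.prep r q))
... | inj₁ p  | inj₂ q = inj₂ (s≤s (subst (_≤ length lam) (sym (↭-length p)) q))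
... | inj₂ eq | inj₁ q = inj₂ (s≤s (ℕ.≤-reflexive (trans eq (↭-length q))))
... | inj₂ eq | inj₂ q = inj₂ (ℕ.<-trans (subst (_< length lam) (sym eq) q) (ℕ.n<1+n (length lam)))

indicator : Vec ℕ m → Vec ℕ m → ℚ
indicator c d = ⟦ vecEq d c ⟧

-- The monomial x^σ involves as many variables as σ has parts. With no more parts than that, p_lam
-- produces it only by giving each part its own variable, which would make lam a rearrangement of σ.
powerSum-triangular : ∀ {n σ lam} → Partition n σ → Partition n lam → length lam ≤ length σ → ¬ (σ ≡ lam) →
  powerSum lam (length σ) (indicator (fromList σ)) ≡ 0ℚ
powerSum-triangular {n} {σ} {lam} σ⊢n lam⊢n |lam|≤|σ| σ≢lam =
  trans (∑-cong (allLists (length lam) (length σ)) term) (∑-zero (allLists (length lam) (length σ)))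
  where
  absurd : ∀ g → ¬ (weight (length σ) lam g ≡ fromList σ)
  absurd g eq with nonzeros-weight (length σ) (positive lam⊢n) g
  ... | p rewrite eq | nonzeros-fromList (positive σ⊢n) with p
  ...   | inj₁ σ↭lam     = σ≢lam (Partition-↭ σ⊢n lam⊢n σ↭lam)
  ...   | inj₂ |σ|<|lam| = ℕ.<⇒≱ |σ|<|lam| |lam|≤|σ|
  term : ∀ g → indicator (fromList σ) (weight (length σ) lam g) ≡ 0ℚ
  term g with ≡-dec ℕ._≟_ (weight (length σ) lam g) (fromList σ)
  ... | yes eq = ⊥-elim (absurd g eq)
  ... | no _   = refl

weight-map-suc : ∀ m σ g → weight (suc m) σ (map suc g) ≡ 0 ∷ weight m σ g
weight-map-suc m []      g       = refl
weight-map-suc m (r ∷ σ) []      = refl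
weight-map-suc m (r ∷ σ) (v ∷ g) = begin
  weight (suc m) (r ∷ σ) (suc v ∷ map suc g)        ≡⟨ weight-∷ (suc m) r σ (suc v) (map suc g) ⟩
  addAt (suc v) r (weight (suc m) σ (map suc g))    ≡⟨ cong (addAt (suc v) r) (weight-map-suc m σ g) ⟩
  0 ∷ addAt v r (weight m σ g)                      ≡⟨ cong (0 ∷_) (weight-∷ m r σ v g) ⟨
  0 ∷ weight m (r ∷ σ) (v ∷ g)                      ∎

-- The word 0, 1, ..., m - 1, which sends each part to its own variable, built so that
-- `weight-map-suc` can remove one variable at a time.
diagonal : ℕ → List ℕ
diagonal zero    = []
diagonal (suc m) = 0 ∷ map suc (diagonal m)

weight-diagonal : ∀ σ → weight (length σ) σ (diagonal (length σ)) ≡ fromList σ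
weight-diagonal []      = refl
weight-diagonal (r ∷ σ) = begin
  weight (suc l) (r ∷ σ) (0 ∷ map suc (diagonal l))          ≡⟨ weight-∷ (suc l) r σ 0 (map suc (diagonal l)) ⟩
  addAt 0 r (weight (suc l) σ (map suc (diagonal l)))        ≡⟨ cong (addAt 0 r) (weight-map-suc l σ (diagonal l)) ⟩
  r + 0 ∷ weight l σ (diagonal l)                            ≡⟨ cong₂ _∷_ (ℕ.+-identityʳ r) (weight-diagonal σ) ⟩
  fromList (r ∷ σ)                                           ∎
  where l = length σ

∈-allLists⁺ : ∀ {b t} → All (_< b) t → t ∈ allLists (length t) b
∈-allLists⁺ []                        = here refl
∈-allLists⁺ {b} {x ∷ t} (x<b ∷ t<b) =
  ∈-concatMap⁺ (λ x → map (x ∷_) (allLists (length t) b)) (lose (∈-upTo⁺ x<b) (∈-map⁺ (x ∷_) (∈-allLists⁺ t<b)))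

diagonal-∈ : ∀ m → diagonal m ∈ allLists m m
diagonal-∈ m = subst (λ l → diagonal m ∈ allLists l m) (length-diagonal m) (∈-allLists⁺ (diagonal-< m))
  where
  map-suc-< : ∀ {m t} → All (_< m) t → All (_< suc m) (map suc t)
  map-suc-< []      = []
  map-suc-< (p ∷ q) = s≤s p ∷ map-suc-< q
  diagonal-< : ∀ m → All (_< m) (diagonal m)
  diagonal-< zero    = []
  diagonal-< (suc m) = z<s ∷ map-suc-< (diagonal-< m)
  length-map-suc : ∀ (t : List ℕ) → length (map suc t) ≡ length t
  length-map-suc []      = refl
  length-map-suc (x ∷ t) = cong suc (length-map-suc t)
  length-diagonal : ∀ m → length (diagonal m) ≡ m
  length-diagonal zero    = refl
  length-diagonal (suc m) = cong suc (trans (length-map-suc (diagonal m)) (length-diagonal m))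

vecEq-refl : (c : Vec ℕ m) → vecEq c c ≡ true
vecEq-refl c with ≡-dec ℕ._≟_ c c
... | yes _ = refl
... | no c≢c = ⊥-elim (c≢c refl)

powerSumCoeff≡powerSum : ∀ lam m c → ℕtoℚ (powerSumCoeff lam m c) ≡ powerSum lam m (indicator c)
powerSumCoeff≡powerSum lam m c = ℕtoℚ-length-filterᵇ (λ f → vecEq (weight m lam f) c) (allLists (length lam) m)

-- The exact value is the product of the factorials of the multiplicities. Being nonzero suffices
-- for cancellation, and `diagonal` witnesses it.
powerSum-diagonal : ∀ σ → ∃[ k ] powerSum σ (length σ) (indicator (fromList σ)) ≡ ℕtoℚ (suc k)
powerSum-diagonal σ = let k , eq = nonempty hit in k , trans (sym (powerSumCoeff≡powerSum σ l c)) (cong ℕtoℚ eq)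
  where
  l = length σ
  c = fromList σ
  hits = filterᵇ (λ f → vecEq (weight l σ f) c) (allLists l l)
  hit : diagonal l ∈ hits
  hit = ∈-filter⁺ (T? ∘ (λ f → vecEq (weight l σ f) c)) (diagonal-∈ l)
    (subst T (sym (trans (cong (λ d → vecEq d c) (weight-diagonal σ)) (vecEq-refl c))) _)
  nonempty : ∀ {x} {xs : List (List ℕ)} → x ∈ xs → ∃[ k ] length xs ≡ suc k
  nonempty (here _)  = _ , refl
  nonempty (there _) = _ , refl

*ℚ-cancelʳ-suc : ∀ k {x y} → x *ℚ ℕtoℚ (suc k) ≡ y *ℚ ℕtoℚ (suc k) → x ≡ y
*ℚ-cancelʳ-suc k {x} {y} eq = begin
  x                                            ≡⟨ undo x ⟩
  (x *ℚ ℕtoℚ (suc k)) *ℚ inv (suc k)           ≡⟨ cong (_*ℚ inv (suc k)) eq ⟩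
  (y *ℚ ℕtoℚ (suc k)) *ℚ inv (suc k)           ≡⟨ undo y ⟨
  y                                            ∎
  where
  undo : ∀ z → z ≡ (z *ℚ ℕtoℚ (suc k)) *ℚ inv (suc k)
  undo z = sym (trans (K.*-assoc z _ _) (trans
    (cong (z *ℚ_) (trans (K.*-comm (ℕtoℚ (suc k)) _) (inv-inverse k))) (K.*-identityʳ z)))

-- By descending induction on the length of σ: among the power sums of length at most ℓ(σ), only
-- p_σ contributes to the coefficient of x^σ.
powerSum-independent : ∀ n (a b : List ℕ → ℚ) →
  (∀ m c → ∑ (partitions n) (λ lam → a lam *ℚ powerSum lam m (indicator c))
         ≡ ∑ (partitions n) (λ lam → b lam *ℚ powerSum lam m (indicator c))) →
  ∀ {σ} → Partition n σ → a σ ≡ b σ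
powerSum-independent n a b sums-agree {σ₀} σ₀⊢n = descend (suc n) σ₀⊢n (ℕ.m≤n+m (suc n) (length σ₀))
  where
  descend : ∀ t {σ} → Partition n σ → n < length σ + t → a σ ≡ b σ
  -- The descent starts from lengths above n, which no partition of n attains.
  descend zero    {σ} σ⊢n n<|σ| = ⊥-elim (ℕ.<⇒≱ (subst (n <_) (ℕ.+-identityʳ (length σ)) n<|σ|)
    (subst (length σ ≤_) (sums σ⊢n) (length≤sum (positive σ⊢n))))
  descend (suc t) {σ} σ⊢n n<|σ|+1+t = sym (*ℚ-cancelʳ-suc (proj₁ (powerSum-diagonal σ))
    (subst (λ x → b σ *ℚ x ≡ a σ *ℚ x) (proj₂ (powerSum-diagonal σ)) (+ℚ-cancelˡ (S a) (begin
      S a +ℚ b σ *ℚ X σ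
        ≡⟨ cong (S a +ℚ_) (∑-partitions-single σ⊢n (λ lam → b lam *ℚ X lam)) ⟨
      S a +ℚ ∑ (partitions n) (λ lam → ⟦ σ == lam ⟧ *ℚ (b lam *ℚ X lam))
        ≡⟨ ∑-+ (partitions n) _ _ ⟨
      ∑ (partitions n) (λ lam → a lam *ℚ X lam +ℚ ⟦ σ == lam ⟧ *ℚ (b lam *ℚ X lam))
        -- Rather than isolating σ in the list of partitions, each sum has received the σ-term of
        -- the other. The two sums then agree term by term: at σ by commutativity, elsewhere by
        -- induction or triangularity.
        ≡⟨ ∑-partitions-cong n (λ lam lam⊢n → term lam lam⊢n (σ == lam) refl) ⟩
      ∑ (partitions n) (λ lam → b lam *ℚ X lam +ℚ ⟦ σ == lam ⟧ *ℚ (a lam *ℚ X lam))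
        ≡⟨ ∑-+ (partitions n) _ _ ⟩
      S b +ℚ ∑ (partitions n) (λ lam → ⟦ σ == lam ⟧ *ℚ (a lam *ℚ X lam))
        ≡⟨ cong₂ _+ℚ_ (sym (sums-agree (length σ) (fromList σ))) (∑-partitions-single σ⊢n (λ lam → a lam *ℚ X lam)) ⟩
      S a +ℚ a σ *ℚ X σ ∎))))
    where
    X : List ℕ → ℚ
    X lam = powerSum lam (length σ) (indicator (fromList σ))
    S : (List ℕ → ℚ) → ℚ
    S c = ∑ (partitions n) λ lam → c lam *ℚ X lam
    term : ∀ lam → Partition n lam → ∀ e → (σ == lam) ≡ e →
      a lam *ℚ X lam +ℚ ⟦ e ⟧ *ℚ (b lam *ℚ X lam) ≡ b lam *ℚ X lam +ℚ ⟦ e ⟧ *ℚ (a lam *ℚ X lam)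
    term lam lam⊢n true  _  = solve 2 (λ x y → x :+ con 1 :* y := y :+ con 1 :* x) refl _ _
    term lam lam⊢n false ne = cong₂ (λ x y → x +ℚ 0ℚ *ℚ y) agree (sym agree)
      where
      agree : a lam *ℚ X lam ≡ b lam *ℚ X lam
      agree with ℕ.<-≤-connex (length σ) (length lam)
      ... | inj₁ |σ|<|lam| = cong (_*ℚ X lam) (descend t lam⊢n
        (ℕ.<-≤-trans n<|σ|+1+t (subst (_≤ length lam + t) (sym (ℕ.+-suc (length σ) t)) (ℕ.+-monoˡ-≤ t |σ|<|lam|))))
      ... | inj₂ |lam|≤|σ| = trans (cong (a lam *ℚ_) X≡0) (trans (trans (K.zeroʳ _) (sym (K.zeroʳ _)))
        (cong (b lam *ℚ_) (sym X≡0)))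
        where
        X≡0 : X lam ≡ 0ℚ
        X≡0 = powerSum-triangular σ⊢n lam⊢n |lam|≤|σ| λ σ≡lam → contradiction
          (trans (sym ne) (trans (cong (σ ==_) (sym σ≡lam)) (==-refl σ))) λ ()

-- Criteria for p-positivity

opaque
  unfolding _+ℚ_

  +ℚ-nonNeg : ∀ {x y} → 0ℚ ℚ.≤ x → 0ℚ ℚ.≤ y → 0ℚ ℚ.≤ x +ℚ y
  +ℚ-nonNeg p q = ℚ.+-mono-≤ p q

  +ℚ-pos-nonNeg : ∀ {x y} → 0ℚ ℚ.< x → 0ℚ ℚ.≤ y → 0ℚ ℚ.< x +ℚ y
  +ℚ-pos-nonNeg p q = ℚ.+-mono-<-≤ p q

  +ℚ-nonNeg-pos : ∀ {x y} → 0ℚ ℚ.≤ x → 0ℚ ℚ.< y → 0ℚ ℚ.< x +ℚ y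
  +ℚ-nonNeg-pos p q = ℚ.+-mono-≤-< p q

  +ℚ-nonPos : ∀ {x y} → x ℚ.≤ 0ℚ → y ℚ.≤ 0ℚ → x +ℚ y ℚ.≤ 0ℚ
  +ℚ-nonPos p q = ℚ.+-mono-≤ p q

  +ℚ-nonPos-neg : ∀ {x y} → x ℚ.≤ 0ℚ → y ℚ.< 0ℚ → x +ℚ y ℚ.< 0ℚ
  +ℚ-nonPos-neg p q = ℚ.+-mono-≤-< p q

  *ℚ-nonNeg : ∀ {x y} → 0ℚ ℚ.≤ x → 0ℚ ℚ.≤ y → 0ℚ ℚ.≤ x *ℚ y
  *ℚ-nonNeg {x} {y} p q = ℚ.nonNegative⁻¹ (x ℚ.* y)
    {{ℚ.nonNeg*nonNeg⇒nonNeg x {{ℚ.nonNegative p}} y {{ℚ.nonNegative q}}}}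

  *ℚ-pos : ∀ {x y} → 0ℚ ℚ.< x → 0ℚ ℚ.< y → 0ℚ ℚ.< x *ℚ y
  *ℚ-pos {x} {y} p q = subst (ℚ._< x ℚ.* y) (ℚ.*-zeroʳ x) (ℚ.*-monoʳ-<-pos x {{ℚ.positive p}} q)

  *ℚ-pos-neg : ∀ {x y} → 0ℚ ℚ.< x → y ℚ.< 0ℚ → x *ℚ y ℚ.< 0ℚ
  *ℚ-pos-neg {x} {y} p q = subst (x ℚ.* y ℚ.<_) (ℚ.*-zeroʳ x) (ℚ.*-monoʳ-<-pos x {{ℚ.positive p}} q)

0<1 : 0ℚ ℚ.< 1ℚ
0<1 = ℚ.positive⁻¹ 1ℚ

0≤1 : 0ℚ ℚ.≤ 1ℚ
0≤1 = ℚ.<⇒≤ 0<1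

⟦⟧-nonNeg : ∀ b → 0ℚ ℚ.≤ ⟦ b ⟧
⟦⟧-nonNeg true  = 0≤1
⟦⟧-nonNeg false = ℚ.≤-refl

∑-nonNeg : (xs : List A) {f : A → ℚ} → (∀ {x} → x ∈ xs → 0ℚ ℚ.≤ f x) → 0ℚ ℚ.≤ ∑ xs f
∑-nonNeg []       _ = ℚ.≤-refl
∑-nonNeg (x ∷ xs) p = +ℚ-nonNeg (p (here refl)) (∑-nonNeg xs (p ∘ there))

∑-pos : (xs : List A) {f : A → ℚ} → (∀ {x} → x ∈ xs → 0ℚ ℚ.≤ f x) →
        ∀ {x} → x ∈ xs → 0ℚ ℚ.< f x → 0ℚ ℚ.< ∑ xs f
∑-pos (x ∷ xs) p (here refl) fx>0 = +ℚ-pos-nonNeg fx>0 (∑-nonNeg xs (p ∘ there))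
∑-pos (x ∷ xs) p (there x∈)    fx>0 = +ℚ-nonNeg-pos (p (here refl)) (∑-pos xs (p ∘ there) x∈ fx>0)

inv-pos : ∀ n → 0ℚ ℚ.< inv (suc n)
inv-pos n = ℚ.positive⁻¹ _ {{ℚ.1/pos⇒pos (ℕtoℚ (suc n)) {{ℚ.normalize-pos (suc n) 1}}}}

wt-pos : ∀ {ρ} → All (1 ≤_) ρ → 0ℚ ℚ.< wt ρ
wt-pos []                        = 0<1
wt-pos {suc r ∷ ρ} (s≤s _ ∷ pos) = *ℚ-pos (*ℚ-pos (+ℚ-pos-nonNeg 0<1 0≤1) (inv-pos (r + sum ρ))) (wt-pos pos)

-- Signs may be checked on compositions: the weights `wt` are positive, and grouping rearrangements
-- only adds nonnegative terms.
expansion⇒pPositive : ∀ {α n} (c : List ℕ → ℚ) → sum α ≡ n → (∀ {ρ} → OddComp n ρ → 0ℚ ℚ.≤ c ρ) →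
  (∀ m d → ℕtoℚ (ribbonCoeff α m d) ≡ ∑ (oddComps n n) (λ ρ → (wt ρ *ℚ c ρ) *ℚ powerSum ρ m (indicator d))) →
  pPositiveRibbon α
expansion⇒pPositive {α} {n} c refl c≥0 expand = a , a≥0 , λ m d → begin
  ℕtoℚ (ribbonCoeff α m d)
    ≡⟨ expand m d ⟩
  ∑ C (λ ρ → (wt ρ *ℚ c ρ) *ℚ powerSum ρ m (indicator d))
    ≡⟨ collect-expansion n C (λ ρ → wt ρ *ℚ c ρ) m (indicator d) (∈-oddComps⁻ n n) ⟩
  ∑ (partitions n) (λ lam → a lam *ℚ powerSum lam m (indicator d))
    ≡⟨ ∑-cong (partitions n) (λ lam → trans (cong (a lam *ℚ_) (sym (powerSumCoeff≡powerSum lam m d)))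
         (*ℚ-def (a lam) (ℕtoℚ (powerSumCoeff lam m d)))) ⟩
  ∑ (partitions n) (λ lam → a lam ℚ.* ℕtoℚ (powerSumCoeff lam m d))
    ≡⟨ sumℚ-map (λ lam → a lam ℚ.* ℕtoℚ (powerSumCoeff lam m d)) (partitions n) ⟨
  sumℚ (map (λ lam → a lam ℚ.* ℕtoℚ (powerSumCoeff lam m d)) (partitions n)) ∎
  where
  C = oddComps n n
  a : List ℕ → ℚ
  a = collect C (λ ρ → wt ρ *ℚ c ρ)
  a≥0 : ∀ lam → 0ℚ ℚ.≤ a lam
  a≥0 lam = ∑-nonNeg C λ {ρ} ρ∈ → *ℚ-nonNeg (⟦⟧-nonNeg (sort ρ == lam))
    (*ℚ-nonNeg (ℚ.<⇒≤ (wt-pos (OddComp⇒positive (∈-oddComps⁻ n n ρ∈)))) (c≥0 (∈-oddComps⁻ n n ρ∈)))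

sum-hookShape : ∀ i j → sum (hookShape i j) ≡ i + suc j
sum-hookShape zero    j = ℕ.+-identityʳ (suc j)
sum-hookShape (suc i) j = cong suc (sum-hookShape i j)

-- A record keeps i and j readable from the type, whereas `pPositiveRibbon (hookShape i j)` unfolds
-- to a statement about coefficients.
record HookPositive (i j : ℕ) : Set where
  no-eta-equality
  pattern
  constructor hookPositive
  field
    pPositive : pPositiveRibbon (hookShape i j)
open HookPositive

ribbonCoeff-expansion : ∀ i j m d → ℕtoℚ (ribbonCoeff (hookShape i j) m d) ≡
  ∑ (oddComps (i + suc j) (i + suc j)) (λ ρ → (wt ρ *ℚ Nalt ρ i) *ℚ powerSum ρ m (indicator d))
ribbonCoeff-expansion i j m d = trans (ribbonCoeff-hookShape i j m d) (Hook-expansion i j m (indicator d))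

hookPositive-sym : ∀ i j → HookPositive i j → HookPositive j i
hookPositive-sym i j (hookPositive (a , a≥0 , expand)) = hookPositive (a , a≥0 , λ m d → begin
  ℕtoℚ (ribbonCoeff (hookShape j i) m d)
    ≡⟨ ribbonCoeff-hookShape j i m d ⟩
  Hook j i m (indicator d)
    ≡⟨ Hook-sym j i m (indicator d) ⟩
  Hook i j m (indicator d)
    ≡⟨ ribbonCoeff-hookShape i j m d ⟨
  ℕtoℚ (ribbonCoeff (hookShape i j) m d)
    ≡⟨ expand m d ⟩
  sumℚ (map (λ lam → a lam ℚ.* ℕtoℚ (powerSumCoeff lam m d)) (partitions (sum (hookShape i j))))
    ≡⟨ cong (λ n → sumℚ (map (λ lam → a lam ℚ.* ℕtoℚ (powerSumCoeff lam m d)) (partitions n)))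
         (trans (sum-hookShape i j) (trans (ℕ.+-comm i (suc j)) (trans (sym (ℕ.+-suc j i)) (sym (sum-hookShape j i))))) ⟩
  sumℚ (map (λ lam → a lam ℚ.* ℕtoℚ (powerSumCoeff lam m d)) (partitions (sum (hookShape j i)))) ∎)

-- By linear independence every expansion has the collected coefficient at `sort ρ₀`. Only
-- rearrangements of ρ₀ contribute to it and `Nalt` agrees on them, so it equals `Nalt ρ₀ i` times a
-- sum `W` of weights, which is positive because ρ₀ itself is among them.
¬hookPositive : ∀ i j {ρ₀} → OddComp (i + suc j) ρ₀ → Nalt ρ₀ i ℚ.< 0ℚ → ¬ HookPositive i j
¬hookPositive i j {ρ₀} ρ₀⊢n neg (hookPositive (a , a≥0 , expand)) =
  ℚ.<-irrefl refl (ℚ.<-≤-trans (*ℚ-pos-neg W>0 neg) (subst (0ℚ ℚ.≤_) (trans (powerSum-independent n a b agree (sort-Partition ρ₀⊢n)) factor) (a≥0 (sort ρ₀))))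
  where
  n = i + suc j
  C = oddComps n n
  b : List ℕ → ℚ
  b = collect C (λ ρ → wt ρ *ℚ Nalt ρ i)
  agree : ∀ m d → ∑ (partitions n) (λ lam → a lam *ℚ powerSum lam m (indicator d))
                ≡ ∑ (partitions n) (λ lam → b lam *ℚ powerSum lam m (indicator d))
  agree m d = begin
    ∑ (partitions n) (λ lam → a lam *ℚ powerSum lam m (indicator d))
      ≡⟨ ∑-cong (partitions n) (λ lam → trans (cong (a lam *ℚ_) (sym (powerSumCoeff≡powerSum lam m d)))
           (*ℚ-def (a lam) (ℕtoℚ (powerSumCoeff lam m d)))) ⟩
    ∑ (partitions n) (λ lam → a lam ℚ.* ℕtoℚ (powerSumCoeff lam m d))
      ≡⟨ sumℚ-map (λ lam → a lam ℚ.* ℕtoℚ (powerSumCoeff lam m d)) (partitions n) ⟨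
    sumℚ (map (λ lam → a lam ℚ.* ℕtoℚ (powerSumCoeff lam m d)) (partitions n))
      ≡⟨ cong (λ n → sumℚ (map (λ lam → a lam ℚ.* ℕtoℚ (powerSumCoeff lam m d)) (partitions n))) (sum-hookShape i j) ⟨
    sumℚ (map (λ lam → a lam ℚ.* ℕtoℚ (powerSumCoeff lam m d)) (partitions (sum (hookShape i j))))
      ≡⟨ expand m d ⟨
    ℕtoℚ (ribbonCoeff (hookShape i j) m d)
      ≡⟨ ribbonCoeff-expansion i j m d ⟩
    ∑ C (λ ρ → (wt ρ *ℚ Nalt ρ i) *ℚ powerSum ρ m (indicator d))
      ≡⟨ collect-expansion n C (λ ρ → wt ρ *ℚ Nalt ρ i) m (indicator d) (∈-oddComps⁻ n n) ⟩
    ∑ (partitions n) (λ lam → b lam *ℚ powerSum lam m (indicator d)) ∎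
  W = ∑ C λ ρ → ⟦ sort ρ == sort ρ₀ ⟧ *ℚ wt ρ
  W>0 : 0ℚ ℚ.< W
  W>0 = ∑-pos C
    (λ {ρ} ρ∈ → *ℚ-nonNeg (⟦⟧-nonNeg (sort ρ == sort ρ₀)) (ℚ.<⇒≤ (wt-pos (OddComp⇒positive (∈-oddComps⁻ n n ρ∈)))))
    (∈-oddComps⁺ ρ₀⊢n ℕ.≤-refl)
    (subst (λ e → 0ℚ ℚ.< ⟦ e ⟧ *ℚ wt ρ₀) (sym (==-refl (sort ρ₀))) (*ℚ-pos 0<1 (wt-pos (OddComp⇒positive ρ₀⊢n))))
  factor : b (sort ρ₀) ≡ W *ℚ Nalt ρ₀ i
  factor = trans (∑-cong C λ ρ → term ρ (sort ρ == sort ρ₀) refl) (∑-*ʳ (Nalt ρ₀ i) C _)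
    where
    term : ∀ ρ e → (sort ρ == sort ρ₀) ≡ e → ⟦ e ⟧ *ℚ (wt ρ *ℚ Nalt ρ i) ≡ (⟦ e ⟧ *ℚ wt ρ) *ℚ Nalt ρ₀ i
    term ρ false _  = solve 3 (λ x y z → con 0 :* (x :* y) := (con 0 :* x) :* z) refl (wt ρ) (Nalt ρ i) (Nalt ρ₀ i)
    term ρ true  eq = trans (sym (K.*-assoc 1ℚ (wt ρ) (Nalt ρ i))) (cong ((1ℚ *ℚ wt ρ) *ℚ_) (Nalt-↭ ρ↭ρ₀ i))
      where
      ρ↭ρ₀ : ρ ↭ ρ₀
      ρ↭ρ₀ = ↭.trans (↭-sym (sort-↭ ρ)) (subst (_↭ ρ₀) (sym (==⇒≡ (sort ρ) (sort ρ₀) eq)) (sort-↭ ρ₀))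

-- Signs of the coefficients

opaque
  unfolding -ℚ_

  -1<0 : -ℚ 1ℚ ℚ.< 0ℚ
  -1<0 = ℚ.negative⁻¹ (ℚ.- 1ℚ)

odd-suc : ∀ n → odd (suc n) ≡ not (odd n)
odd-suc zero          = refl
odd-suc (suc zero)    = refl
odd-suc (suc (suc n)) = odd-suc n

odd-+ : ∀ m n → odd (m + n) ≡ (odd m xor odd n)
odd-+ zero          n = refl
odd-+ (suc zero)    n = odd-suc n
odd-+ (suc (suc m)) n = odd-+ m n

n%2 : ∀ n → n % 2 ≡ (if odd n then 1 else 0)
n%2 zero          = refl
n%2 (suc zero)    = refl
n%2 (suc (suc n)) = n%2 n

-1^-odd : ∀ i → odd i ≡ true → -1^ i ≡ -ℚ 1ℚ
-1^-odd (suc zero)    _ = refl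
-1^-odd (suc (suc i)) o = trans (-‿involutive (-1^ i)) (-1^-odd i o)

x+0≡x : ∀ {x y} → y ≡ 0ℚ → x +ℚ y ≡ x
x+0≡x {x} eq = trans (cong (x +ℚ_) eq) (K.+-identityʳ x)

-- The polynomial (1 + t³)/(1 + t) = 1 - t + t².
three : ℕ → ℚ
three = Nalt (3 ∷ [])

three-vanish : ∀ i → 3 ≤ i → three i ≡ 0ℚ
three-vanish (suc (suc (suc i))) _ =
  trans (cong (_+ℚ -1^ i) (-‿involutive (-ℚ (-1^ i)))) (K.-‿inverseˡ (-1^ i))
three-vanish (suc (suc zero))    (s≤s (s≤s ()))
three-vanish (suc zero)          (s≤s ())

three-odd : ∀ i → odd i ≡ true → three i ℚ.≤ 0ℚ
three-odd (suc zero)          _ = ℚ.<⇒≤ (subst (ℚ._< 0ℚ) (sym (K.+-identityʳ (-ℚ 1ℚ))) -1<0)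
three-odd (suc (suc (suc i))) _ = ℚ.≤-reflexive (three-vanish (3 + i) (s≤s (s≤s (s≤s z≤n))))

-- The difference i - b is odd, and in odd degrees 1 - t + t² has only the coefficients -1 and 0.
shift-three : ∀ b i → odd b ≡ true → odd i ≡ false → shift 0ℚ b three i ℚ.≤ 0ℚ
shift-three b i odd-b even-i with shiftView b i
... | outside i<b   = ℚ.≤-reflexive (shift-< 0ℚ three i<b)
... | inside x refl = subst (ℚ._≤ 0ℚ) (sym (shift-+ 0ℚ b three x)) (three-odd x odd-x)
  where
  odd-x : odd x ≡ true
  odd-x = not-injective (trans (sym (cong (_xor odd x) odd-b)) (trans (sym (odd-+ b x)) even-i))

shift-suc : ∀ a (h : ℕ → ℚ) → shift 0ℚ a h (suc a) ≡ h 1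
shift-suc a h = trans (cong (shift 0ℚ a h) (ℕ.+-comm 1 a)) (shift-+ 0ℚ a h 1)

Nalt-b3-1 : ∀ {b} → 3 ≤ b → Nalt (b ∷ 3 ∷ []) 1 ℚ.< 0ℚ
Nalt-b3-1 {b} 3≤b = subst (ℚ._< 0ℚ) (sym (trans
  (x+0≡x (shift-< 0ℚ three (ℕ.≤-trans (s≤s (s≤s z≤n)) 3≤b))) (K.+-identityʳ (-ℚ 1ℚ)))) -1<0

Nalt-b3-even : ∀ {b} i → odd b ≡ true → odd i ≡ false → 3 ≤ i → Nalt (b ∷ 3 ∷ []) i ℚ.≤ 0ℚ
Nalt-b3-even {b} i odd-b even-i 3≤i =
  +ℚ-nonPos (ℚ.≤-reflexive (three-vanish i 3≤i)) (shift-three b i odd-b even-i)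

even-suc : ∀ {a} → odd a ≡ true → odd (suc a) ≡ false
even-suc {a} odd-a = trans (odd-suc a) (cong not odd-a)

-- Here n = i + j + 1 is odd and can be a single part. Below degree n only 1/(1 + t) is seen, whose
-- coefficient at the odd degree i is -1.
¬hookPositive-odd-odd : ∀ i j → odd i ≡ true → odd j ≡ true → ¬ HookPositive i j
¬hookPositive-odd-odd i j odd-i odd-j = ¬hookPositive i j
  (subst (λ n → OddComp n (i + suc j ∷ [])) (ℕ.+-identityʳ (i + suc j)) (odd-n ∷ []))
  (subst (ℚ._< 0ℚ) (sym (trans (x+0≡x (shift-< 0ℚ -1^ (ℕ.m<m+n i z<s))) (-1^-odd i odd-i))) -1<0)
  where
  odd-n : odd (i + suc j) ≡ true
  odd-n = trans (odd-+ i (suc j)) (cong₂ _xor_ odd-i (even-suc {j} odd-j))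

-- With a = i - 1 and b = j - 1, degree a + 1 of (1 + t^a)(1 + t^b)(1 - t + t²) receives -1 from t^a
-- · (-t). The terms without t^a are nonpositive by degree and parity.
¬hookPositive-even-even : ∀ a b → odd a ≡ true → odd b ≡ true → 3 ≤ a → 3 ≤ b → ¬ HookPositive (suc a) (suc b)
¬hookPositive-even-even a b odd-a odd-b 3≤a 3≤b = ¬hookPositive (suc a) (suc b)
  (subst (λ n → OddComp n (a ∷ b ∷ 3 ∷ [])) (total a b) (odd-a ∷ odd-b ∷ refl ∷ []))
  (+ℚ-nonPos-neg (Nalt-b3-even {b} (suc a) odd-b (even-suc {a} odd-a) (ℕ.m≤n⇒m≤1+n 3≤a))
    (subst (ℚ._< 0ℚ) (sym (shift-suc a (Nalt (b ∷ 3 ∷ [])))) (Nalt-b3-1 3≤b)))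
  where
  total : ∀ a b → a + (b + 3) ≡ suc a + suc (suc b)
  total = solve-∀

-- With b = j - 1, both parts i + 2 and b are odd and exceed i, so degree i sees only 1/(1 + t), and
-- i is odd.
¬hookPositive-odd-even : ∀ i b → odd i ≡ true → odd b ≡ true → 2 + i ≤ b → ¬ HookPositive i (suc b)
¬hookPositive-odd-even i b odd-i odd-b 2+i≤b = ¬hookPositive i (suc b)
  (subst (λ n → OddComp n (2 + i ∷ b ∷ [])) (total i b) (odd-i ∷ odd-b ∷ []))
  (subst (ℚ._< 0ℚ) (sym (trans (x+0≡x (shift-< 0ℚ (Nalt (b ∷ [])) (ℕ.m≤n⇒m≤1+n (ℕ.n<1+n i))))
    (trans (x+0≡x (shift-< 0ℚ -1^ (ℕ.<-≤-trans (ℕ.m≤n⇒m≤1+n (ℕ.n<1+n i)) 2+i≤b))) (-1^-odd i odd-i)))) -1<0)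
  where
  total : ∀ i b → 2 + i + (b + 0) ≡ i + suc (suc b)
  total = solve-∀

-- With a = i - 1 and b = j - 4. Since n is even, the number of odd parts must be even, and a second
-- 3 is added to the pattern a, b, 3. The -1 again comes from t^a · (-t), and the terms without t^a
-- stay nonpositive.
¬hookPositive-even-odd : ∀ a b → odd a ≡ true → odd b ≡ true → 3 ≤ a → a ≤ b → ¬ HookPositive (suc a) (4 + b)
¬hookPositive-even-odd (suc (suc (suc a))) b odd-a odd-b 3≤a a≤b = ¬hookPositive (4 + a) (4 + b)
  (subst (λ n → OddComp n (3 + a ∷ 3 ∷ b ∷ 3 ∷ [])) (total a b) (odd-a ∷ refl ∷ odd-b ∷ refl ∷ []))
  (+ℚ-nonPos-neg
    (+ℚ-nonPos (Nalt-b3-even {b} (4 + a) odd-b (even-suc {1 + a} odd-a) (s≤s (s≤s (s≤s z≤n))))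
      -- Using the t³ of the second part 3 leaves degree i - 3, which is odd and less than b.
      (+ℚ-nonPos (three-odd (1 + a) odd-a)
        (ℚ.≤-reflexive (shift-< 0ℚ three (ℕ.≤-trans (ℕ.n≤1+n (2 + a)) a≤b)))))
    (subst (ℚ._< 0ℚ) (sym (trans (shift-suc (3 + a) (Nalt (3 ∷ b ∷ 3 ∷ []))) (K.+-identityʳ _)))
      (Nalt-b3-1 (ℕ.≤-trans 3≤a a≤b))))
  where
  total : ∀ a b → 3 + a + (3 + (b + (3 + 0))) ≡ 4 + a + suc (4 + b)
  total = solve-∀
¬hookPositive-even-odd (suc zero) b _ _ (s≤s ())
¬hookPositive-even-odd (suc (suc zero)) b _ _ (s≤s (s≤s ()))

Nalt-0 : ∀ {n ρ} → OddComp n ρ → Nalt ρ 0 ≡ 1ℚ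
Nalt-0 []                    = refl
Nalt-0 (_∷_ {suc r} _ c) = trans (x+0≡x refl) (Nalt-0 c)

-- With s parts equal to 1, Nalt ρ 1 = s − 1 and Nalt ρ 2 is the binomial coefficient (s − 1 choose 2).
Nalt-1-2 : ∀ {n ρ} → OddComp n ρ →
  (Nalt ρ 1 ≡ -ℚ 1ℚ × Nalt ρ 2 ≡ 1ℚ) ⊎ (0ℚ ℚ.≤ Nalt ρ 1 × 0ℚ ℚ.≤ Nalt ρ 2)
Nalt-1-2 [] = inj₁ (refl , -‿involutive 1ℚ)
Nalt-1-2 (_∷_ {suc zero} _ c) with Nalt-1-2 c
... | inj₁ (p , q) = inj₂
  ( ℚ.≤-reflexive (sym (trans (cong₂ _+ℚ_ p (Nalt-0 c)) (K.-‿inverseˡ 1ℚ)))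
  , ℚ.≤-reflexive (sym (trans (cong₂ _+ℚ_ q p) (K.-‿inverseʳ 1ℚ))) )
... | inj₂ (p , q) = inj₂ (+ℚ-nonNeg p (subst (0ℚ ℚ.≤_) (sym (Nalt-0 c)) 0≤1) , +ℚ-nonNeg q p)
Nalt-1-2 (_∷_ {suc (suc (suc r))} _ c) with Nalt-1-2 c
... | inj₁ (p , q) = inj₁ (trans (x+0≡x refl) p , trans (x+0≡x refl) q)
... | inj₂ (p , q) = inj₂ (+ℚ-nonNeg p ℚ.≤-refl , +ℚ-nonNeg q ℚ.≤-refl)

hookPositive-0 : ∀ j → HookPositive 0 j
hookPositive-0 j = hookPositive (expansion⇒pPositive {hookShape 0 j} (λ ρ → Nalt ρ 0) (sum-hookShape 0 j)
  (λ c → subst (0ℚ ℚ.≤_) (sym (Nalt-0 c)) 0≤1) (ribbonCoeff-expansion 0 j))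

hookPositive-2 : ∀ j → HookPositive 2 j
hookPositive-2 j = hookPositive (expansion⇒pPositive {hookShape 2 j} (λ ρ → Nalt ρ 2) (sum-hookShape 2 j)
  (λ c → [ (λ { (_ , q) → subst (0ℚ ℚ.≤_) (sym q) 0≤1 }) , proj₂ ]′ (Nalt-1-2 c)) (ribbonCoeff-expansion 2 j))

N-nonNeg : ∀ ρ i → 0ℚ ℚ.≤ N ρ i
N-nonNeg []      zero    = 0≤1
N-nonNeg []      (suc i) = ℚ.≤-refl
N-nonNeg (r ∷ ρ) i       = +ℚ-nonNeg (N-nonNeg ρ i) (shifted r i)
  where
  shifted : ∀ r i → 0ℚ ℚ.≤ shift 0ℚ r (N ρ) i
  shifted zero    i       = N-nonNeg ρ i
  shifted (suc r) zero    = ℚ.≤-refl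
  shifted (suc r) (suc i) = shifted r i

-- The two hooks in `Hook-suc i i` are equal by symmetry, so coefficients can be taken from half of
-- `N`, a product without denominator, instead of `Nalt`.
hookPositive-middle : ∀ i → HookPositive i (suc i)
hookPositive-middle i = hookPositive (expansion⇒pPositive {hookShape i (suc i)} (λ ρ → inv 2 *ℚ N ρ (suc i))
  (trans (sum-hookShape i (suc i)) (ℕ.+-suc i (suc i)))
  (λ {ρ} _ → *ℚ-nonNeg (ℚ.<⇒≤ (inv-pos 1)) (N-nonNeg ρ (suc i))) λ m d → begin
    ℕtoℚ (ribbonCoeff (hookShape i (suc i)) m d)
      ≡⟨ ribbonCoeff-hookShape i (suc i) m d ⟩
    H m d
      ≡⟨ halve (H m d) ⟨
    inv 2 *ℚ (H m d +ℚ H m d)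
      ≡⟨ cong (λ x → inv 2 *ℚ (x +ℚ H m d)) (Hook-sym i (suc i) m (indicator d)) ⟩
    inv 2 *ℚ (Hook (suc i) i m (indicator d) +ℚ H m d)
      ≡⟨ cong (inv 2 *ℚ_) (trans (Hook-suc i i m (indicator d))
           (rowPairs-expansion n n (suc i) (suc i) refl ℕ.≤-refl (indicator d))) ⟩
    inv 2 *ℚ ∑ (oddComps n n) (λ ρ → (wt ρ *ℚ N ρ (suc i)) *ℚ powerSum ρ m (indicator d))
      ≡⟨ ∑-*ˡ (inv 2) (oddComps n n) _ ⟨
    ∑ (oddComps n n) (λ ρ → inv 2 *ℚ ((wt ρ *ℚ N ρ (suc i)) *ℚ powerSum ρ m (indicator d)))
      ≡⟨ ∑-cong (oddComps n n) (λ ρ → solve 4 (λ h w x p → h :* ((w :* x) :* p) := (w :* (h :* x)) :* p) refl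
           (inv 2) (wt ρ) (N ρ (suc i)) (powerSum ρ m (indicator d))) ⟩
    ∑ (oddComps n n) (λ ρ → (wt ρ *ℚ (inv 2 *ℚ N ρ (suc i))) *ℚ powerSum ρ m (indicator d)) ∎)
  where
  n = suc i + suc i
  H : ∀ m → _ → ℚ
  H m d = Hook i (suc i) m (indicator d)
  halve : ∀ x → inv 2 *ℚ (x +ℚ x) ≡ x
  halve x = trans (solve 2 (λ h x → h :* (x :+ x) := (h :* con 2) :* x) refl (inv 2) x)
    (trans (cong (_*ℚ x) (trans (cong (inv 2 *ℚ_) (sym (ℕtoℚ-+ 1 1))) (inv-inverse 1))) (K.*-identityˡ x))

-- Classification

-- A large even index is given through its odd predecessor, because that is the part entering the
-- witnesses.
data EvenView : ℕ → Set where
  isZero  : EvenView 0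
  isTwo   : EvenView 2
  isLarge : ∀ a → odd a ≡ true → 3 ≤ a → EvenView (suc a)

evenView : ∀ i → odd i ≡ false → EvenView i
evenView zero                       _      = isZero
evenView (suc (suc zero))           _      = isTwo
evenView (suc (suc (suc (suc i)))) even-i =
  isLarge (3 + i) (trans (odd-suc i) (cong not even-i)) (s≤s (s≤s (s≤s z≤n)))

odd-total : ∀ i j → odd i ≡ odd j → HookPositive i j → i ≡ 0 ⊎ i ≡ 2 ⊎ j ≡ 0 ⊎ j ≡ 2
odd-total i j same pos with odd i in odd-i
... | true  = contradiction pos (¬hookPositive-odd-odd i j odd-i (sym same))
... | false with evenView i odd-i | evenView j (sym same)
...   | isZero              | _                  = inj₁ refl
...   | isTwo               | _                  = inj₂ (inj₁ refl)
...   | isLarge a _ _       | isZero             = inj₂ (inj₂ (inj₁ refl))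
...   | isLarge a _ _       | isTwo              = inj₂ (inj₂ (inj₂ refl))
...   | isLarge a odd-a 3≤a | isLarge b odd-b 3≤b =
  contradiction pos (¬hookPositive-even-even a b odd-a odd-b 3≤a 3≤b)

-- The gap d = j - i - 1 is even. For d = 0 the hook is the middle one; for d ≥ 2 there is j ≥ i +
-- 3, the room needed by the witnesses for odd and for large even i.
even-total-< : ∀ i d → odd d ≡ false → HookPositive i (suc (i + d)) → i ≡ 0 ⊎ i ≡ 2 ⊎ d ≡ 0
even-total-< i zero          _      pos = inj₂ (inj₂ refl)
even-total-< i (suc (suc d)) even-d pos with odd i in odd-i
... | true  = contradiction pos (¬hookPositive-odd-even i (i + (2 + d)) odd-i
  (trans (odd-+ i (2 + d)) (cong₂ _xor_ odd-i even-d))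
  (subst (_≤ i + (2 + d)) (ℕ.+-comm i 2) (ℕ.+-monoʳ-≤ i (s≤s (s≤s z≤n)))))
... | false with evenView i odd-i
...   | isZero              = inj₁ refl
...   | isTwo               = inj₂ (inj₁ refl)
...   | isLarge a odd-a 3≤a = contradiction (subst (HookPositive (suc a)) (total a d) pos)
  (¬hookPositive-even-odd a (a + d) odd-a (trans (odd-+ a d) (cong₂ _xor_ odd-a even-d)) 3≤a (ℕ.m≤m+n a d))
  where
  total : ∀ a d → suc (suc a + (2 + d)) ≡ 4 + (a + d)
  total = solve-∀

even-gap : ∀ i d → odd (i + suc (i + d)) ≡ true → odd d ≡ false
even-gap i d p = go (odd i) (odd d) (trans (sym (trans (odd-+ i (suc (i + d)))
  (cong (odd i xor_) (trans (odd-suc (i + d)) (cong not (odd-+ i d)))))) p)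
  where
  go : ∀ a b → (a xor not (a xor b)) ≡ true → b ≡ false
  go _     false _ = refl
  go true  true ()
  go false true ()

even-total : ∀ i j → odd (i + j) ≡ true → HookPositive i j →
  i ≡ 0 ⊎ i ≡ 2 ⊎ j ≡ suc i ⊎ i ≡ suc j ⊎ j ≡ 2 ⊎ j ≡ 0
even-total i j odd-i+j pos with compare i j
... | equal i = contradiction (trans (sym odd-i+j) (trans (odd-+ i i) (xor-same (odd i)))) λ ()
... | less i d with even-total-< i d (even-gap i d odd-i+j) pos
...   | inj₁ i≡0           = inj₁ i≡0
...   | inj₂ (inj₁ i≡2)    = inj₂ (inj₁ i≡2)
...   | inj₂ (inj₂ refl) = inj₂ (inj₂ (inj₁ (cong suc (ℕ.+-identityʳ i))))
even-total i j odd-i+j pos | greater j d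
  with even-total-< j d (even-gap j d (trans (cong odd (ℕ.+-comm j (suc (j + d)))) odd-i+j)) (hookPositive-sym _ _ pos)
...   | inj₁ j≡0           = inj₂ (inj₂ (inj₂ (inj₂ (inj₂ j≡0))))
...   | inj₂ (inj₁ j≡2)    = inj₂ (inj₂ (inj₂ (inj₂ (inj₁ j≡2))))
...   | inj₂ (inj₂ refl) = inj₂ (inj₂ (inj₂ (inj₁ (cong suc (ℕ.+-identityʳ j)))))

triangle-hookShape : ∀ i j → triangle (suc i + j) (suc i) ≡ hookShape i j
triangle-hookShape i j = cong (λ l → replicate i 1 ++ l ∷ [])
  (trans (cong (_+ 1) (ℕ.m+n∸m≡n i j)) (ℕ.+-comm j 1))

-- Translation between (i, j) and (n, k)

module _ (i j : ℕ) where
  private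
    n = suc i + j
    k = suc i

  fromTriangle : pPositiveRibbon (triangle n k) → HookPositive i j
  fromTriangle pos = hookPositive (subst pPositiveRibbon (triangle-hookShape i j) pos)

  toTriangle : HookPositive i j → pPositiveRibbon (triangle n k)
  toTriangle pos = subst pPositiveRibbon (sym (triangle-hookShape i j)) (pPositive pos)

  small-case : n ≤ 2 → pPositiveRibbon (triangle n k)
  -- At most two boxes always form a single row or a single column.
  small-case n≤2 = toTriangle (cases i j n≤2)
    where
    cases : ∀ i j → suc (i + j) ≤ 2 → HookPositive i j
    cases zero          j       _ = hookPositive-0 j
    cases (suc zero)    zero    _ = hookPositive-sym 0 1 (hookPositive-0 1)
    cases (suc zero)    (suc j) (s≤s (s≤s ()))
    cases (suc (suc i)) j       (s≤s (s≤s ()))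

  j≡0⇒k≡n : j ≡ 0 → k ≡ n
  j≡0⇒k≡n refl = sym (ℕ.+-identityʳ k)

  k≡n⇒j≡0 : k ≡ n → j ≡ 0
  k≡n⇒j≡0 eq = sym (ℕ.+-cancelˡ-≡ k 0 j (trans (ℕ.+-identityʳ k) eq))

  j≡2⇒k≡n∸2 : j ≡ 2 → k ≡ n ∸ 2
  j≡2⇒k≡n∸2 refl = sym (ℕ.m+n∸n≡m k 2)

  k≡n∸2⇒j≡2 : 2 ≤ n → k ≡ n ∸ 2 → j ≡ 2
  k≡n∸2⇒j≡2 2≤n eq = sym (ℕ.+-cancelˡ-≡ k 2 j (trans (cong (_+ 2) eq) (ℕ.m∸n+n≡m 2≤n)))

  n≡h*2⇒n/2≡h : ∀ h → n ≡ h * 2 → n / 2 ≡ h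
  n≡h*2⇒n/2≡h h eq = trans (cong (_/ 2) eq) (m*n/n≡m h 2)

  j≡1+i⇒k≡n/2 : j ≡ suc i → k ≡ n / 2
  j≡1+i⇒k≡n/2 j≡1+i = sym (n≡h*2⇒n/2≡h k (trans (cong (k +_) j≡1+i) (k+k≡k*2 k)))
    where
    k+k≡k*2 : ∀ k → k + k ≡ k * 2
    k+k≡k*2 = solve-∀

  i≡1+j⇒k≡n/2+1 : i ≡ suc j → k ≡ n / 2 + 1
  i≡1+j⇒k≡n/2+1 i≡1+j = sym (trans (cong (_+ 1) (n≡h*2⇒n/2≡h i
    (trans (sym (ℕ.+-suc i j)) (trans (cong (i +_) (sym i≡1+j)) (i+i≡i*2 i))))) (ℕ.+-comm i 1))
    where
    i+i≡i*2 : ∀ i → i + i ≡ i * 2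
    i+i≡i*2 = solve-∀

  n≡[n/2]*2 : n % 2 ≡ 0 → n ≡ n / 2 * 2
  n≡[n/2]*2 n-even = trans (m≡m%n+[m/n]*n n 2) (cong (_+ n / 2 * 2) n-even)

  k≡n/2⇒j≡1+i : n % 2 ≡ 0 → k ≡ n / 2 → j ≡ suc i
  k≡n/2⇒j≡1+i n-even eq = ℕ.+-cancelˡ-≡ k j (suc i)
    (trans (n≡[n/2]*2 n-even) (trans (cong (_* 2) (sym eq)) (k*2≡k+k k)))
    where
    k*2≡k+k : ∀ k → k * 2 ≡ k + k
    k*2≡k+k = solve-∀

  k≡n/2+1⇒i≡1+j : n % 2 ≡ 0 → k ≡ n / 2 + 1 → i ≡ suc j
  k≡n/2+1⇒i≡1+j n-even eq = sym (ℕ.+-cancelˡ-≡ i (suc j) i (trans (ℕ.+-suc i j)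
    (trans (n≡[n/2]*2 n-even) (trans (cong (_* 2) (sym i≡n/2)) (i*2≡i+i i)))))
    where
    i≡n/2 : i ≡ n / 2
    i≡n/2 = ℕ.suc-injective (trans eq (ℕ.+-comm (n / 2) 1))
    i*2≡i+i : ∀ i → i * 2 ≡ i + i
    i*2≡i+i = solve-∀

  odd-case : n % 2 ≡ 1 → 3 ≤ n →
    pPositiveRibbon (triangle n k) ⇔ (k ≡ 1 ⊎ k ≡ 3 ⊎ k ≡ n ∸ 2 ⊎ k ≡ n)
  odd-case n-odd 3≤n = mk⇔ (to ∘ fromTriangle) (toTriangle ∘ from)
    where
    same : odd i ≡ odd j
    same = go (odd i) (odd j) (subst (λ o → (if o then 1 else 0) ≡ 1)
      (trans (odd-suc (i + j)) (cong not (odd-+ i j))) (trans (sym (n%2 n)) n-odd))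
      where
      go : ∀ a b → (if not (a xor b) then 1 else 0) ≡ 1 → a ≡ b
      go false false _ = refl
      go true  true  _ = refl
      go false true  ()
      go true  false ()
    to : HookPositive i j → k ≡ 1 ⊎ k ≡ 3 ⊎ k ≡ n ∸ 2 ⊎ k ≡ n
    to pos with odd-total i j same pos
    ... | inj₁ i≡0               = inj₁ (cong suc i≡0)
    ... | inj₂ (inj₁ i≡2)        = inj₂ (inj₁ (cong suc i≡2))
    ... | inj₂ (inj₂ (inj₁ j≡0)) = inj₂ (inj₂ (inj₂ (j≡0⇒k≡n j≡0)))
    ... | inj₂ (inj₂ (inj₂ j≡2)) = inj₂ (inj₂ (inj₁ (j≡2⇒k≡n∸2 j≡2)))
    from : k ≡ 1 ⊎ k ≡ 3 ⊎ k ≡ n ∸ 2 ⊎ k ≡ n → HookPositive i j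
    from (inj₁ refl)              = hookPositive-0 j
    from (inj₂ (inj₁ refl))       = hookPositive-2 j
    from (inj₂ (inj₂ (inj₁ k≡n∸2))) = subst (HookPositive i)
      (sym (k≡n∸2⇒j≡2 (ℕ.≤-trans (ℕ.n≤1+n 2) 3≤n) k≡n∸2)) (hookPositive-sym 2 i (hookPositive-2 i))
    from (inj₂ (inj₂ (inj₂ k≡n)))   = subst (HookPositive i)
      (sym (k≡n⇒j≡0 k≡n)) (hookPositive-sym 0 i (hookPositive-0 i))

  even-case : n % 2 ≡ 0 → 4 ≤ n →
    pPositiveRibbon (triangle n k) ⇔ (k ≡ 1 ⊎ k ≡ 3 ⊎ k ≡ n / 2 ⊎ k ≡ n / 2 + 1 ⊎ k ≡ n ∸ 2 ⊎ k ≡ n)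
  even-case n-even 4≤n = mk⇔ (to ∘ fromTriangle) (toTriangle ∘ from)
    where
    odd-i+j : odd (i + j) ≡ true
    odd-i+j = go (odd (i + j)) (subst (λ o → (if o then 1 else 0) ≡ 0) (odd-suc (i + j)) (trans (sym (n%2 n)) n-even))
      where
      go : ∀ a → (if not a then 1 else 0) ≡ 0 → a ≡ true
      go true  _ = refl
      go false ()
    to : HookPositive i j → k ≡ 1 ⊎ k ≡ 3 ⊎ k ≡ n / 2 ⊎ k ≡ n / 2 + 1 ⊎ k ≡ n ∸ 2 ⊎ k ≡ n
    to pos with even-total i j odd-i+j pos
    ... | inj₁ i≡0                             = inj₁ (cong suc i≡0)
    ... | inj₂ (inj₁ i≡2)                      = inj₂ (inj₁ (cong suc i≡2))
    ... | inj₂ (inj₂ (inj₁ j≡1+i))             = inj₂ (inj₂ (inj₁ (j≡1+i⇒k≡n/2 j≡1+i)))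
    ... | inj₂ (inj₂ (inj₂ (inj₁ i≡1+j)))      = inj₂ (inj₂ (inj₂ (inj₁ (i≡1+j⇒k≡n/2+1 i≡1+j))))
    ... | inj₂ (inj₂ (inj₂ (inj₂ (inj₁ j≡2)))) = inj₂ (inj₂ (inj₂ (inj₂ (inj₁ (j≡2⇒k≡n∸2 j≡2)))))
    ... | inj₂ (inj₂ (inj₂ (inj₂ (inj₂ j≡0)))) = inj₂ (inj₂ (inj₂ (inj₂ (inj₂ (j≡0⇒k≡n j≡0)))))
    from : k ≡ 1 ⊎ k ≡ 3 ⊎ k ≡ n / 2 ⊎ k ≡ n / 2 + 1 ⊎ k ≡ n ∸ 2 ⊎ k ≡ n → HookPositive i j
    from (inj₁ refl)                                = hookPositive-0 j
    from (inj₂ (inj₁ refl))                         = hookPositive-2 j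
    from (inj₂ (inj₂ (inj₁ k≡n/2)))                   =
      subst (HookPositive i) (sym (k≡n/2⇒j≡1+i n-even k≡n/2)) (hookPositive-middle i)
    from (inj₂ (inj₂ (inj₂ (inj₁ k≡n/2+1))))          =
      subst (λ i → HookPositive i j) (sym (k≡n/2+1⇒i≡1+j n-even k≡n/2+1))
        (hookPositive-sym j (suc j) (hookPositive-middle j))
    from (inj₂ (inj₂ (inj₂ (inj₂ (inj₁ k≡n∸2)))))     = subst (HookPositive i)
      (sym (k≡n∸2⇒j≡2 (ℕ.≤-trans (ℕ.m≤m+n 2 2) 4≤n) k≡n∸2)) (hookPositive-sym 2 i (hookPositive-2 i))
    from (inj₂ (inj₂ (inj₂ (inj₂ (inj₂ k≡n)))))       = subst (HookPositive i)
      (sym (k≡n⇒j≡0 k≡n)) (hookPositive-sym 0 i (hookPositive-0 i))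

Claim : ℕ → ℕ → Set
Claim n k =
  (n ≤ 2 → pPositiveRibbon (triangle n k))
  × (n % 2 ≡ 1 → 3 ≤ n →
      pPositiveRibbon (triangle n k) ⇔ (k ≡ 1 ⊎ k ≡ 3 ⊎ k ≡ n ∸ 2 ⊎ k ≡ n))
  × (n % 2 ≡ 0 → 4 ≤ n →
      pPositiveRibbon (triangle n k) ⇔ (k ≡ 1 ⊎ k ≡ 3 ⊎ k ≡ n / 2 ⊎ k ≡ n / 2 + 1 ⊎ k ≡ n ∸ 2 ⊎ k ≡ n))

theorem4p7 : (n k : ℕ) → 1 ≤ k → k ≤ n →
    (n ≤ 2 → pPositiveRibbon (triangle n k))
    × (n % 2 ≡ 1 → 3 ≤ n →
    (pPositiveRibbon (triangle n k)
    ⇔ (k ≡ 1 ⊎ k ≡ 3 ⊎ k ≡ n ∸ 2 ⊎ k ≡ n)))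
    × (n % 2 ≡ 0 → 4 ≤ n →
    (pPositiveRibbon (triangle n k)
    ⇔ (k ≡ 1 ⊎ k ≡ 3 ⊎ k ≡ n / 2 ⊎ k ≡ n / 2 + 1 ⊎ k ≡ n ∸ 2 ⊎ k ≡ n)))
theorem4p7 n (suc i) _ k≤n =
  let j , k+j≡n = ℕ.m≤n⇒∃[o]m+o≡n k≤n
  in subst (λ n → Claim n (suc i)) k+j≡n (small-case i j , odd-case i j , even-case i j)
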